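{- Let $t\ge2$, $r\ge1$, $N=t+2r$, $\zeta=e^{2\pi i/t}$, and let $\lambda$ be a partition with at most $N$ parts. Suppose $s_\lambda(1,\zeta,\dots,\zeta^{t-1},z_1,z_1^{ -1},\dots,z_r,z_r^{ -1})\equiv0$ identically in $z_1,\dots,z_r$, and $n_i\ge1$ for every residue $i$ modulo $t$. Then $t$ is even, $|G|=2$, $\min\mathcal{S}+\max\mathcal{S}=\tau$, and $\mathcal{S}\setminus g_{\mathrm{com}}$ is symmetric about $\tau/2$, i.e. stable under $x\mapsto\tau-x$.
   Context: For $\lambda=(\lambda_1\ge\dots\ge\lambda_N\ge0)$ let $\beta_j=\lambda_j+N-j$ ($1\le j\le N$) and let $n_i$ be the number of $\beta_j\equiv i\pmod t$. Let $\mathcal{E}=\{i\in\mathbb{Z}/t:n_i\ge2\}$ and $\mathcal{S}=\{\beta_j:\beta_j\bmod t\in\mathcal{E}\}$; with $e=|\mathcal{E}|$ and all $n_i\ge1$ one has $|\mathcal{S}|=2r+e$. A choice $g$ is a subset of $\mathcal{S}$ containing exactly one value in each class $i\in\mathcal{E}$; put $T_g=\mathcal{S}\setminus g$, a set of $2r$ integers. For $T=\{u_1>\dots>u_{2r}\}$ put $\deg(T)=\sum_{a\le r}u_a-\sum_{a>r}u_a$; $G$ is the set of choices $g$ maximizing $\deg(T_g)$. When $|G|=2$, $g_{\mathrm{com}}$ is the intersection of the two elements of $G$. For $i\in\mathcal{E}$ list the values of $\mathcal{S}$ in class $i$ as $c_{i,1}>\dots>c_{i,n_i}$ and let $\Delta_i(k)=c_{i,k}+c_{i,k+1}$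 for $1\le k\le n_i-1$; there are $2r$ of these numbers in all, and $\tau$ is the $r$-th largest of them counted with multiplicity. -}

module Defs where

open import Algebra.Apartness.Bundles using (HeytingField; HeytingCommutativeRing)
open import Algebra.Bundles using (CommutativeRing)
import Algebra.Properties.Semiring.Exp as Exp
import Algebra.Properties.Semiring.Mult as Mult
import Algebra.Properties.Semiring.Sum as Sum
import Data.Fin.Base as Fin
open import Data.Fin.Base using (Fin; toℕ; opposite; punchIn)
open import Data.Fin.Properties using (_≟_)
open import Data.Fin.Subset using (Subset; ∣_∣; _∩_; _─_)
  renaming (_∈_ to _∈ˢ_; _⊆_ to _⊆ˢ_)
open import Data.Fin.Subset.Properties using (_∈?_)
import Data.Integer.Base as ℤ
open import Data.Integer.Base using (ℤ)
open import Data.List.Base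
  using (List; map; filter; allFin; concatMap; zipWith; take; drop; head)
open import Data.List.Membership.Propositional using (_∈_)
import Data.List.Sort as Sort
open import Data.Maybe.Base using (Maybe)
open import Data.Nat.Base using (ℕ; zero; suc; _+_; _*_; _∸_; _≤_; _<_; NonZero)
open import Data.Nat.DivMod using (_mod_)
open import Data.Nat.ListAction using (sum)
open import Data.Nat.Properties using (≤-decTotalOrder; _≤?_)
open import Data.Product.Base using (_×_; ∃; proj₁)
open import Data.Vec.Base using (tabulate)
open import Data.Vec.Functional using (Vector; []; _∷_; _++_; concat)
open import Function.Base using (_∘_)
open import Level using (Level; _⊔_)
open import Relation.Binary.Construct.Flip.EqAndOrd using (decTotalOrder)
open import Relation.Binary.PropositionalEquality.Core using (_≡_)
open import Relation.Nullary.Decidable.Core using (does)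

-- A partition with at most N parts is a weakly decreasing vector of N naturals
-- (padded with zeros).  Indices start at 0, so the N - j of the usual
-- 1-indexed convention is  toℕ (opposite j).

IsPartition : ∀ {N} → Vector ℕ N → Set
IsPartition lam = ∀ {i j} → i Fin.≤ j → lam j ≤ lam i

staircase : ∀ {N} → Vector ℕ N
staircase j = toℕ (opposite j)

shifted : ∀ {N} → Vector ℕ N → Vector ℕ N
shifted lam j = lam j + staircase j

-- The role of ℂ is played by an arbitrary field K of characteristic 0 with a
-- primitive t-th root of unity ζ; K = ℂ, ζ = exp(2πi/t) is an instance.

module Schur {c ℓ₁ ℓ₂ : Level} (K : HeytingField c ℓ₁ ℓ₂) where

  open HeytingField K
    renaming (_*_ to _*ᴷ_; -_ to -ᴷ_)
    using (Carrier; _≈_; _#_; 0#; 1#; #⇒invertible)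
  open CommutativeRing
    (HeytingCommutativeRing.commutativeRing (HeytingField.heytingCommutativeRing K))
    using (semiring)
  open Exp semiring using (_^_)
  open Mult semiring using () renaming (_×_ to _·_)
  open Sum semiring using () renaming (sum to ∑)

  CharacteristicZero : Set ℓ₂
  CharacteristicZero = ∀ n → (suc n · 1#) # 0#

  IsPrimitiveRoot : ℕ → Carrier → Set (ℓ₁ ⊔ ℓ₂)
  IsPrimitiveRoot t ζ = (ζ ^ t) ≈ 1# × (∀ k → 0 < k → k < t → (ζ ^ k) # 1#)

  -- The library provides an inverse of  x - 0# , which is  ≈ x .
  inv : ∀ {x} → x # 0# → Carrier
  inv x#0 = proj₁ (#⇒invertible x#0)

  -- Laplace expansion along the first row.
  det : ∀ {n} → (Fin n → Fin n → Carrier) → Carrier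
  det {zero}  A = 1#
  det {suc n} A = ∑ λ j →
    ((-ᴷ 1#) ^ toℕ j) *ᴷ (A Fin.zero j *ᴷ det λ i k → A (Fin.suc i) (punchIn j k))

  alternant : ∀ {N} → Vector ℕ N → Vector Carrier N → Carrier
  alternant e x = det λ i j → x i ^ e j

  -- The bialternant definition of the Schur polynomial, at a point where the
  -- Vandermonde determinant in the denominator is invertible.
  schur : ∀ {N} → Vector ℕ N → (x : Vector Carrier N) →
          alternant staircase x # 0# → Carrier
  schur lam x V#0 = alternant (shifted lam) x *ᴷ inv V#0

  -- The tuple (1, ζ, …, ζ^(t-1), z₁, z₁⁻¹, …, zᵣ, zᵣ⁻¹).
  point : (t r : ℕ) → Carrier → (z : Vector Carrier r) → (∀ i → z i # 0#) →
          Vector Carrier (t + r * 2)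
  point t r ζ z z#0 =
    (λ (k : Fin t) → ζ ^ toℕ k) ++ concat (λ i → z i ∷ inv (z#0 i) ∷ [])

  -- Identical vanishing in z₁, …, zᵣ as a rational function: at every point
  -- with all zᵢ invertible at which the denominator is invertible.  K is
  -- infinite, so this is the vanishing of the Laurent polynomial.
  VanishesIdentically : (t r : ℕ) → Carrier → Vector ℕ (t + r * 2) → Set (c ⊔ ℓ₁ ⊔ ℓ₂)
  VanishesIdentically t r ζ lam =
    (z : Vector Carrier r) (z#0 : ∀ i → z i # 0#)
    (V#0 : alternant staircase (point t r ζ z z#0) # 0#) →
    schur lam (point t r ζ z z#0) V#0 ≈ 0#

IsMin IsMax : ℕ → List ℕ → Set
IsMin m xs = m ∈ xs × (∀ {x} → x ∈ xs → m ≤ x)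
IsMax m xs = m ∈ xs × (∀ {x} → x ∈ xs → x ≤ m)

-- The k-th largest entry (k ≥ 1), counted with multiplicity.
kthLargest : ℕ → List ℕ → Maybe ℕ
kthLargest k xs = head (drop (k ∸ 1) (Sort.sort (decTotalOrder ≤-decTotalOrder) xs))

-- Stability under x ↦ s - x.
IsStable : ℕ → List ℕ → Set
IsStable s xs = ∀ {x} → x ∈ xs → ∃ λ y → y ∈ xs × ℤ.+ y ≡ ℤ.+ s ℤ.- ℤ.+ x

consecutiveSums : List ℕ → List ℕ
consecutiveSums xs = zipWith _+_ xs (drop 1 xs)

-- For a partition the numbers β j strictly decrease in j, so a set of values
-- β j is represented by the set of the corresponding indices j.

module Beads (t r : ℕ) .{{_ : NonZero t}} (lam : Vector ℕ (t + r * 2)) where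

  N : ℕ
  N = t + r * 2

  β : Vector ℕ N
  β = shifted lam

  residue : Fin N → Fin t
  residue j = β j mod t

  class : Fin t → Subset N
  class i = tabulate λ j → does (residue j ≟ i)

  n : Fin t → ℕ
  n i = ∣ class i ∣

  ℰ : Subset t
  ℰ = tabulate λ i → does (2 ≤? n i)

  𝒮 : Subset N
  𝒮 = tabulate λ j → does (residue j ∈? ℰ)

  -- The values of an index set, in decreasing order.
  values : Subset N → List ℕ
  values P = map β (filter (_∈? P) (allFin N))

  IsChoice : Subset N → Set
  IsChoice g = g ⊆ˢ 𝒮 × (∀ i → i ∈ˢ ℰ → ∣ g ∩ class i ∣ ≡ 1)

  T : Subset N → Subset N
  T g = 𝒮 ─ g

  deg : Subset N → ℤ
  deg P = ℤ.+ sum (take r (values P)) ℤ.- ℤ.+ sum (drop r (values P))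

  G : Subset N → Set
  G g = IsChoice g × (∀ h → IsChoice h → deg (T h) ℤ.≤ deg (T g))

  -- All Δᵢ(k) for i ∈ ℰ and 1 ≤ k ≤ nᵢ - 1, with multiplicity.
  Δs : List ℕ
  Δs = concatMap (λ i → consecutiveSums (values (𝒮 ∩ class i)))
                 (filter (_∈? ℰ) (allFin t))

  τ : Maybe ℕ
  τ = kthLargest r Δs

{-# OPTIONS --safe #-}
-- Specialize z_l to s⁴ 2^(w l) with integers s and w l.  Combinations of the rows of the
-- points 1, ζ, …, ζ^(t-1) are the indicator rows of the residue classes, so the vanishing
-- of the alternant becomes that of an integer determinant for every s.  For a threshold c,
-- suitable powers of s can be taken out of its rows and columns; the remaining entries are
-- polynomials in s whose constant terms again form a singular matrix.  Its rows pick the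
-- elements of a class nearest to c/4, the values 2^(w l b) with 4b ≤ c, and the values
-- 2^(-w l b) with 4b ≥ c.  A kernel vector κ therefore vanishes at a unique nearest element
-- of a class, and its parts above and below c/4 have vanishing moments of exponents w l.
-- If no sum of consecutive elements of a class is c/2 and r of them lie on either side, both parts
-- are solutions of r × r Vandermonde systems and κ = 0, a contradiction.  Hence r - 1 sums
-- lie above τ, r - 1 below, and two classes contain a pair with sum τ (no third class
-- does, since 2i ≡ τ modulo t has at most two solutions, and two only for even t).
-- For c = 2τ the exponents 0, …, r - 1 and 0, …, r - 2, r give two relations between the
-- values of ∏ (x - p) and ∏ (x - q) at two points, where p and q run over the powers of 2
-- belonging to the elements above and to the reflections of those below.  Their quotient
-- says ∑ p = ∑ q, so the two sets agree by uniqueness of binary expansions: x ↦ τ - x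
-- exchanges the elements above and below.
-- Finally 2 deg T ≤ ∑ |2u - τ| over u ∈ T, with equality exactly when r elements lie on
-- either side of τ/2, so the maximizing choices take a nearest element in every class and
-- opposite ends of the two pairs with sum τ.
module Submission where

-- The integer specialization meets two difficulties. The field has only an apartness relation,
-- whereas an integer matrix of determinant 0 has an explicit kernel vector; and the passage to a
-- leading term, in which the nearest elements of a class win, becomes a congruence modulo a large
-- `s`. The powers of 2 do double duty. Since 2^(w l b) is the `w l`-th power of the node 2^b, the
-- equations for a kernel vector are moment equations at nodes independent of the exponents, and the
-- exponents may be varied at will. One set of exponents gives a single equation between the two
-- unknown sets of nodes, far too little to identify them. Raising the last exponent by one
-- multiplies each product by a linear factor whose shift is the sum of the nodes; division isolates
-- this sum, and because the nodes are powers of 2 that one number determines the whole set. The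
-- factor 4 in the exponents lets a threshold halfway between s - 1 and s for the sums of pairs be
-- given by an integer `c`.

open import Algebra.Bundles using (Semiring)

-- Finite sums over a semiring.

module Summation {c ℓ} (S : Semiring c ℓ) where
  open Semiring S hiding (zero)
  import Algebra.Properties.Semiring.Sum S as Sum
  open import Data.Bool.Base using (if_then_else_)
  open import Data.Fin.Base using (Fin; zero; suc)
  open import Data.Fin.Properties using (_≟_; suc-injective)
  open import Data.Nat.Base using (ℕ; zero; suc)
  open import Data.Vec.Functional using (Vector)
  open import Function.Base using (_∘_)
  open import Relation.Binary.PropositionalEquality.Core as ≡ using (_≡_; _≢_)
  open import Relation.Binary.Reasoning.Setoid setoid
  open import Relation.Nullary.Decidable.Core using (does; yes; no)
  open import Relation.Nullary.Negation.Core using (contradiction)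

  private variable
    m n : ℕ

  -- Opaque, so that unification can read the summand off a sum.
  opaque
    ∑ : Vector Carrier n → Carrier
    ∑ = Sum.sum

    ∑≡sum : (u : Vector Carrier n) → ∑ u ≡ Sum.sum u
    ∑≡sum u = ≡.refl

    ∑-[] : (u : Vector Carrier 0) → ∑ u ≈ 0#
    ∑-[] u = refl

    ∑-suc : (u : Vector Carrier (suc n)) → ∑ u ≈ u zero + ∑ (u ∘ suc)
    ∑-suc u = refl

    ∑-cong : {u v : Vector Carrier n} → (∀ i → u i ≈ v i) → ∑ u ≈ ∑ v
    ∑-cong = Sum.sum-cong-≋

    ∑-zero : {u : Vector Carrier n} → (∀ i → u i ≈ 0#) → ∑ u ≈ 0#
    ∑-zero {n} h = trans (Sum.sum-cong-≋ h) (Sum.sum-replicate-zero n)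

    ∑-+ : (u v : Vector Carrier n) → ∑ (λ i → u i + v i) ≈ ∑ u + ∑ v
    ∑-+ = Sum.∑-distrib-+

    ∑-*ˡ : ∀ a (u : Vector Carrier n) → ∑ (λ i → a * u i) ≈ a * ∑ u
    ∑-*ˡ a u = sym (Sum.*-distribˡ-sum a u)

    ∑-*ʳ : ∀ a (u : Vector Carrier n) → ∑ (λ i → u i * a) ≈ ∑ u * a
    ∑-*ʳ a u = sym (Sum.*-distribʳ-sum a u)

    ∑-comm : (u : Fin m → Fin n → Carrier) → ∑ (λ i → ∑ (u i)) ≈ ∑ λ j → ∑ λ i → u i j
    ∑-comm = Sum.∑-comm

  ∑-single : ∀ (i : Fin n) {u : Vector Carrier n} → (∀ j → j ≢ i → u j ≈ 0#) → ∑ u ≈ u i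
  ∑-single zero    h = trans (∑-suc _) (trans (+-congˡ (∑-zero λ j → h (suc j) λ ())) (+-identityʳ _))
  ∑-single (suc i) h =
    trans (∑-suc _) (trans (+-cong (h zero λ ()) (∑-single i λ j j≢i → h (suc j) (j≢i ∘ suc-injective)))
          (+-identityˡ _))

  ∑-linear : ∀ a b (u v : Vector Carrier n) → ∑ (λ i → a * u i + b * v i) ≈ a * ∑ u + b * ∑ v
  ∑-linear a b u v = trans (∑-+ _ _) (+-cong (∑-*ˡ a u) (∑-*ˡ b v))

  ∑-two : ∀ {i k : Fin n} → i ≢ k → {u : Vector Carrier n} → (∀ j → j ≢ i → j ≢ k → u j ≈ 0#) →
          ∑ u ≈ u i + u k
  ∑-two {n} {i} {k} i≢k {u} h = begin
    ∑ u               ≈⟨ ∑-cong split ⟩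
    ∑ (λ j → at i j + at k j) ≈⟨ ∑-+ (at i) (at k) ⟩
    ∑ (at i) + ∑ (at k)       ≈⟨ +-cong (∑-single i (off i)) (∑-single k (off k)) ⟩
    at i i + at k k           ≡⟨ ≡.cong₂ _+_ (on i) (on k) ⟩
    u i + u k                 ∎
    where
    at : Fin n → Fin n → Carrier
    at i j = if does (j ≟ i) then u j else 0#
    on : ∀ i → at i i ≡ u i
    on i with i ≟ i
    ... | yes _  = ≡.refl
    ... | no i≢i = contradiction ≡.refl i≢i
    off : ∀ i j → j ≢ i → at i j ≈ 0#
    off i j j≢i with j ≟ i
    ... | yes j≡i = contradiction j≡i j≢i
    ... | no _    = refl
    split : ∀ j → u j ≈ at i j + at k j
    split j with j ≟ i | j ≟ k
    ... | yes ≡.refl | yes ≡.refl = contradiction ≡.refl i≢k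
    ... | yes _      | no _       = sym (+-identityʳ _)
    ... | no _       | yes _      = sym (+-identityˡ _)
    ... | no j≢i     | no j≢k     = trans (h j j≢i j≢k) (sym (+-identityˡ _))

open import Algebra.Bundles using (CommutativeRing)

-- The image of the integers in a commutative ring.

module IntegerImage {c ℓ} (R : CommutativeRing c ℓ) where
  open CommutativeRing R
  open import Algebra.Properties.Ring ring using (-‿distribˡ-*; -‿distribʳ-*)
  open import Algebra.Properties.AbelianGroup +-abelianGroup
    using (⁻¹-∙-comm; ⁻¹-involutive; ε⁻¹≈ε)
  open import Algebra.Properties.Semiring.Mult semiring
    using (×-homo-+; ×-homo-1; ×1-homo-*) renaming (_×_ to _·_)
  open import Algebra.Properties.CommutativeSemigroup +-commutativeSemigroup
    using (interchange)
  open import Algebra.Solver.Ring.AlmostCommutativeRing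
    using (fromCommutativeRing; _-Raw-AlmostCommutative⟶_)
  open import Data.Integer.Base as ℤ using (ℤ; -[1+_]; _⊖_)
  import Data.Integer.Properties as ℤ
  import Data.Maybe.Base as Maybe
  open import Data.Nat.Base as ℕ using (ℕ; zero; suc)
  open import Relation.Binary.PropositionalEquality.Core as ≡ using (_≡_)
  open import Relation.Binary.Reasoning.Setoid setoid
  open import Relation.Nullary.Decidable.Core using (dec⇒maybe)

  -- The canonical ring map from the integers. It supplies the coefficients of the ring solver and
  -- later carries integer matrices into the field.
  ι : ℤ → Carrier
  ι (ℤ.+ n)  = n · 1#
  ι -[1+ n ] = - (suc n · 1#)

  ι-cong : ∀ {i j} → i ≡ j → ι i ≈ ι j
  ι-cong ≡.refl = refl

  ι-neg : ∀ i → ι (ℤ.- i) ≈ - ι i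
  ι-neg (ℤ.+ zero)  = sym ε⁻¹≈ε
  ι-neg (ℤ.+ suc n) = refl
  ι-neg -[1+ n ]    = sym (⁻¹-involutive _)

  ι-⊖ : ∀ m n → ι (m ⊖ n) ≈ m · 1# - n · 1#
  ι-⊖ zero    zero    = sym (-‿inverseʳ 0#)
  ι-⊖ zero    (suc n) = sym (+-identityˡ _)
  ι-⊖ (suc m) zero    = sym (trans (+-congˡ ε⁻¹≈ε) (+-identityʳ _))
  ι-⊖ (suc m) (suc n) = begin
    ι (suc m ⊖ suc n)              ≈⟨ ι-cong (ℤ.[1+m]⊖[1+n]≡m⊖n m n) ⟩
    ι (m ⊖ n)                      ≈⟨ ι-⊖ m n ⟩
    a - b                          ≈⟨ +-identityˡ _ ⟨
    0# + (a - b)                   ≈⟨ +-congʳ (-‿inverseʳ 1#) ⟨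
    (1# - 1#) + (a - b)            ≈⟨ interchange 1# (- 1#) a (- b) ⟩
    (1# + a) + (- 1# + - b)        ≈⟨ +-congˡ (⁻¹-∙-comm 1# b) ⟩
    (1# + a) - (1# + b)            ∎
    where
    a = m · 1#
    b = n · 1#

  ι-+ : ∀ i j → ι (i ℤ.+ j) ≈ ι i + ι j
  ι-+ (ℤ.+ m)  (ℤ.+ n)  = ×-homo-+ 1# m n
  ι-+ (ℤ.+ m)  -[1+ n ] = ι-⊖ m (suc n)
  ι-+ -[1+ m ] (ℤ.+ n)  = trans (ι-⊖ n (suc m)) (+-comm _ _)
  ι-+ -[1+ m ] -[1+ n ] = begin
    - (suc (suc (m ℕ.+ n)) · 1#)     ≈⟨ -‿cong (+-congˡ (trans (×-homo-+ 1# (suc m) n) refl)) ⟩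
    - (1# + (suc m · 1# + n · 1#))   ≈⟨ -‿cong (trans (sym (+-assoc _ _ _)) (trans (+-congʳ (+-comm _ _)) (+-assoc _ _ _))) ⟩
    - (suc m · 1# + suc n · 1#)      ≈⟨ ⁻¹-∙-comm _ _ ⟨
    - (suc m · 1#) - suc n · 1#      ∎

  ι-+*+ : ∀ m n → ι (ℤ.+ m ℤ.* ℤ.+ n) ≈ m · 1# * (n · 1#)
  ι-+*+ m n = trans (ι-cong (≡.sym (ℤ.pos-* m n))) (×1-homo-* m n)

  ι-+* : ∀ m j → ι (ℤ.+ m ℤ.* j) ≈ m · 1# * ι j
  ι-+* m (ℤ.+ n)  = ι-+*+ m n
  ι-+* m -[1+ n ] = begin
    ι (ℤ.+ m ℤ.* ℤ.- (ℤ.+ suc n))   ≈⟨ ι-cong (≡.sym (ℤ.neg-distribʳ-* (ℤ.+ m) (ℤ.+ suc n))) ⟩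
    ι (ℤ.- (ℤ.+ m ℤ.* ℤ.+ suc n))   ≈⟨ ι-neg (ℤ.+ m ℤ.* ℤ.+ suc n) ⟩
    - ι (ℤ.+ m ℤ.* ℤ.+ suc n)       ≈⟨ -‿cong (ι-+*+ m (suc n)) ⟩
    - (m · 1# * (suc n · 1#))       ≈⟨ -‿distribʳ-* _ _ ⟩
    m · 1# * - (suc n · 1#)         ∎

  ι-* : ∀ i j → ι (i ℤ.* j) ≈ ι i * ι j
  ι-* (ℤ.+ m)  j = ι-+* m j
  ι-* -[1+ m ] j = begin
    ι (ℤ.- (ℤ.+ suc m) ℤ.* j)   ≈⟨ ι-cong (≡.sym (ℤ.neg-distribˡ-* (ℤ.+ suc m) j)) ⟩
    ι (ℤ.- (ℤ.+ suc m ℤ.* j))   ≈⟨ ι-neg (ℤ.+ suc m ℤ.* j) ⟩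
    - ι (ℤ.+ suc m ℤ.* j)       ≈⟨ -‿cong (ι-+* (suc m) j) ⟩
    - (suc m · 1# * ι j)        ≈⟨ -‿distribˡ-* _ _ ⟩
    - (suc m · 1#) * ι j        ∎

  ι-1 : ι ℤ.1ℤ ≈ 1#
  ι-1 = ×-homo-1 1#

  ℤ⟶R : CommutativeRing.rawRing ℤ.+-*-commutativeRing
         -Raw-AlmostCommutative⟶ fromCommutativeRing R
  ℤ⟶R = record
    { ⟦_⟧    = ι
    ; +-homo = ι-+
    ; *-homo = ι-*
    ; -‿homo = ι-neg
    ; 0-homo = refl
    ; 1-homo = ι-1
    }

  open import Algebra.Solver.Ring
    (CommutativeRing.rawRing ℤ.+-*-commutativeRing) (fromCommutativeRing R) ℤ⟶R
    (λ i j → Maybe.map ι-cong (dec⇒maybe (i ℤ.≟ j)))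
    public using (solve; _:=_; _:+_; _:*_; _:-_; :-_)

-- Determinants: multilinearity, alternation and row spans.

module Determinant {c ℓ} (R : CommutativeRing c ℓ) where
  open CommutativeRing R hiding (zero)
  open IntegerImage R using (solve; _:=_; _:+_; _:*_; :-_)
  open import Algebra.Properties.CommutativeMonoid.Sum *-commutativeMonoid
    using () renaming (sum to ∏; sum-remove to ∏-remove)
  open import Algebra.Properties.Group +-group using (inverseʳ-unique)
  open import Algebra.Properties.Ring ring using (-1*x≈-x)
  open import Algebra.Properties.Semiring.Exp semiring using (_^_)
  open Summation semiring
  open import Data.Bool.Base using (if_then_else_)
  open import Data.Fin.Base using (Fin; zero; suc; toℕ; fromℕ<; punchIn; punchOut)
  open import Data.Fin.Properties
    using (_≟_; any?; pigeonhole; punchOut-injective; toℕ<n; toℕ-fromℕ<; toℕ-injective;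
           suc-injective)
  open import Data.Nat.Base as ℕ using (ℕ; zero; suc; s≤s; z≤n)
  import Data.Nat.Properties as ℕ
  open import Data.Product.Base using (∃; _×_; _,_; proj₁; proj₂)
  open import Data.Vec.Functional using (Vector; updateAt)
  open import Data.Vec.Functional.Properties using (updateAt-updates; updateAt-minimal)
  open import Function.Base using (_∘_; const)
  open import Relation.Binary.PropositionalEquality.Core as ≡ using (_≡_; _≢_)
  open import Relation.Binary.Reasoning.Setoid setoid
  open import Relation.Nullary.Decidable.Core using (Dec; does; yes; no)
  open import Relation.Nullary.Negation.Core using (contradiction)

  private variable
    m n : ℕ

  Matrix : ℕ → ℕ → Set c
  Matrix m n = Fin m → Vector Carrier n

  sgn : Fin n → Carrier
  sgn j = (- 1#) ^ toℕ j

  minor : Matrix (suc m) (suc n) → Fin (suc n) → Matrix m n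
  minor A j i k = A (suc i) (punchIn j k)

  -- Stated over any commutative ring because determinants over the field and over the integers both
  -- occur; `schur-det` and `ι-det` connect the versions.
  det : Matrix n n → Carrier
  det {zero}  A = 1#
  det {suc n} A = ∑ λ j → sgn j * (A zero j * det (minor A j))

  infix 4 _≋_
  _≋_ : Vector Carrier n → Vector Carrier n → Set ℓ
  u ≋ v = ∀ j → u j ≈ v j

  det-cong : {A B : Matrix n n} → (∀ i → A i ≋ B i) → det A ≈ det B
  det-cong {zero}  h = refl
  det-cong {suc n} h = ∑-cong λ j →
    *-congˡ (*-cong (h zero j) (det-cong λ i k → h (suc i) (punchIn j k)))

  -- Phrased for three matrices that agree off row `k`, and not with row updates, because this form
  -- passes directly to minors in the induction.
  det-linear : ∀ (k : Fin n) {A B C : Matrix n n} a b →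
               (∀ i → i ≢ k → A i ≋ C i) → (∀ i → i ≢ k → B i ≋ C i) →
               (∀ j → C k j ≈ a * A k j + b * B k j) → det C ≈ a * det A + b * det B
  det-linear zero {A} {B} {C} a b hA hB hC = trans (∑-cong λ j → begin
    sgn j * (C zero j * det (minor C j))
      ≈⟨ *-congˡ (*-congʳ (hC j)) ⟩
    sgn j * ((a * A zero j + b * B zero j) * det (minor C j))
      ≈⟨ solve 6 (λ s a x b y d → s :* ((a :* x :+ b :* y) :* d) :=
                    a :* (s :* (x :* d)) :+ b :* (s :* (y :* d))) refl _ _ _ _ _ _ ⟩
    a * (sgn j * (A zero j * det (minor C j))) + b * (sgn j * (B zero j * det (minor C j)))
      ≈⟨ +-cong (*-congˡ (*-congˡ (*-congˡ (det-cong λ i k → hA (suc i) (λ ()) _))))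
                (*-congˡ (*-congˡ (*-congˡ (det-cong λ i k → hB (suc i) (λ ()) _)))) ⟨
    a * (sgn j * (A zero j * det (minor A j))) + b * (sgn j * (B zero j * det (minor B j))) ∎)
    (∑-linear a b _ _)
  det-linear (suc k) {A} {B} {C} a b hA hB hC = trans (∑-cong λ j → begin
    sgn j * (C zero j * det (minor C j))
      ≈⟨ *-congˡ (*-congˡ (det-linear k a b
           (λ i i≢k l → hA (suc i) (i≢k ∘ suc-injective) (punchIn j l))
           (λ i i≢k l → hB (suc i) (i≢k ∘ suc-injective) (punchIn j l))
           (λ l → hC (punchIn j l)))) ⟩
    sgn j * (C zero j * (a * det (minor A j) + b * det (minor B j)))
      ≈⟨ solve 6 (λ s z a x b y → s :* (z :* (a :* x :+ b :* y)) :=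
                    a :* (s :* (z :* x)) :+ b :* (s :* (z :* y))) refl _ _ _ _ _ _ ⟩
    a * (sgn j * (C zero j * det (minor A j))) + b * (sgn j * (C zero j * det (minor B j)))
      ≈⟨ +-cong (*-congˡ (*-congˡ (*-congʳ (hA zero (λ ()) j))))
                (*-congˡ (*-congˡ (*-congʳ (hB zero (λ ()) j)))) ⟨
    a * (sgn j * (A zero j * det (minor A j))) + b * (sgn j * (B zero j * det (minor B j))) ∎)
    (∑-linear a b _ _)

  -- Expanding det along two rows gives such a sum, in which the terms for the
  -- column pairs (j, k) and (k, j) cancel.
  alternating-sum : ∀ n (φ : Fin (suc n) → Fin (suc n) → Carrier) → (∀ a b → φ a b ≈ φ b a) →
                    (∑ λ j → sgn j * ∑ λ k → sgn k * φ j (punchIn j k)) ≈ 0#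
  alternating-sum zero    φ φ-sym = ∑-zero λ _ → trans (*-congˡ (∑-[] _)) (zeroʳ _)
  alternating-sum (suc n) φ φ-sym = begin
    ∑ (λ j → sgn j * ∑ λ k → sgn k * φ j (punchIn j k))
      ≈⟨ ∑-suc _ ⟩
    1# * X + ∑ (λ j → - 1# * sgn j * ∑ (λ k → sgn k * φ (suc j) (punchIn (suc j) k)))
      ≈⟨ +-congˡ (∑-cong λ j → *-congˡ (∑-suc _)) ⟩
    1# * X + ∑ (λ j → - 1# * sgn j * (1# * φ (suc j) zero + inner j))
      ≈⟨ +-cong (*-identityˡ X) (∑-cong λ j → begin
           - 1# * sgn j * (1# * φ (suc j) zero + inner j)
             ≈⟨ *-cong (-1*x≈-x _) (+-cong (trans (*-identityˡ _) (φ-sym (suc j) zero)) (inner≈ j)) ⟩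
           - sgn j * (φ zero (suc j) + - inner′ j)
             ≈⟨ solve 3 (λ s x y → (:- s) :* (x :+ (:- y)) := :- (s :* x) :+ s :* y) refl _ _ _ ⟩
           - (sgn j * φ zero (suc j)) + sgn j * inner′ j
             ≈⟨ +-cong (-1*x≈-x _) (*-identityˡ _) ⟨
           - 1# * (sgn j * φ zero (suc j)) + 1# * (sgn j * inner′ j) ∎) ⟩
    X + ∑ (λ j → - 1# * (sgn j * φ zero (suc j)) + 1# * (sgn j * inner′ j))
      ≈⟨ +-congˡ (∑-linear (- 1#) 1# _ _) ⟩
    X + (- 1# * X + 1# * ∑ (λ j → sgn j * inner′ j))
      ≈⟨ +-congˡ (+-cong (-1*x≈-x X) (trans (*-identityˡ _)
           (alternating-sum n (λ a b → φ (suc a) (suc b)) λ a b → φ-sym _ _))) ⟩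
    X + (- X + 0#)
      ≈⟨ trans (+-congˡ (+-identityʳ _)) (-‿inverseʳ X) ⟩
    0# ∎
    where
    X = ∑ λ k → sgn k * φ zero (suc k)
    inner  = λ j → ∑ λ k → - 1# * sgn k * φ (suc j) (suc (punchIn j k))
    inner′ = λ j → ∑ λ k → sgn k * φ (suc j) (suc (punchIn j k))
    inner≈ : ∀ j → inner j ≈ - inner′ j
    inner≈ j = trans (∑-cong λ k → *-assoc (- 1#) (sgn k) _)
                     (trans (∑-*ˡ (- 1#) _) (-1*x≈-x _))

  -- punchIn₂ a b enumerates the indices other than a and b; it is junk for a = b.
  punchIn₂ : Fin (suc (suc n)) → Fin (suc (suc n)) → Fin n → Fin (suc (suc n))
  punchIn₂ zero    zero    m       = suc (suc m)
  punchIn₂ zero    (suc b) m       = suc (punchIn b m)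
  punchIn₂ (suc a) zero    m       = suc (punchIn a m)
  punchIn₂ (suc a) (suc b) zero    = zero
  punchIn₂ (suc a) (suc b) (suc m) = suc (punchIn₂ a b m)

  punchIn₂-sym : ∀ (a b : Fin (suc (suc n))) m → punchIn₂ a b m ≡ punchIn₂ b a m
  punchIn₂-sym zero    zero    m       = ≡.refl
  punchIn₂-sym zero    (suc b) m       = ≡.refl
  punchIn₂-sym (suc a) zero    m       = ≡.refl
  punchIn₂-sym (suc a) (suc b) zero    = ≡.refl
  punchIn₂-sym (suc a) (suc b) (suc m) = ≡.cong suc (punchIn₂-sym a b m)

  punchIn₂-punchIn : ∀ (j : Fin (suc (suc n))) k m →
                     punchIn j (punchIn k m) ≡ punchIn₂ j (punchIn j k) m
  punchIn₂-punchIn zero    k       m       = ≡.refl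
  punchIn₂-punchIn (suc j) zero    m       = ≡.refl
  punchIn₂-punchIn (suc j) (suc k) zero    = ≡.refl
  punchIn₂-punchIn (suc j) (suc k) (suc m) = ≡.cong suc (punchIn₂-punchIn j k m)

  -- In the expansion along both rows, the coefficient of a pair of columns is a product of two
  -- entries of one and the same row and a complementary minor. It is symmetric in the pair, so
  -- `alternating-sum` applies.
  det-alternating₀₁ : (A : Matrix (suc (suc n)) (suc (suc n))) → A zero ≋ A (suc zero) → det A ≈ 0#
  det-alternating₀₁ {n} A A₀≋A₁ = trans (∑-cong λ j → *-congˡ (begin
      A zero j * ∑ (λ k → sgn k * (A (suc zero) (punchIn j k) * det (minor (minor A j) k)))
        ≈⟨ ∑-*ˡ _ _ ⟨
      ∑ (λ k → A zero j * (sgn k * (A (suc zero) (punchIn j k) * det (minor (minor A j) k))))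
        ≈⟨ ∑-cong (λ k → trans
             (solve 4 (λ x s y d → x :* (s :* (y :* d)) := s :* (x :* y :* d)) refl _ _ _ _)
             (*-congˡ (*-cong (*-congˡ (sym (A₀≋A₁ _))) (det-cong λ i m →
               reflexive (≡.cong (A (suc (suc i))) (punchIn₂-punchIn j k m)))))) ⟩
      ∑ (λ k → sgn k * φ j (punchIn j k)) ∎))
    (alternating-sum (suc n) φ λ a b → *-cong (*-comm _ _) (det-cong λ i m →
      reflexive (≡.cong (A (suc (suc i))) (punchIn₂-sym a b m))))
    where
    φ : Fin (suc (suc n)) → Fin (suc (suc n)) → Carrier
    φ a b = A zero a * A zero b * det λ i m → A (suc (suc i)) (punchIn₂ a b m)

  private
    replace₂ : Fin n → Fin n → Matrix n n → Vector Carrier n → Vector Carrier n → Matrix n n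
    replace₂ i k A u v l = if does (l ≟ i) then u else (if does (l ≟ k) then v else A l)

    replace₂-first : ∀ (i k : Fin n) A u v l → l ≡ i → replace₂ i k A u v l ≡ u
    replace₂-first i k A u v l l≡i with l ≟ i
    ... | yes _  = ≡.refl
    ... | no l≢i = contradiction l≡i l≢i

    replace₂-second : ∀ {i k : Fin n} A u v l → i ≢ k → l ≡ k → replace₂ i k A u v l ≡ v
    replace₂-second {i = i} {k} A u v l i≢k l≡k with l ≟ i | l ≟ k
    ... | yes l≡i | _      = contradiction (≡.trans (≡.sym l≡i) l≡k) i≢k
    ... | no _    | yes _  = ≡.refl
    ... | no _    | no l≢k = contradiction l≡k l≢k

    replace₂-other : ∀ (i k : Fin n) A u v u′ v′ l → (l ≡ i → u ≡ u′) → (l ≡ k → v ≡ v′) →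
                     replace₂ i k A u v l ≡ replace₂ i k A u′ v′ l
    replace₂-other i k A u v u′ v′ l p q with l ≟ i | l ≟ k
    ... | yes l≡i | _       = p l≡i
    ... | no _    | yes l≡k = q l≡k
    ... | no _    | no _    = ≡.refl

    ≡⇒≋ : {u v : Vector Carrier n} → u ≡ v → u ≋ v
    ≡⇒≋ ≡.refl j = refl

  -- Polarization: expand the vanishing determinant with `u + v` in both rows. Alternation is
  -- assumed for the single pair `i`, `k`, because the general case is itself derived from a swap of
  -- rows 0 and 1.
  det-swap : ∀ {i k : Fin n} → i ≢ k →
             (∀ (A : Matrix n n) → A i ≋ A k → det A ≈ 0#) →
             ∀ A u v → det (replace₂ i k A u v) + det (replace₂ i k A v u) ≈ 0#
  det-swap {n} {i} {k} i≢k alt A u v = begin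
    D u v + D v u
      ≈⟨ +-cong (trans (sym (+-identityˡ _)) (+-congʳ (sym (D-alt u)))) (trans (sym (+-identityʳ _)) (+-congˡ (sym (D-alt v)))) ⟩
    D u u + D u v + (D v u + D v v)
      ≈⟨ +-cong (linʳ u) (linʳ v) ⟨
    D u w + D v w
      ≈⟨ linˡ ⟨
    D w w
      ≈⟨ D-alt w ⟩
    0# ∎
    where
    w : Vector Carrier n
    w j = u j + v j
    D : Vector Carrier n → Vector Carrier n → Carrier
    D x y = det (replace₂ i k A x y)
    D-alt : ∀ x → D x x ≈ 0#
    D-alt x = alt _ (≡⇒≋ (≡.trans (replace₂-first i k A x x i ≡.refl) (≡.sym (replace₂-second A x x k i≢k ≡.refl))))
    one : ∀ x y → x + y ≈ 1# * x + 1# * y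
    one x y = sym (+-cong (*-identityˡ x) (*-identityˡ y))
    drop-ones : ∀ {x y z} → z ≈ 1# * x + 1# * y → z ≈ x + y
    drop-ones h = trans h (+-cong (*-identityˡ _) (*-identityˡ _))
    linˡ : D w w ≈ D u w + D v w
    linˡ = drop-ones (det-linear i 1# 1#
      (λ l l≢i → ≡⇒≋ (replace₂-other i k A u w w w l (λ l≡i → contradiction l≡i l≢i) λ _ → ≡.refl))
      (λ l l≢i → ≡⇒≋ (replace₂-other i k A v w w w l (λ l≡i → contradiction l≡i l≢i) λ _ → ≡.refl))
      (λ j → begin
        replace₂ i k A w w i j ≈⟨ ≡⇒≋ (replace₂-first i k A w w i ≡.refl) j ⟩
        u j + v j              ≈⟨ one _ _ ⟩
        1# * u j + 1# * v j    ≈⟨ +-cong (*-congˡ (≡⇒≋ (replace₂-first i k A u w i ≡.refl) j))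
                                         (*-congˡ (≡⇒≋ (replace₂-first i k A v w i ≡.refl) j)) ⟨
        1# * replace₂ i k A u w i j + 1# * replace₂ i k A v w i j ∎))
    linʳ : ∀ x → D x w ≈ D x u + D x v
    linʳ x = drop-ones (det-linear k 1# 1#
      (λ l l≢k → ≡⇒≋ (replace₂-other i k A x u x w l (λ _ → ≡.refl) λ l≡k → contradiction l≡k l≢k))
      (λ l l≢k → ≡⇒≋ (replace₂-other i k A x v x w l (λ _ → ≡.refl) λ l≡k → contradiction l≡k l≢k))
      (λ j → begin
        replace₂ i k A x w k j ≈⟨ ≡⇒≋ (replace₂-second A x w k i≢k ≡.refl) j ⟩
        u j + v j              ≈⟨ one _ _ ⟩
        1# * u j + 1# * v j    ≈⟨ +-cong (*-congˡ (≡⇒≋ (replace₂-second A x u k i≢k ≡.refl) j))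
                                         (*-congˡ (≡⇒≋ (replace₂-second A x v k i≢k ≡.refl) j)) ⟨
        1# * replace₂ i k A x u k j + 1# * replace₂ i k A x v k j ∎))

  det-zero-minors : (A : Matrix (suc n) (suc n)) → (∀ j → det (minor A j) ≈ 0#) → det A ≈ 0#
  det-zero-minors A h = ∑-zero λ j →
    trans (*-congˡ (trans (*-congˡ (h j)) (zeroʳ _))) (zeroʳ _)

  -- A swap of rows 0 and 1 costs only a sign. Afterwards the equal rows both lie below row 0, one
  -- step closer together, and every minor along row 0 vanishes by induction.
  det-alternating-zero : ∀ (k : Fin n) (A : Matrix (suc n) (suc n)) → A zero ≋ A (suc k) → det A ≈ 0#
  det-alternating-zero zero A h = det-alternating₀₁ A h
  det-alternating-zero (suc k) A h = begin
    det A                         ≈⟨ det-cong {A = A} {B A₀ A₁} (λ { zero j → refl ; (suc zero) j → refl ; (suc (suc l)) j → refl }) ⟩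
    det (B A₀ A₁)                 ≈⟨ +-identityʳ _ ⟨
    det (B A₀ A₁) + 0#            ≈⟨ +-congˡ (det-zero-minors (B A₁ A₀) λ j →
                                       det-alternating-zero k (minor (B A₁ A₀) j) (h ∘ punchIn j)) ⟨
    det (B A₀ A₁) + det (B A₁ A₀) ≈⟨ det-swap (λ ()) det-alternating₀₁ A A₀ A₁ ⟩
    0#                            ∎
    where
    A₀ = A zero
    A₁ = A (suc zero)
    B = replace₂ zero (suc zero) A

  det-alternating : ∀ (i k : Fin n) → i ≢ k → (A : Matrix n n) → A i ≋ A k → det A ≈ 0#
  det-alternating zero zero i≢k A h = contradiction ≡.refl i≢k
  det-alternating (suc i) (suc k) i≢k A h = det-zero-minors A λ j →
    det-alternating i k (i≢k ∘ ≡.cong suc) (minor A j) (h ∘ punchIn j)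
  det-alternating zero (suc k) i≢k A h = det-alternating-zero k A h
  det-alternating (suc k) zero i≢k A h = det-alternating-zero k A (sym ∘ h)

  δ : Fin n → Fin n → Carrier
  δ i j = if does (i ≟ j) then 1# else 0#

  δ-≡ : ∀ (i : Fin n) → δ i i ≡ 1#
  δ-≡ i with i ≟ i
  ... | yes _  = ≡.refl
  ... | no i≢i = contradiction ≡.refl i≢i

  δ-≢ : ∀ (i j : Fin n) → i ≢ j → δ i j ≡ 0#
  δ-≢ i j i≢j with i ≟ j
  ... | yes i≡j = contradiction i≡j i≢j
  ... | no _    = ≡.refl

  Span : Matrix m n → Vector Carrier n → Set _
  Span A v = ∃ λ (a : Vector Carrier _) → ∀ j → v j ≈ ∑ λ k → a k * A k j

  span-resp : {A : Matrix m n} {u v : Vector Carrier n} → u ≋ v → Span A u → Span A v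
  span-resp u≋v (a , h) = a , λ j → trans (sym (u≋v j)) (h j)

  span-row : (A : Matrix m n) (k : Fin m) → Span A (A k)
  span-row A k = (λ l → δ l k) , λ j → sym (trans
    (∑-single k λ l l≢k → trans (*-congʳ (reflexive (δ-≢ l k l≢k))) (zeroˡ _))
    (trans (*-congʳ (reflexive (δ-≡ k))) (*-identityˡ _)))

  span-linear : {A : Matrix m n} {u v : Vector Carrier n} → ∀ x y → Span A u → Span A v →
                Span A (λ j → x * u j + y * v j)
  span-linear x y (a , h) (b , g) = (λ k → x * a k + y * b k) , λ j →
    trans (+-cong (*-congˡ (h j)) (*-congˡ (g j)))
          (trans (sym (∑-linear x y _ _)) (∑-cong λ k →
            solve 5 (λ x y a b z → x :* (a :* z) :+ y :* (b :* z) := (x :* a :+ y :* b) :* z)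
              refl _ _ _ _ _))

  span-scale : {A : Matrix m n} {u : Vector Carrier n} → ∀ x → Span A u → Span A (λ j → x * u j)
  span-scale x (a , h) = (λ k → x * a k) , λ j →
    trans (*-congˡ (h j)) (trans (sym (∑-*ˡ x _)) (∑-cong λ k → sym (*-assoc _ _ _)))

  span-zero : {A : Matrix m n} → Span A (λ _ → 0#)
  span-zero = (λ _ → 0#) , λ j → sym (∑-zero λ k → zeroˡ _)

  span-∑ : ∀ {l} {A : Matrix m n} (a : Vector Carrier l) {B : Matrix l n} → (∀ k → Span A (B k)) →
           Span A (λ j → ∑ λ k → a k * B k j)
  span-∑ {l = zero}  a h = span-resp (λ j → sym (∑-[] _)) span-zero
  span-∑ {l = suc l} a h =
    span-resp (λ j → trans (+-congˡ (*-identityˡ _)) (sym (∑-suc _)))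
              (span-linear (a zero) 1# (h zero) (span-∑ (a ∘ suc) (h ∘ suc)))

  -- A determinant with rows in the span of the rows of R is a multiple of det R:
  -- expand multilinearly, and sort the rows by transpositions.
  module _ (R : Matrix n n) where

    Multiple : Matrix n n → Set _
    Multiple A = ∃ λ a → det A ≈ a * det R

    private
      multiple-resp : {A B : Matrix n n} → (∀ i → A i ≋ B i) → Multiple A → Multiple B
      multiple-resp h (a , p) = a , trans (sym (det-cong h)) p

      multiple-zero : {A : Matrix n n} → det A ≈ 0# → Multiple A
      multiple-zero p = 0# , trans p (sym (zeroˡ _))

      multiple-linear : ∀ (k : Fin n) {A B C : Matrix n n} a b →
        (∀ i → i ≢ k → A i ≋ C i) → (∀ i → i ≢ k → B i ≋ C i) →
        (∀ j → C k j ≈ a * A k j + b * B k j) → Multiple A → Multiple B → Multiple C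
      multiple-linear k a b hA hB hC (x , p) (y , q) = a * x + b * y ,
        trans (det-linear k a b hA hB hC) (trans (+-cong (*-congˡ p) (*-congˡ q))
          (solve 5 (λ a x b y d → a :* (x :* d) :+ b :* (y :* d) := (a :* x :+ b :* y) :* d)
            refl _ _ _ _ _))

      _[_]≔_ : Matrix n n → Fin n → Vector Carrier n → Matrix n n
      A [ k ]≔ v = updateAt A k (const v)

      at : ∀ (A : Matrix n n) k v → (A [ k ]≔ v) k ≋ v
      at A k v = ≡⇒≋ (updateAt-updates k A)

      off : ∀ (A : Matrix n n) {i k} v → i ≢ k → (A [ k ]≔ v) i ≋ A i
      off A {i} {k} v i≢k = ≡⇒≋ (updateAt-minimal i k A i≢k)

      -- Multilinear expansion of row `k`, one summand at a time. An empty combination makes the row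
      -- zero, and linearity with both coefficients 0 then kills the determinant.
      multiple-row : ∀ {m} (k : Fin n) (A : Matrix n n) (a : Vector Carrier m) (S : Matrix m n) →
                     (∀ j → A k j ≈ ∑ λ l → a l * S l j) →
                     (∀ l → Multiple (A [ k ]≔ S l)) → Multiple A
      multiple-row {zero} k A a S h hS = multiple-zero (begin
        det A
          ≈⟨ det-linear k 0# 0# (λ _ _ _ → refl) (λ _ _ _ → refl) (λ j → begin
               A k j                        ≈⟨ trans (h j) (∑-[] _) ⟩
               0#                           ≈⟨ 0*+0* _ _ ⟨
               0# * A k j + 0# * A k j      ∎) ⟩
        0# * det A + 0# * det A
          ≈⟨ 0*+0* _ _ ⟩
        0# ∎)
        where
        0*+0* : ∀ x y → 0# * x + 0# * y ≈ 0#
        0*+0* x y = trans (+-cong (zeroˡ x) (zeroˡ y)) (+-identityˡ 0#)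
      multiple-row {suc m} k A a S h hS =
        multiple-linear k {A [ k ]≔ S zero} {A [ k ]≔ rest} (a zero) 1#
          (λ i → off A _) (λ i → off A _)
          (λ j → trans (trans (h j) (∑-suc _))
                   (+-cong (*-congˡ (sym (at A k _ j))) (trans (sym (at A k _ j)) (sym (*-identityˡ _)))))
          (hS zero)
          (multiple-row k (A [ k ]≔ rest) (a ∘ suc) (S ∘ suc) (at A k rest) λ l →
            multiple-resp (overwrite (S (suc l))) (hS (suc l)))
        where
        rest : Vector Carrier n
        rest j = ∑ λ l → a (suc l) * S (suc l) j
        overwrite : ∀ v i → (A [ k ]≔ v) i ≋ ((A [ k ]≔ rest) [ k ]≔ v) i
        overwrite v i with i ≟ k
        ... | yes ≡.refl = λ j → trans (at A k v j) (sym (at (A [ k ]≔ rest) k v j))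
        ... | no i≢k     = λ j → trans (off A v i≢k j)
                             (sym (trans (off (A [ k ]≔ rest) v i≢k j) (off A rest i≢k j)))

      collision : ∀ {n} (k : Fin n) (f : Fin n → Fin n) → (∀ j → f j ≢ k) →
                  ∃ λ i → ∃ λ l → i ≢ l × f i ≡ f l
      collision {suc n} k f h with pigeonhole (ℕ.n<1+n n) (λ j → punchOut (h j ∘ ≡.sym))
      ... | i , l , i<l , fi≡fl = i , l , (λ i≡l → ℕ.<⇒≢ i<l (≡.cong toℕ i≡l)) ,
        punchOut-injective (h i ∘ ≡.sym) (h l ∘ ≡.sym) fi≡fl

      transpose : Fin n → Fin n → (Fin n → Fin n) → Fin n → Fin n
      transpose i k f l = if does (l ≟ i) then f k else (if does (l ≟ k) then f i else f l)

      multiple-swap : ∀ {i k} (f : Fin n → Fin n) → i ≢ k →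
                      Multiple (R ∘ transpose i k f) → Multiple (R ∘ f)
      multiple-swap {i} {k} f i≢k (a , p) = - a , (begin
        det (R ∘ f)
          ≈⟨ inverseʳ-unique _ _ (trans (+-cong (det-cong λ l → ≡⇒≋ (≡.sym (same l))) (det-cong λ l → ≡⇒≋ (≡.sym (swapped l))))
               (trans (+-comm _ _) (det-swap i≢k (det-alternating i k i≢k) (R ∘ f) (R (f i)) (R (f k))))) ⟩
        - det (R ∘ transpose i k f)
          ≈⟨ -‿cong p ⟩
        - (a * det R)
          ≈⟨ solve 2 (λ a d → :- (a :* d) := (:- a) :* d) refl _ _ ⟩
        - a * det R ∎)
        where
        same : ∀ l → replace₂ i k (R ∘ f) (R (f k)) (R (f i)) l ≡ R (transpose i k f l)
        same l with l ≟ i | l ≟ k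
        ... | yes _ | _     = ≡.refl
        ... | no _  | yes _ = ≡.refl
        ... | no _  | no _  = ≡.refl
        swapped : ∀ l → replace₂ i k (R ∘ f) (R (f i)) (R (f k)) l ≡ R (f l)
        swapped l with l ≟ i | l ≟ k
        ... | yes ≡.refl | _          = ≡.refl
        ... | no _       | yes ≡.refl = ≡.refl
        ... | no _       | no _       = ≡.refl

    -- Selection sort on the row indices: the first `k` positions are right and `d` remain. If `f`
    -- misses the index `K` due next, two of its values coincide by the pigeonhole principle and two
    -- rows are equal.
    multiple-selection : ∀ d k → k ℕ.+ d ≡ n → (f : Fin n → Fin n) →
                         (∀ i → toℕ i ℕ.< k → f i ≡ i) → Multiple (R ∘ f)
    multiple-selection zero k k+0≡n f fix = multiple-resp {R} {R ∘ f}
      (λ i → ≡⇒≋ (≡.cong R (≡.sym (fix i (≡.subst (toℕ i ℕ.<_) (≡.trans (≡.sym k+0≡n) (ℕ.+-identityʳ k)) (toℕ<n i))))))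
      (1# , sym (*-identityˡ _))
    multiple-selection (suc d) k k+1+d≡n f fix = select (any? (λ j → f j ≟ K))
      where
      k<n : k ℕ.< n
      k<n = ≡.subst (k ℕ.<_) k+1+d≡n (ℕ.m<m+n k (s≤s z≤n))
      K : Fin n
      K = fromℕ< k<n
      next : suc k ℕ.+ d ≡ n
      next = ≡.trans (≡.sym (ℕ.+-suc k d)) k+1+d≡n
      initial : ∀ {i} → toℕ i ℕ.< suc k → i ≢ K → toℕ i ℕ.< k
      initial i≤k i≢K = ℕ.≤∧≢⇒< (ℕ.s≤s⁻¹ i≤k) λ i≡k → i≢K (toℕ-injective (≡.trans i≡k (≡.sym (toℕ-fromℕ< k<n))))
      fixed : f K ≡ K → ∀ i → toℕ i ℕ.< suc k → f i ≡ i
      fixed fK≡K i i≤k with i ≟ K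
      ... | yes ≡.refl = fK≡K
      ... | no i≢K     = fix i (initial i≤k i≢K)
      swapped : ∀ j → f j ≡ K → j ≢ K → ∀ i → toℕ i ℕ.< suc k → transpose j K f i ≡ i
      swapped j fj≡K j≢K i i≤k with i ≟ j | i ≟ K
      ... | yes ≡.refl | yes i≡K    = contradiction i≡K j≢K
      ... | yes ≡.refl | no i≢K     = contradiction (≡.trans (≡.sym (fix i (initial i≤k i≢K))) fj≡K) j≢K
      ... | no _       | yes ≡.refl = fj≡K
      ... | no _       | no i≢K     = fix i (initial i≤k i≢K)
      place : ∀ j → f j ≡ K → Dec (j ≡ K) → Multiple (R ∘ f)
      place j fj≡K (yes ≡.refl) = multiple-selection d (suc k) next f (fixed fj≡K)
      place j fj≡K (no j≢K)     =
        multiple-swap f j≢K (multiple-selection d (suc k) next (transpose j K f) (swapped j fj≡K j≢K))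
      select : Dec (∃ λ j → f j ≡ K) → Multiple (R ∘ f)
      select (yes (j , fj≡K)) = place j fj≡K (j ≟ K)
      select (no ∄j) with collision K f (λ j fj≡K → ∄j (j , fj≡K))
      ... | i , l , i≢l , fi≡fl =
        multiple-zero (det-alternating i l i≢l (R ∘ f) (≡⇒≋ (≡.cong R fi≡fl)))

    -- Rows i ≥ s are rows of R; rows i < s are arbitrary elements of the span.
    multiple-span : ∀ s → s ℕ.≤ n → (f : Fin n → Fin n) (A : Matrix n n) →
                    (∀ i → Span R (A i)) → (∀ i → s ℕ.≤ toℕ i → A i ≋ R (f i)) → Multiple A
    multiple-span zero s≤n f A _ hf =
      multiple-resp (λ i j → sym (hf i z≤n j)) (multiple-selection n 0 ≡.refl f λ _ ())
    multiple-span (suc s) s<n f A hA hf =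
      multiple-row K A (proj₁ (hA K)) R (proj₂ (hA K)) λ l →
        multiple-span s (ℕ.<⇒≤ s<n) (updateAt f K (const l)) (A [ K ]≔ R l) (inSpan l) (isRow l)
      where
      K : Fin n
      K = fromℕ< s<n
      inSpan : ∀ l i → Span R ((A [ K ]≔ R l) i)
      inSpan l i with i ≟ K
      ... | yes ≡.refl = span-resp (λ j → sym (at A K (R l) j)) (span-row R l)
      ... | no i≢K     = span-resp (λ j → sym (off A (R l) i≢K j)) (hA i)
      isRow : ∀ l i → s ℕ.≤ toℕ i → (A [ K ]≔ R l) i ≋ R (updateAt f K (const l) i)
      isRow l i s≤i with i ≟ K
      ... | yes ≡.refl = λ j → trans (at A K (R l) j) (≡⇒≋ (≡.cong R (≡.sym (updateAt-updates K f))) j)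
      ... | no i≢K     = λ j → trans (off A (R l) i≢K j) (trans
        (hf i (ℕ.≤∧≢⇒< s≤i λ s≡i → i≢K (toℕ-injective (≡.trans (≡.sym s≡i) (≡.sym (toℕ-fromℕ< s<n))))) j)
        (≡⇒≋ (≡.cong R (≡.sym (updateAt-minimal i K f i≢K))) j))

    -- Plays the part of multiplicativity three times: for the Vandermonde determinant, for the
    -- passage from the alternant to integer matrices, and for the kernel of a singular matrix.
    det-span : (A : Matrix n n) → (∀ i → Span R (A i)) → Multiple A
    det-span A hA = multiple-span n ℕ.≤-refl (λ i → i) A hA λ i n≤i → contradiction (toℕ<n i) (ℕ.≤⇒≯ n≤i)

  det-scalar : ∀ a → det {n} (λ i j → a * δ i j) ≈ a ^ n
  det-scalar {zero}  a = refl
  det-scalar {suc n} a = begin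
    ∑ (λ j → sgn j * (a * δ zero j * det (minor aI j)))
      ≈⟨ ∑-single zero (λ { zero 0≢0 → contradiction ≡.refl 0≢0
                          ; (suc j) _ → trans (*-congˡ (trans (*-congʳ (zeroʳ a)) (zeroˡ _))) (zeroʳ _) }) ⟩
    1# * (a * 1# * det (minor aI zero))
      ≈⟨ trans (*-identityˡ _) (*-congʳ (*-identityʳ a)) ⟩
    a * det (minor aI zero)
      ≈⟨ *-congˡ (det-scalar {n} a) ⟩
    a * a ^ n ∎
    where
    aI : Matrix (suc n) (suc n)
    aI i j = a * δ i j

  det-scale : (u v : Vector Carrier n) (A : Matrix n n) →
              det (λ i j → u i * v j * A i j) ≈ ∏ u * ∏ v * det A
  det-scale {zero}  u v A = sym (trans (*-identityʳ _) (*-identityʳ _))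
  det-scale {suc n} u v A = trans (∑-cong λ j → begin
    sgn j * (u zero * v j * A zero j * det (λ i k → u (suc i) * v (punchIn j k) * minor A j i k))
      ≈⟨ *-congˡ (*-congˡ (det-scale (u ∘ suc) (v ∘ punchIn j) (minor A j))) ⟩
    sgn j * (u zero * v j * A zero j * (∏ (u ∘ suc) * ∏ (v ∘ punchIn j) * det (minor A j)))
      ≈⟨ solve 7 (λ s x y z p q d → s :* (x :* y :* z :* (p :* q :* d)) :=
                    x :* p :* (y :* q) :* (s :* (z :* d))) refl _ _ _ _ _ _ _ ⟩
    ∏ u * (v j * ∏ (v ∘ punchIn j)) * (sgn j * (A zero j * det (minor A j)))
      ≈⟨ *-congʳ (*-congˡ (∏-remove {i = j} v)) ⟨
    ∏ u * ∏ v * (sgn j * (A zero j * det (minor A j))) ∎)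
    (∑-*ˡ _ _)

-- Vandermonde matrices and interpolation at separated points.

module Vandermonde {c ℓ} (R : CommutativeRing c ℓ) where
  open CommutativeRing R hiding (zero)
  open Determinant R
  open IntegerImage R using (solve; _:=_; _:+_; _:*_; _:-_; :-_)
  open Summation semiring
  open import Algebra.Properties.CommutativeSemiring.Exp commutativeSemiring
    using (_^_; ^-congʳ)
  open import Data.Fin.Base using (Fin; zero; suc; inject₁; opposite; toℕ)
  open import Data.Fin.Induction using (<-weakInduction)
  open import Data.Fin.Properties using (opposite-involutive; suc-injective; toℕ-inject₁)
  open import Data.Nat.Base using (ℕ; zero; suc)
  open import Data.Product.Base using (∃; _,_; proj₁; proj₂)
  open import Data.Vec.Functional using (Vector)
  open import Function.Base using (_∘_)
  open import Relation.Binary.PropositionalEquality.Core as ≡ using (_≡_; _≢_)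
  open import Relation.Binary.Reasoning.Setoid setoid

  private variable
    n : ℕ

  -- The ring-theoretic form of being apart from 0, with the inverse carried along as a witness.
  Unit : Carrier → Set _
  Unit x = ∃ λ y → y * x ≈ 1#

  unit-resp : ∀ {x y} → x ≈ y → Unit x → Unit y
  unit-resp x≈y (z , zx≈1) = z , trans (*-congˡ (sym x≈y)) zx≈1

  unit-factor : ∀ {x y z} → z ≈ x * y → Unit z → Unit x
  unit-factor {x} {y} {z} z≈xy (w , wz≈1) = w * y , (begin
    w * y * x   ≈⟨ solve 3 (λ w y x → w :* y :* x := w :* (x :* y)) refl w y x ⟩
    w * (x * y) ≈⟨ *-congˡ z≈xy ⟨
    w * z       ≈⟨ wz≈1 ⟩
    1#          ∎)

  unit-* : ∀ {x y} → Unit x → Unit y → Unit (x * y)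
  unit-* {x} {y} (v , vx≈1) (w , wy≈1) = v * w , (begin
    v * w * (x * y) ≈⟨ solve 4 (λ v w x y → v :* w :* (x :* y) := v :* x :* (w :* y)) refl v w x y ⟩
    v * x * (w * y) ≈⟨ *-cong vx≈1 wy≈1 ⟩
    1# * 1#         ≈⟨ *-identityˡ 1# ⟩
    1#              ∎)

  unit-neg : ∀ {x} → Unit x → Unit (- x)
  unit-neg {x} (v , vx≈1) = - v , trans (solve 2 (λ v x → (:- v) :* (:- x) := v :* x) refl v x) vx≈1

  unit-1 : Unit 1#
  unit-1 = 1# , *-identityˡ 1#

  unit-^ : ∀ {x} n → Unit x → Unit (x ^ n)
  unit-^ zero    ux = unit-1
  unit-^ (suc n) ux = unit-* ux (unit-^ n ux)

  unit-cancel : ∀ {x y} → Unit x → x * y ≈ 0# → y ≈ 0#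
  unit-cancel {x} {y} (v , vx≈1) xy≈0 = begin
    y           ≈⟨ *-identityˡ y ⟨
    1# * y      ≈⟨ *-congʳ vx≈1 ⟨
    v * x * y   ≈⟨ *-assoc v x y ⟩
    v * (x * y) ≈⟨ *-congˡ xy≈0 ⟩
    v * 0#      ≈⟨ zeroʳ v ⟩
    0#          ∎

  [x-y]∣x^n-y^n : ∀ n x y → ∃ λ q → x ^ n - y ^ n ≈ (x - y) * q
  [x-y]∣x^n-y^n zero    x y = 0# , trans (-‿inverseʳ 1#) (sym (zeroʳ _))
  [x-y]∣x^n-y^n (suc n) x y with [x-y]∣x^n-y^n n x y
  ... | q , h = x ^ n + y * q , (begin
    x * x ^ n - y * y ^ n
      ≈⟨ solve 4 (λ x y p r → x :* p :- y :* r := (x :- y) :* p :+ y :* (p :- r)) refl _ _ _ _ ⟩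
    (x - y) * x ^ n + y * (x ^ n - y ^ n)
      ≈⟨ +-congˡ (*-congˡ h) ⟩
    (x - y) * x ^ n + y * ((x - y) * q)
      ≈⟨ solve 4 (λ x y p q → (x :- y) :* p :+ y :* ((x :- y) :* q) := (x :- y) :* (p :+ y :* q)) refl _ _ _ _ ⟩
    (x - y) * (x ^ n + y * q) ∎)

  Separated : Vector Carrier n → Set _
  Separated x = ∀ i k → i ≢ k → Unit (x i - x k)

  -- Peel off x₀: the weights of x₁, …, xₙ are determined by the differences
  -- v (j + 1) - x₀ v j, to which x₀ does not contribute.
  interpolate : (x : Vector Carrier n) → Separated x → (v : Vector Carrier n) →
                ∃ λ (a : Vector Carrier n) → ∀ j → ∑ (λ i → a i * x i ^ toℕ j) ≈ v j
  interpolate {zero}  x sep v = v , λ ()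
  interpolate {suc n} x sep v = a , <-weakInduction P base step
    where
    x₀ = x zero
    IH = interpolate (x ∘ suc) (λ i k i≢k → sep (suc i) (suc k) (i≢k ∘ suc-injective))
           (λ j → v (suc j) - x₀ * v (inject₁ j))
    d⁻¹ : Fin n → Carrier
    d⁻¹ i = proj₁ (sep (suc i) zero λ ())
    b : Vector Carrier n
    b i = proj₁ IH i * d⁻¹ i
    a : Vector Carrier (suc n)
    a zero    = v zero - ∑ b
    a (suc i) = b i
    P : Fin (suc n) → Set _
    P j = ∑ (λ i → a i * x i ^ toℕ j) ≈ v j
    base : P zero
    base = begin
      ∑ (λ i → a i * 1#)             ≈⟨ ∑-cong (λ i → *-identityʳ _) ⟩
      ∑ a                            ≈⟨ ∑-suc a ⟩
      v zero - ∑ b + ∑ b             ≈⟨ solve 2 (λ v s → v :- s :+ s := v) refl _ _ ⟩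
      v zero                         ∎
    shift : ∀ (j : Fin n) i → b i * (x (suc i) - x₀) * x (suc i) ^ toℕ j ≈
                              proj₁ IH i * x (suc i) ^ toℕ j
    shift j i = *-congʳ (trans (*-assoc _ _ _) (trans (*-congˡ (proj₂ (sep (suc i) zero λ ()))) (*-identityʳ _)))
    step : ∀ j → P (inject₁ j) → P (suc j)
    step j Pj = begin
      ∑ (λ i → a i * (x i * x i ^ toℕ j))
        ≈⟨ ∑-cong (λ i → solve 4 (λ a x p z → a :* (x :* p) := z :* (a :* p) :+ a :* (x :- z) :* p) refl _ _ _ x₀) ⟩
      ∑ (λ i → x₀ * (a i * x i ^ toℕ j) + a i * (x i - x₀) * x i ^ toℕ j)
        ≈⟨ trans (∑-+ _ _) (+-cong (∑-*ˡ x₀ _) (∑-suc _)) ⟩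
      x₀ * ∑ (λ i → a i * x i ^ toℕ j) +
        (a zero * (x₀ - x₀) * x₀ ^ toℕ j + ∑ (λ i → b i * (x (suc i) - x₀) * x (suc i) ^ toℕ j))
        ≈⟨ +-cong (*-congˡ (trans (∑-cong λ i → *-congˡ (^-congʳ (x i) (≡.sym (toℕ-inject₁ j)))) Pj))
                  (+-cong (trans (*-congʳ (trans (*-congˡ (-‿inverseʳ x₀)) (zeroʳ _))) (zeroˡ _))
                          (trans (∑-cong (shift j)) (proj₂ IH j))) ⟩
      x₀ * v (inject₁ j) + (0# + (v (suc j) - x₀ * v (inject₁ j)))
        ≈⟨ +-congˡ (+-identityˡ _) ⟩
      x₀ * v (inject₁ j) + (v (suc j) - x₀ * v (inject₁ j))
        ≈⟨ solve 2 (λ p q → p :+ (q :- p) := q) refl _ _ ⟩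
      v (suc j) ∎

  vandermonde : Vector Carrier n → Matrix n n
  vandermonde x i j = x i ^ toℕ (opposite j)

  vandermonde-span : (x : Vector Carrier n) → Separated x → ∀ v → Span (vandermonde x) v
  vandermonde-span x sep v with interpolate x sep (v ∘ opposite)
  ... | a , h = a , λ j → sym (trans (h (opposite j)) (reflexive (≡.cong v (opposite-involutive j))))

  -- By interpolation the rows span those of the identity matrix, so 1 is a multiple of the
  -- determinant.
  vandermonde-unit : (x : Vector Carrier n) → Separated x → Unit (det (vandermonde x))
  vandermonde-unit {n} x sep with det-span (vandermonde x) (λ i j → 1# * δ i j) (λ i → vandermonde-span x sep _)
  ... | a , h = a , trans (sym h) (trans (det-scalar {n} 1#) (1^n≈1 n))
    where
    1^n≈1 : ∀ n → 1# ^ n ≈ 1#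
    1^n≈1 zero    = refl
    1^n≈1 (suc n) = trans (*-identityˡ _) (1^n≈1 n)

open import Algebra.Apartness.Bundles using (HeytingField; HeytingCommutativeRing)
open import Data.Fin.Base using (Fin)
open import Data.Nat.Base as ℕ using (ℕ)

-- Names for the rows of the specialized alternant.

module RowIndex (t r : ℕ) where
  open import Data.Fin.Base using (zero; suc; splitAt; join; quotRem; combine; _↑ˡ_; _↑ʳ_)
  open import Data.Fin.Properties using (splitAt-↑ˡ; splitAt-↑ʳ; join-splitAt; remQuot-combine; combine-remQuot)
  open import Data.Nat.Base using (_+_; _*_)
  open import Data.Product.Base using (_×_; _,_; proj₁; proj₂; swap)
  open import Data.Sum.Base using (_⊎_; inj₁; inj₂)
  open import Relation.Binary.PropositionalEquality.Core

  data Row : Set where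
    root    : Fin t → Row
    var inv : Fin r → Row

  -- The order of the components is that of `quotRem`, remainder first: the remainder modulo 2 tells
  -- a variable from its inverse.
  pair : Fin 2 × Fin r → Row
  pair (zero     , l) = var l
  pair (suc zero , l) = inv l

  fromSplit : Fin t ⊎ Fin (r * 2) → Row
  fromSplit (inj₁ k) = root k
  fromSplit (inj₂ m) = pair (quotRem {r} 2 m)

  row : Fin (t + r * 2) → Row
  row i = fromSplit (splitAt t i)

  index : Row → Fin (t + r * 2)
  index (root k) = k ↑ˡ (r * 2)
  index (var l)  = t ↑ʳ combine l zero
  index (inv l)  = t ↑ʳ combine l (suc zero)

  row-index : ∀ ρ → row (index ρ) ≡ ρ
  row-index (root k) = cong fromSplit (splitAt-↑ˡ t k (r * 2))
  row-index (var l)  = trans (cong fromSplit (splitAt-↑ʳ t (r * 2) (combine l zero)))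
    (cong (λ p → pair (swap p)) (remQuot-combine {r} {2} l zero))
  row-index (inv l)  = trans (cong fromSplit (splitAt-↑ʳ t (r * 2) (combine l (suc zero))))
    (cong (λ p → pair (swap p)) (remQuot-combine {r} {2} l (suc zero)))

  index-pair : ∀ p → index (pair p) ≡ t ↑ʳ combine (proj₂ p) (proj₁ p)
  index-pair (zero     , l) = refl
  index-pair (suc zero , l) = refl

  index-fromSplit : ∀ s → index (fromSplit s) ≡ join t (r * 2) s
  index-fromSplit (inj₁ k) = refl
  index-fromSplit (inj₂ m) = trans (index-pair (quotRem {r} 2 m)) (cong (t ↑ʳ_) (combine-remQuot {r} 2 m))

  index-row : ∀ i → index (row i) ≡ i
  index-row i = trans (index-fromSplit (splitAt t i)) (join-splitAt t (r * 2) i)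

  row-injective : ∀ {i k} → row i ≡ row k → i ≡ k
  row-injective {i} {k} e = trans (sym (index-row i)) (trans (cong index e) (index-row k))

-- Specialization of the variables to integers.

module Specialization {c ℓ₁ ℓ₂} (K : HeytingField c ℓ₁ ℓ₂) where
  open import Defs
  R : CommutativeRing c ℓ₁
  R = HeytingCommutativeRing.commutativeRing (HeytingField.heytingCommutativeRing K)
  open HeytingField K using (_#_; #⇒invertible; #-irrefl)
  open CommutativeRing R hiding (zero)
  open Determinant R
  open IntegerImage R
  open Summation semiring
  open Vandermonde R
  open import Algebra.Apartness.Properties.HeytingCommutativeRing
    (HeytingField.heytingCommutativeRing K) using (x-0≈x; invertibleˡ⇒#)
  open import Algebra.Properties.Ring ring using (-1*x≈-x)
  open import Algebra.Properties.CommutativeSemiring.Exp commutativeSemiring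
    using (_^_; ^-distrib-*; ^-congʳ; ^-congˡ; ^-homo-*; ^-assocʳ)
  open import Data.Fin.Base as Fin using (Fin; zero; suc; toℕ)
  open import Data.Fin.Properties using (toℕ<n; toℕ-injective; toℕ-fromℕ<)
  open import Data.Integer.Base as ℤ using (ℤ; -[1+_])
  import Data.Integer.Properties as ℤ
  open import Data.Nat.Base as ℕ using (ℕ; zero; suc; NonZero)
  open import Data.Nat.DivMod using (_/_; _%_; _mod_; m≡m%n+[m/n]*n; m%n<n)
  import Data.Nat.Properties as ℕ
  open import Data.Product.Base using (_×_; _,_; proj₁; proj₂)
  open import Data.Sum.Base using (inj₁; inj₂)
  open import Data.Vec.Functional using (Vector)
  open import Function.Base using (_∘_)
  open import Relation.Binary.PropositionalEquality.Core as ≡ using (_≡_; _≢_)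
  open import Relation.Binary.Definitions using (tri<; tri≈; tri>)
  open import Relation.Binary.Reasoning.Setoid setoid
  open import Relation.Nullary.Decidable.Core using (yes; no)
  open import Relation.Nullary.Negation.Core using (contradiction)
  private
    module Schurᴷ = Schur K
    module ℤDet = Determinant ℤ.+-*-commutativeRing
    module ℤSum = Summation (CommutativeRing.semiring ℤ.+-*-commutativeRing)

  schur-det : ∀ {n} (A : Matrix n n) → Schurᴷ.det A ≈ det A
  schur-det {zero}  A = refl
  schur-det {suc n} A = trans (reflexive (≡.sym (∑≡sum _)))
    (∑-cong λ j → *-congˡ (*-congˡ (schur-det (minor A j))))

  ι-∑ : ∀ {n} (u : Vector ℤ n) → ι (ℤSum.∑ u) ≈ ∑ (ι ∘ u)
  ι-∑ {zero}  u = trans (ι-cong (ℤSum.∑-[] u)) (sym (∑-[] _))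
  ι-∑ {suc n} u = begin
    ι (ℤSum.∑ u)                          ≈⟨ ι-cong (ℤSum.∑-suc u) ⟩
    ι (u zero ℤ.+ ℤSum.∑ (u ∘ suc))       ≈⟨ ι-+ (u zero) _ ⟩
    ι (u zero) + ι (ℤSum.∑ (u ∘ suc))     ≈⟨ +-congˡ (ι-∑ (u ∘ suc)) ⟩
    ι (u zero) + ∑ (ι ∘ u ∘ suc)          ≈⟨ ∑-suc _ ⟨
    ∑ (ι ∘ u)                             ∎

  ι-sgn : ∀ {n} (j : Fin n) → ι (ℤDet.sgn j) ≈ sgn j
  ι-sgn zero    = ι-1
  ι-sgn (suc j) = trans (ι-* (ℤ.- ℤ.1ℤ) (ℤDet.sgn j)) (*-cong (trans (ι-neg ℤ.1ℤ) (-‿cong ι-1)) (ι-sgn j))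

  ι-det : ∀ {n} (A : Fin n → Fin n → ℤ) → ι (ℤDet.det A) ≈ det (λ i j → ι (A i j))
  ι-det {zero}  A = ι-1
  ι-det {suc n} A = trans (ι-∑ _) (∑-cong λ j →
    trans (ι-* (ℤDet.sgn j) _) (*-cong (ι-sgn j) (trans (ι-* (A zero j) _) (*-congˡ (ι-det (ℤDet.minor A j))))))

  ι-^ : ∀ m n → ι (ℤ.+ (m ℕ.^ n)) ≈ ι (ℤ.+ m) ^ n
  ι-^ m zero    = ι-1
  ι-^ m (suc n) = trans (ι-cong (ℤ.pos-* m (m ℕ.^ n))) (trans (ι-* (ℤ.+ m) _) (*-congˡ (ι-^ m n)))

  1^ : ∀ k → 1# ^ k ≈ 1#
  1^ zero    = refl
  1^ (suc k) = trans (*-identityˡ _) (1^ k)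

  apart⇒unit : ∀ {x y} → x # y → Unit (x - y)
  apart⇒unit x#y = proj₁ (#⇒invertible x#y) , proj₁ (proj₂ (#⇒invertible x#y))

  apart⇒unit₀ : ∀ {x} → x # 0# → Unit x
  apart⇒unit₀ {x} x#0 = unit-resp (x-0≈x x) (apart⇒unit x#0)

  unit⇒apart₀ : ∀ {x} → Unit x → x # 0#
  unit⇒apart₀ {x} (y , yx≈1) = invertibleˡ⇒# (y , trans (*-congˡ (x-0≈x x)) yx≈1)

  module _ (char0 : Schurᴷ.CharacteristicZero) where

    ι-unit : ∀ {i} → i ≢ ℤ.0ℤ → Unit (ι i)
    ι-unit {ℤ.+ zero}  i≢0 = contradiction ≡.refl i≢0
    ι-unit {ℤ.+ suc n} _   = apart⇒unit₀ (char0 n)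
    ι-unit { -[1+ n ]} _   = unit-neg (apart⇒unit₀ (char0 n))

    -- Equality with 0 is decided among the integers; a nonzero integer has an invertible image,
    -- which cannot be 0.
    ι-injective₀ : ∀ i → ι i ≈ 0# → i ≡ ℤ.0ℤ
    ι-injective₀ i ιi≈0 with i ℤ.≟ ℤ.0ℤ
    ... | yes i≡0 = i≡0
    ... | no i≢0  = contradiction (unit⇒apart₀ (unit-resp ιi≈0 (ι-unit i≢0))) (#-irrefl refl)

    module _ (t r : ℕ) .{{_ : NonZero t}} (ζ : Carrier) (prim : Schurᴷ.IsPrimitiveRoot t ζ) where
      open RowIndex t r

      x^t≈1⇒x^[m%t]≈x^m : ∀ {x} → x ^ t ≈ 1# → ∀ m → x ^ toℕ (m mod t) ≈ x ^ m
      x^t≈1⇒x^[m%t]≈x^m {x} x^t≈1 m = begin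
        x ^ toℕ (m mod t)               ≈⟨ ^-congʳ x (toℕ-fromℕ< (m%n<n m t)) ⟩
        x ^ (m % t)                     ≈⟨ *-identityʳ _ ⟨
        x ^ (m % t) * 1#                ≈⟨ *-congˡ (powers (m / t)) ⟨
        x ^ (m % t) * x ^ (m / t ℕ.* t) ≈⟨ ^-homo-* x (m % t) _ ⟨
        x ^ (m % t ℕ.+ m / t ℕ.* t)     ≈⟨ ^-congʳ x (m≡m%n+[m/n]*n m t) ⟨
        x ^ m                           ∎
        where
        powers : ∀ q → x ^ (q ℕ.* t) ≈ 1#
        powers zero    = refl
        powers (suc q) = trans (^-homo-* x t (q ℕ.* t)) (trans (*-cong x^t≈1 (powers q)) (*-identityˡ 1#))

      root^t≈1 : ∀ k → (ζ ^ k) ^ t ≈ 1#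
      root^t≈1 k = begin
        (ζ ^ k) ^ t    ≈⟨ ^-assocʳ ζ k t ⟩
        ζ ^ (k ℕ.* t)  ≈⟨ ^-congʳ ζ (ℕ.*-comm k t) ⟩
        ζ ^ (t ℕ.* k)  ≈⟨ ^-assocʳ ζ t k ⟨
        (ζ ^ t) ^ k    ≈⟨ ^-congˡ k (proj₁ prim) ⟩
        1# ^ k         ≈⟨ 1^ k ⟩
        1#             ∎

      root-unit : ∀ k → Unit (ζ ^ k)
      root-unit k = unit-factor {y = (ζ ^ k) ^ ℕ.pred t}
        (reflexive (≡.cong ((ζ ^ k) ^_) (≡.sym (ℕ.suc-pred t))))
        (unit-resp (sym (root^t≈1 k)) unit-1)

      unit-swap : ∀ {x y} → Unit (x - y) → Unit (y - x)
      unit-swap u = unit-resp (solve 2 (λ x y → :- (x :- y) := y :- x) refl _ _) (unit-neg u)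

      roots-gap : ∀ (a b : Fin t) → toℕ a ℕ.< toℕ b → Unit (ζ ^ toℕ b - ζ ^ toℕ a)
      roots-gap a b a<b = unit-resp (begin
        ζ ^ toℕ a * (ζ ^ (toℕ b ℕ.∸ toℕ a) - 1#)
          ≈⟨ distribˡ _ _ _ ⟩
        ζ ^ toℕ a * ζ ^ (toℕ b ℕ.∸ toℕ a) + ζ ^ toℕ a * - 1#
          ≈⟨ +-cong (trans (sym (^-homo-* ζ (toℕ a) _)) (^-congʳ ζ (ℕ.m+[n∸m]≡n (ℕ.<⇒≤ a<b))))
                    (trans (*-comm _ _) (-1*x≈-x _)) ⟩
        ζ ^ toℕ b - ζ ^ toℕ a ∎)
        (unit-* (root-unit (toℕ a)) (apart⇒unit (proj₂ prim _ (ℕ.m<n⇒0<n∸m a<b)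
          (ℕ.≤-<-trans (ℕ.m∸n≤m (toℕ b) (toℕ a)) (toℕ<n b)))))

      roots-separated : Separated (λ (k : Fin t) → ζ ^ toℕ k)
      roots-separated a b a≢b with ℕ.<-cmp (toℕ a) (toℕ b)
      ... | tri≈ _ a≡b _ = contradiction (toℕ-injective a≡b) a≢b
      ... | tri< a<b _ _ = unit-swap (roots-gap a b a<b)
      ... | tri> _ _ b<a = roots-gap b a b<a

      -- The difference divides `x ^ t - 1#`, because the t-th power of the root is 1.
      root-gap : ∀ k {x} → Unit (x ^ t - 1#) → Unit (x - ζ ^ k)
      root-gap k {x} u with [x-y]∣x^n-y^n t x (ζ ^ k)
      ... | q , h = unit-factor (trans (+-congˡ (-‿cong (sym (root^t≈1 k)))) h) u

      module _ (M : Vector ℕ r) (M≥2 : ∀ l → 2 ℕ.≤ M l) (M-injective : ∀ k l → k ≢ l → M k ≢ M l) where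

        z w : Fin r → Carrier
        z l = ι (ℤ.+ M l)

        z-unit : ∀ l → Unit (z l)
        z-unit l = ι-unit λ +M≡0 → ℕ.n≮0 (≡.subst (2 ℕ.≤_) (ℤ.+-injective +M≡0) (M≥2 l))

        z#0 : ∀ l → z l # 0#
        z#0 l = unit⇒apart₀ (z-unit l)

        w l = Schurᴷ.inv (z#0 l)

        wz≈1 : ∀ l → w l * z l ≈ 1#
        wz≈1 l = proj₂ (apart⇒unit₀ (z#0 l))

        w-unit : ∀ l → Unit (w l)
        w-unit l = z l , trans (*-comm _ _) (wz≈1 l)

        value : Row → Carrier
        value (root k) = ζ ^ toℕ k
        value (var l)  = z l
        value (inv l)  = w l

        x : Vector Carrier (t ℕ.+ r ℕ.* 2)
        x = Schurᴷ.point t r ζ z z#0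

        point-value : ∀ i → x i ≡ value (row i)
        point-value i with Fin.splitAt t i
        ... | inj₁ k = ≡.refl
        ... | inj₂ m with Fin.quotRem {r} 2 m
        ...   | zero     , l = ≡.refl
        ...   | suc zero , l = ≡.refl

        z^t-1 : ∀ l → Unit (z l ^ t - 1#)
        z^t-1 l = unit-resp (begin
          ι (ℤ.+ (M l ℕ.^ t) ℤ.- ℤ.1ℤ)         ≈⟨ ι-+ (ℤ.+ (M l ℕ.^ t)) (ℤ.- ℤ.1ℤ) ⟩
          ι (ℤ.+ (M l ℕ.^ t)) + ι (ℤ.- ℤ.1ℤ)   ≈⟨ +-cong (ι-^ (M l) t) (trans (ι-neg ℤ.1ℤ) (-‿cong ι-1)) ⟩
          z l ^ t - 1#                         ∎)
          (ι-unit λ e → ℕ.<⇒≢ (M^t>1 l) (≡.sym (ℤ.+-injective (ℤ.i-j≡0⇒i≡j _ ℤ.1ℤ e))))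
          where
          M^t>1 : ∀ l → 1 ℕ.< M l ℕ.^ t
          M^t>1 l = ℕ.<-≤-trans (M≥2 l) (≡.subst (ℕ._≤ M l ℕ.^ t) (ℕ.^-identityʳ (M l))
            (ℕ.^-monoʳ-≤ (M l) {{ℕ.>-nonZero (ℕ.<-trans ℕ.z<s (M≥2 l))}} (ℕ.>-nonZero⁻¹ t)))

        w^t-1 : ∀ l → Unit (w l ^ t - 1#)
        w^t-1 l = unit-resp (begin
          w l ^ t * - (z l ^ t - 1#)
            ≈⟨ solve 3 (λ w z o → w :* (:- (z :- o)) := w :* o :- w :* z) refl _ _ _ ⟩
          w l ^ t * 1# - w l ^ t * z l ^ t
            ≈⟨ +-cong (*-identityʳ _) (-‿cong (trans (sym (^-distrib-* (w l) (z l) t))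
                 (trans (^-congˡ t (wz≈1 l)) (1^ t)))) ⟩
          w l ^ t - 1# ∎)
          (unit-* (unit-^ t (w-unit l)) (unit-neg (z^t-1 l)))

        zz-gap : ∀ k l → k ≢ l → Unit (z k - z l)
        zz-gap k l k≢l = unit-resp (trans (ι-+ (ℤ.+ M k) (ℤ.- (ℤ.+ M l))) (+-congˡ (ι-neg (ℤ.+ M l))))
          (ι-unit λ e → M-injective k l k≢l (ℤ.+-injective (ℤ.i-j≡0⇒i≡j _ (ℤ.+ M l) e)))

        ww-gap : ∀ k l → k ≢ l → Unit (w k - w l)
        ww-gap k l k≢l = unit-resp (begin
          w k * w l * (z l - z k)
            ≈⟨ solve 4 (λ a b c d → a :* b :* (c :- d) := a :* (b :* c) :- b :* (a :* d)) refl _ _ _ _ ⟩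
          w k * (w l * z l) - w l * (w k * z k)
            ≈⟨ +-cong (trans (*-congˡ (wz≈1 l)) (*-identityʳ _))
                      (-‿cong (trans (*-congˡ (wz≈1 k)) (*-identityʳ _))) ⟩
          w k - w l ∎)
          (unit-* (unit-* (w-unit k) (w-unit l)) (zz-gap l k (k≢l ∘ ≡.sym)))

        zw-gap : ∀ k l → Unit (z k - w l)
        zw-gap k l = unit-resp (begin
          w l * ι (ℤ.+ (M l ℕ.* M k) ℤ.- ℤ.1ℤ)
            ≈⟨ *-congˡ (ι-+ (ℤ.+ (M l ℕ.* M k)) (ℤ.- ℤ.1ℤ)) ⟩
          w l * (ι (ℤ.+ (M l ℕ.* M k)) + ι (ℤ.- ℤ.1ℤ))
            ≈⟨ *-congˡ (+-cong (trans (ι-cong (ℤ.pos-* (M l) (M k))) (ι-* (ℤ.+ M l) (ℤ.+ M k)))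
                               (trans (ι-neg ℤ.1ℤ) (-‿cong ι-1))) ⟩
          w l * (z l * z k - 1#)
            ≈⟨ solve 4 (λ w z y o → w :* (z :* y :- o) := w :* z :* y :- w :* o) refl _ _ _ _ ⟩
          w l * z l * z k - w l * 1#
            ≈⟨ +-cong (trans (*-congʳ (wz≈1 l)) (*-identityˡ _)) (-‿cong (*-identityʳ _)) ⟩
          z k - w l ∎)
          (unit-* (w-unit l) (ι-unit λ e →
            ℕ.<⇒≢ (ℕ.<-≤-trans (ℕ.s≤s (ℕ.s≤s ℕ.z≤n)) (ℕ.*-mono-≤ (M≥2 l) (M≥2 k)))
              (≡.sym (ℤ.+-injective (ℤ.i-j≡0⇒i≡j _ ℤ.1ℤ e)))))

        -- The specialization avoids the zeros of the denominator: neither an integer `M l` ≥ 2 nor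
        -- its inverse is a t-th root of unity, and `M l * M k` ≠ 1 separates the variables from the
        -- inverses.
        value-separated : ∀ ρ σ → ρ ≢ σ → Unit (value ρ - value σ)
        value-separated (root a) (root b) ρ≢σ = roots-separated a b (ρ≢σ ∘ ≡.cong root)
        value-separated (root a) (var l)  ρ≢σ = unit-swap (root-gap (toℕ a) (z^t-1 l))
        value-separated (root a) (inv l)  ρ≢σ = unit-swap (root-gap (toℕ a) (w^t-1 l))
        value-separated (var k)  (root b) ρ≢σ = root-gap (toℕ b) (z^t-1 k)
        value-separated (var k)  (var l)  ρ≢σ = zz-gap k l (ρ≢σ ∘ ≡.cong var)
        value-separated (var k)  (inv l)  ρ≢σ = zw-gap k l
        value-separated (inv k)  (root b) ρ≢σ = root-gap (toℕ b) (w^t-1 k)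
        value-separated (inv k)  (var l)  ρ≢σ = unit-swap (zw-gap l k)
        value-separated (inv k)  (inv l)  ρ≢σ = ww-gap k l (ρ≢σ ∘ ≡.cong inv)

        point-separated : Separated x
        point-separated i k i≢k = unit-resp
          (reflexive (≡.sym (≡.cong₂ _-_ (point-value i) (point-value k))))
          (value-separated (row i) (row k) (i≢k ∘ row-injective))

        module _ (lam : Vector ℕ (t ℕ.+ r ℕ.* 2)) where

          β : Vector ℕ (t ℕ.+ r ℕ.* 2)
          β = shifted lam

          A : Matrix (t ℕ.+ r ℕ.* 2) (t ℕ.+ r ℕ.* 2)
          A i j = x i ^ β j

          row-span : ∀ ρ → Span A (λ j → value ρ ^ β j)
          row-span ρ = span-resp (λ j → ^-congˡ (β j) (reflexive
            (≡.trans (point-value (index ρ)) (≡.cong value (row-index ρ))))) (span-row A (index ρ))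

          -- A discrete Fourier inversion: interpolation at the roots of unity gives weights that
          -- reproduce the indicator of `i` on the exponents below `t`, and powers of these roots
          -- have period `t` in the exponent.
          class-span : ∀ i → Span A (λ j → ι (ℤDet.δ (β j mod t) i))
          class-span i with interpolate (λ k → ζ ^ toℕ k) roots-separated (λ m → ι (ℤDet.δ m i))
          ... | a , h = span-resp (λ j → trans
            (∑-cong λ k → *-congˡ (sym (x^t≈1⇒x^[m%t]≈x^m (root^t≈1 (toℕ k)) (β j))))
            (h (β j mod t))) (span-∑ a λ k → row-span (root k))

          var-span : ∀ l → Span A (λ j → ι (ℤ.+ (M l ℕ.^ β j)))
          var-span l = span-resp (λ j → sym (ι-^ (M l) (β j))) (row-span (var l))

          -- The factor `z l ^ e` clears the denominators in the row of an inverse variable.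
          inv-span : ∀ l e → (∀ j → β j ℕ.≤ e) → Span A (λ j → ι (ℤ.+ (M l ℕ.^ (e ℕ.∸ β j))))
          inv-span l e β≤e = span-resp (λ j → begin
            z l ^ e * w l ^ β j
              ≈⟨ *-congʳ (trans (^-congʳ (z l) (≡.sym (ℕ.m∸n+n≡m (β≤e j)))) (^-homo-* (z l) (e ℕ.∸ β j) (β j))) ⟩
            z l ^ (e ℕ.∸ β j) * z l ^ β j * w l ^ β j
              ≈⟨ trans (*-assoc _ _ _) (*-congˡ (trans (*-comm _ _) (trans (sym (^-distrib-* (w l) (z l) (β j)))
                   (trans (^-congˡ (β j) (wz≈1 l)) (1^ (β j)))))) ⟩
            z l ^ (e ℕ.∸ β j) * 1#
              ≈⟨ trans (*-identityʳ _) (sym (ι-^ (M l) (e ℕ.∸ β j))) ⟩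
            ι (ℤ.+ (M l ℕ.^ (e ℕ.∸ β j))) ∎) (span-scale (z l ^ e) (row-span (inv l)))

          integer-det-zero : Schurᴷ.VanishesIdentically t r ζ lam →
            (E : Fin (t ℕ.+ r ℕ.* 2) → Fin (t ℕ.+ r ℕ.* 2) → ℤ) →
            (∀ i → Span A (ι ∘ E i)) → ℤDet.det E ≡ ℤ.0ℤ
          integer-det-zero vanishes E E-span = ι-injective₀ _ (begin
            ι (ℤDet.det E)             ≈⟨ ι-det E ⟩
            det (λ i j → ι (E i j))    ≈⟨ proj₂ (det-span A _ E-span) ⟩
            proj₁ (det-span A _ E-span) * det A ≈⟨ *-congˡ det-A≈0 ⟩
            proj₁ (det-span A _ E-span) * 0#    ≈⟨ zeroʳ _ ⟩
            0#                         ∎)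
            where
            -- The vanishing hypothesis speaks only of points with an invertible denominator; the
            -- pairwise separation of the coordinates provides this.
            V#0 : Schurᴷ.alternant staircase x # 0#
            V#0 = unit⇒apart₀ (unit-resp (sym (schur-det (vandermonde x))) (vandermonde-unit x point-separated))
            det-A≈0 : det A ≈ 0#
            det-A≈0 = trans (sym (schur-det A)) (unit-cancel
              (_ , trans (*-comm _ _) (proj₂ (apart⇒unit₀ V#0)))
              (trans (*-comm _ _) (vanishes z z#0 V#0)))

-- Kernels and congruences of integer matrices.

module IntegerKernel where
  import Data.Integer.Properties as ℤ
  open Determinant ℤ.+-*-commutativeRing
  open Summation (CommutativeRing.semiring ℤ.+-*-commutativeRing)
  open import Data.Fin.Base using (zero; suc; punchIn)
  open import Data.Fin.Properties using (any?)
  open import Data.Integer.Base hiding (suc)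
  open import Data.Integer.Divisibility.Signed
  open import Data.Integer.Tactic.RingSolver using (solve-∀)
  open import Algebra.Properties.Semiring.Exp (CommutativeRing.semiring ℤ.+-*-commutativeRing)
    using () renaming (_^_ to _^ℤ_)
  open import Data.Nat.Base using (zero; suc)
  open import Data.Product.Base using (∃; _×_; _,_)
  open import Data.Sum.Base using (_⊎_; inj₁; inj₂)
  open import Data.Vec.Functional using (Vector; _∷_)
  open import Function.Base using (_∘_)
  open import Relation.Binary.PropositionalEquality
  open import Relation.Nullary.Decidable.Core using (yes; no; ¬?; decidable-stable)
  open import Relation.Nullary.Negation.Core using (contradiction)
  open ≡-Reasoning

  private variable
    m n : ℕ

  *-≢0 : ∀ {a b} → a ≢ 0ℤ → b ≢ 0ℤ → a * b ≢ 0ℤ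
  *-≢0 {a} a≢0 b≢0 ab≡0 with ℤ.i*j≡0⇒i≡0∨j≡0 a ab≡0
  ... | inj₁ a≡0 = a≢0 a≡0
  ... | inj₂ b≡0 = b≢0 b≡0

  Kernel : Matrix m n → Vector ℤ n → Set
  Kernel A κ = (∃ λ j → κ j ≢ 0ℤ) × (∀ i → ∑ (λ j → A i j * κ j) ≡ 0ℤ)

  -- Full column rank over the integers: the unit vectors are reached only after multiplication by a
  -- common nonzero `a`.
  SpansMultiples : Matrix m n → Set
  SpansMultiples A = ∃ λ a → a ≢ 0ℤ × (∀ k → Span A (λ j → a * δ k j))

  -- Fraction-free Gaussian elimination on the first column.
  kernel-or-span : (A : Matrix m n) → ∃ (Kernel A) ⊎ SpansMultiples A
  kernel-or-span {m} {zero}  A = inj₂ (1ℤ , (λ ()) , λ ())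
  kernel-or-span {m} {suc n} A with any? (λ i → ¬? (A i zero ℤ.≟ 0ℤ))
  ... | no ∄p = inj₁ (δ zero , (zero , λ ()) , λ i → ∑-zero λ
    { zero    → cong (_* 1ℤ) (decidable-stable (A i zero ℤ.≟ 0ℤ) λ Ai0≢0 → ∄p (i , Ai0≢0))
    ; (suc j) → ℤ.*-zeroʳ (A i (suc j)) })
  ... | yes (p , a≢0) = extend (kernel-or-span A′)
    where
    a = A p zero
    reduced : Matrix m (suc n)
    reduced i j = a * A i j + - A i zero * A p j
    A′ : Matrix m n
    A′ i j = reduced i (suc j)
    zero-column : ∀ i → reduced i zero ≡ 0ℤ
    zero-column i = lemma a (A i zero)
      where
      lemma : ∀ x y → x * y + - y * x ≡ 0ℤ
      lemma = solve-∀
    reduced-span : ∀ i → Span A (reduced i)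
    reduced-span i = span-linear {A = A} a (- A i zero) (span-row A i) (span-row A p)
    extend : ∃ (Kernel A′) ⊎ SpansMultiples A′ → ∃ (Kernel A) ⊎ SpansMultiples A
    extend (inj₁ (κ′ , (k , κ′k≢0) , A′κ′≡0)) =
      inj₁ (κ , (suc k , *-≢0 a≢0 κ′k≢0) , λ i → ℤ.*-cancelˡ-≡ a _ _ {{≢-nonZero a≢0}} (begin
        a * ∑ (λ j → A i j * κ j)
          ≡⟨ cong (a *_) (trans (∑-suc _) (cong (λ x → A i zero * κ zero + x) (pull i))) ⟩
        a * (A i zero * - S p + a * S i)
          ≡⟨ lemma a (A i zero) (S p) (S i) ⟩
        a * (a * S i + - A i zero * S p)
          ≡⟨ cong (a *_) (trans (sym (∑-linear a (- A i zero) _ _)) (trans (∑-cong λ j →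
               lemma₂ a (A i (suc j)) (κ′ j) (A i zero) (A p (suc j))) (A′κ′≡0 i))) ⟩
        a * 0ℤ ∎))
      where
      S : Fin m → ℤ
      S i = ∑ λ j → A i (suc j) * κ′ j
      κ : Vector ℤ (suc n)
      κ = - S p ∷ λ j → a * κ′ j
      pull : ∀ i → ∑ (λ j → A i (suc j) * (a * κ′ j)) ≡ a * S i
      pull i = trans (∑-cong λ j → comm (A i (suc j)) a (κ′ j)) (∑-*ˡ a _)
        where
        comm : ∀ x y z → x * (y * z) ≡ y * (x * z)
        comm = solve-∀
      lemma : ∀ a b p i → a * (b * - p + a * i) ≡ a * (a * i + - b * p)
      lemma = solve-∀
      lemma₂ : ∀ a x k b y → a * (x * k) + - b * (y * k) ≡ (a * x + - b * y) * k
      lemma₂ = solve-∀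
    extend (inj₂ (c , c≢0 , h)) = inj₂ (a * c , *-≢0 a≢0 c≢0 , multiples)
      where
      lift : ∀ {v} → Span A′ v → Span A (0ℤ ∷ v)
      lift {v} (b , g) = span-resp {A = A} (λ
        { zero    → ∑-zero λ i → trans (cong (b i *_) (zero-column i)) (ℤ.*-zeroʳ (b i))
        ; (suc j) → sym (g j) }) (span-∑ {A = A} b {reduced} reduced-span)
      multiples : ∀ k → Span A (λ j → a * c * δ k j)
      multiples (suc k) = span-resp {A = A} (λ
        { zero    → trans (ℤ.*-zeroʳ a) (sym (ℤ.*-zeroʳ (a * c)))
        ; (suc j) → sym (ℤ.*-assoc a c _) }) (span-scale {A = A} a (lift (h k)))
      -- The lifted vectors, weighted by the entries of the pivot row, are subtracted from `c` times
      -- that row. This clears its later entries and leaves `a * c` in front.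
      multiples zero = span-resp {A = A} (λ
        { zero    → trans (cong (λ x → c * a + -1ℤ * x) (∑-zero λ k → ℤ.*-zeroʳ (A p (suc k)))) (first c a)
        ; (suc j) → trans (cong (λ x → c * A p (suc j) + -1ℤ * x) (trans
            (∑-single j λ k k≢j → trans (cong (λ x → A p (suc k) * (c * x)) (δ-≢ k j k≢j)) (trans (cong (A p (suc k) *_) (ℤ.*-zeroʳ c)) (ℤ.*-zeroʳ (A p (suc k)))))
            (cong (λ x → A p (suc j) * (c * x)) (δ-≡ j)))) (later a c (A p (suc j))) })
        (span-linear {A = A} c -1ℤ (span-row A p)
          (span-∑ {A = A} (λ k → A p (suc k)) {λ k → 0ℤ ∷ λ j → c * δ k j} λ k → lift (h k)))
        where
        first : ∀ c a → c * a + -1ℤ * 0ℤ ≡ a * c * 1ℤ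
        first = solve-∀
        later : ∀ a c x → c * x + -1ℤ * (x * (c * 1ℤ)) ≡ a * c * 0ℤ
        later = solve-∀

  -- If the rows spanned multiples of all unit vectors, the determinant `a ^ n` of a nonzero scalar
  -- matrix would be a multiple of 0.
  kernel : (A : Matrix n n) → det A ≡ 0ℤ → ∃ (Kernel A)
  kernel {n} A detA≡0 with kernel-or-span A
  ... | inj₁ k = k
  ... | inj₂ (a , a≢0 , h) with det-span A (λ k j → a * δ k j) h
  ...   | b , e = contradiction (begin
    a ^ℤ n             ≡⟨ det-scalar {n} a ⟨
    det {n} (λ k j → a * δ k j) ≡⟨ e ⟩
    b * det A          ≡⟨ cong (b *_) detA≡0 ⟩
    b * 0ℤ             ≡⟨ ℤ.*-zeroʳ b ⟩
    0ℤ                 ∎) (power n)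
    where
    power : ∀ n → a ^ℤ n ≢ 0ℤ
    power zero    ()
    power (suc n) = *-≢0 a≢0 (power n)

  infix 4 _≈_mod_
  record _≈_mod_ (x y s : ℤ) : Set where
    constructor congruent
    field ∣difference : s ∣ x - y
  open _≈_mod_ public

  +-mod : ∀ {s x y x′ y′} → x ≈ x′ mod s → y ≈ y′ mod s → x + y ≈ x′ + y′ mod s
  +-mod {s} {x} {y} {x′} {y′} (congruent p) (congruent q) =
    congruent (subst (s ∣_) (lemma x y x′ y′) (∣m∣n⇒∣m+n p q))
    where
    lemma : ∀ x y x′ y′ → (x - x′) + (y - y′) ≡ x + y - (x′ + y′)
    lemma = solve-∀

  *-mod : ∀ {s x y x′ y′} → x ≈ x′ mod s → y ≈ y′ mod s → x * y ≈ x′ * y′ mod s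
  *-mod {s} {x} {y} {x′} {y′} (congruent p) (congruent q) =
    congruent (subst (s ∣_) (lemma x y x′ y′) (∣m∣n⇒∣m+n (∣m⇒∣m*n y p) (∣n⇒∣m*n x′ q)))
    where
    lemma : ∀ x y x′ y′ → (x - x′) * y + x′ * (y - y′) ≡ x * y - x′ * y′
    lemma = solve-∀

  refl-mod : ∀ {s} x → x ≈ x mod s
  refl-mod x = congruent (divides 0ℤ (ℤ.+-inverseʳ x))

  sym-mod : ∀ {s x y} → x ≈ y mod s → y ≈ x mod s
  sym-mod {s} {x} {y} (congruent p) = congruent (subst (s ∣_) (lemma x y) (∣m⇒∣-m p))
    where
    lemma : ∀ x y → - (x - y) ≡ y - x
    lemma = solve-∀

  ∑-mod : ∀ {s} {u v : Vector ℤ n} → (∀ i → u i ≈ v i mod s) → ∑ u ≈ ∑ v mod s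
  ∑-mod {zero}  {s} {u} {v} h = subst₂ (_≈_mod s) (sym (∑-[] u)) (sym (∑-[] v)) (refl-mod 0ℤ)
  ∑-mod {suc n} {s} {u} {v} h =
    subst₂ (_≈_mod s) (sym (∑-suc u)) (sym (∑-suc v)) (+-mod (h zero) (∑-mod (h ∘ suc)))

  det-mod : ∀ {s} (A B : Matrix n n) → (∀ i j → A i j ≈ B i j mod s) → det A ≈ det B mod s
  det-mod {zero}  A B h = refl-mod 1ℤ
  det-mod {suc n} A B h = ∑-mod λ j → *-mod (refl-mod (sgn j))
    (*-mod (h zero j) (det-mod (minor A j) (minor B j) λ i k → h (suc i) (punchIn j k)))

-- Powers of 2, and the constant terms of the scaled alternant.

module Powers where
  open import Data.Nat.Base
  open import Data.Nat.Properties
  open import Relation.Binary.Definitions using (tri<; tri≈; tri>)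
  open import Relation.Binary.PropositionalEquality
  open import Relation.Nullary.Negation.Core using (contradiction)

  2^-injective : ∀ {m n} → 2 ^ m ≡ 2 ^ n → m ≡ n
  2^-injective {m} {n} e with <-cmp m n
  ... | tri< m<n _ _ = contradiction e (<⇒≢ (^-monoʳ-< 2 ≤-refl m<n))
  ... | tri≈ _ m≡n _ = m≡n
  ... | tri> _ _ n<m = contradiction (sym e) (<⇒≢ (^-monoʳ-< 2 ≤-refl n<m))

-- Put z_l = s⁴ 2^(w l).  After scaling the rows and columns of the alternant by
-- suitable powers of s, its entries become polynomials in s; their constant
-- terms form the matrix B 0.
module ConstantTerm (t r : ℕ) .{{_ : ℕ.NonZero t}} (β : Fin (t ℕ.+ r ℕ.* 2) → ℕ) where
  import Data.Integer.Properties as ℤ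
  open Determinant ℤ.+-*-commutativeRing
  open Summation (CommutativeRing.semiring ℤ.+-*-commutativeRing)
  open import Algebra.Properties.CommutativeMonoid.Sum
    (CommutativeRing.*-commutativeMonoid ℤ.+-*-commutativeRing) using () renaming (sum to ∏)
  open IntegerKernel
  open RowIndex t r
  open import Data.Fin.Base using (zero; suc)
  import Data.Fin.Properties as Fin
  open import Data.Integer.Base as ℤ using (ℤ; 0ℤ)
  open import Data.Integer.Divisibility.Signed using (divides; ∣⇒∣ᵤ)
  open import Data.Nat.Base hiding (ℕ; zero; suc; _/_; _%_)
  import Data.Nat.Base as ℕ
  open import Data.Nat.Divisibility using (_∣_; ∣⇒≤)
  open import Data.Nat.DivMod using (_mod_)
  open import Data.Nat.Properties
  open import Data.Nat.Tactic.RingSolver using (solve-∀)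
  open import Data.Product.Base using (∃; _×_; _,_)
  open import Data.Sum.Base using (inj₁; inj₂)
  open import Data.Vec.Functional using (Vector)
  open import Function.Base using (_∘_)
  open import Relation.Binary.PropositionalEquality
  open import Relation.Nullary.Decidable.Core using (yes; no)
  open import Relation.Nullary.Negation.Core using (contradiction)

  private
    N = t + r * 2

  ^-distribʳ-* : ∀ n a b → (a * b) ^ n ≡ a ^ n * b ^ n
  ^-distribʳ-* ℕ.zero    a b = refl
  ^-distribʳ-* (ℕ.suc n) a b = trans (cong (a * b *_) (^-distribʳ-* n a b)) (interchange a b _ _)
    where
    interchange : ∀ a b c d → a * b * (c * d) ≡ a * c * (b * d)
    interchange = solve-∀

  ∏≢0 : ∀ {n} (u : Vector ℤ n) → (∀ i → u i ≢ 0ℤ) → ∏ u ≢ 0ℤ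
  ∏≢0 {ℕ.zero}  u h ()
  ∏≢0 {ℕ.suc n} u h = *-≢0 (h zero) (∏≢0 (u ∘ suc) (h ∘ suc))

  power-mod : ∀ s k → ℤ.+ (s ^ k) ≈ ℤ.+ (0 ^ k) mod ℤ.+ s
  power-mod s ℕ.zero    = refl-mod ℤ.1ℤ
  power-mod s (ℕ.suc k) = congruent (divides (ℤ.+ (s ^ k))
    (trans (ℤ.+-identityʳ _) (trans (cong ℤ.+_ (*-comm s (s ^ k))) (ℤ.pos-* (s ^ k) s))))

  ∣small⇒≡0 : ∀ {s x} → ℤ.∣ x ∣ < s → x ≈ 0ℤ mod ℤ.+ s → x ≡ 0ℤ
  ∣small⇒≡0 {s} {x} ∣x∣<s (congruent d) with ℤ.∣ x ∣ in eq
  ... | ℕ.zero  = ℤ.∣i∣≡0⇒i≡0 eq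
  ... | ℕ.suc k = contradiction ∣x∣<s (≤⇒≯ (∣⇒≤ (subst (λ y → s ∣ y)
    (trans (cong ℤ.∣_∣ (ℤ.+-identityʳ x)) eq) (∣⇒∣ᵤ d))))

  module _ (c e F : ℕ) (β≤e : ∀ j → β j ≤ e) (c≤4e : c ≤ 4 * e) (w : Fin r → ℕ)
           (p : Fin t → Fin N) where

    -- Four times the distance of `β j` from c/4. Distinct x and y are equally near exactly when 2
    -- (x + y) = c, so c = 2τ sees the ties with sum τ and an odd `c` sees none.
    D : Fin N → ℕ
    D j = ∣ 4 * β j - c ∣

    -- In the rows `var` and `inv` the exponents of `s` are twice the excess of `4 * β j` over `c`,
    -- respectively of `c` over `4 * β j`, and 0 if there is none. At s = 0 the convention 0 ^ 0 = 1
    -- turns each power of `s` into the indicator of exponent 0.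
    B : ℕ → Row → Vector ℤ N
    B s (root i) j = δ (β j mod t) i ℤ.* ℤ.+ (s ^ (D j ∸ D (p i)))
    B s (var l)  j = ℤ.+ (s ^ (4 * β j + D j ∸ c)) ℤ.* ℤ.+ (2 ^ (w l * (F + β j)))
    B s (inv l)  j = ℤ.+ (s ^ (c + D j ∸ 4 * β j)) ℤ.* ℤ.+ (2 ^ (w l * (e ∸ β j)))

    W : ℕ
    W = 4 * e + c

    D≤W : ∀ j → D j ≤ W
    D≤W j = ≤-trans (∣m-n∣≤m⊔n (4 * β j) c) (≤-trans (m⊔n≤m+n (4 * β j) c) (+-monoˡ-≤ c (*-monoʳ-≤ 4 (β≤e j))))

    rowExponent : Row → ℕ
    rowExponent (root i) = D (p i)
    rowExponent (var l)  = c
    rowExponent (inv l)  = 4 * e ∸ c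

    -- The extracted powers are put back. The row and column exponents are such that every `D j`
    -- cancels, leaving a constant times a row of class indicators, of powers of `M s l`, or of
    -- powers of its inverse cleared of denominators.
    scaled : ℕ → Row → Vector ℤ N
    scaled s ρ j = ℤ.+ (s ^ rowExponent ρ) ℤ.* ℤ.+ (s ^ (W ∸ D j)) ℤ.* B s ρ j

    -- The fourth power produces the exponents `4 * β j` that are compared with `c`.
    M : ℕ → Fin r → ℕ
    M s l = s ^ 4 * 2 ^ w l

    M^ : ∀ s l n → M s l ^ n ≡ s ^ (4 * n) * 2 ^ (w l * n)
    M^ s l n = trans (^-distribʳ-* n (s ^ 4) (2 ^ w l)) (cong₂ _*_ (^-*-assoc s 4 n) (^-*-assoc 2 (w l) n))

    private
      ^-+₃ : ∀ s a b d → s ^ a * s ^ b * s ^ d ≡ s ^ (a + b + d)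
      ^-+₃ s a b d = sym (trans (^-distribˡ-+-* s (a + b) d) (cong (_* s ^ d) (^-distribˡ-+-* s a b)))

      pos-*₃ : ∀ a b d → ℤ.+ a ℤ.* ℤ.+ b ℤ.* ℤ.+ d ≡ ℤ.+ (a * b * d)
      pos-*₃ a b d = trans (cong (ℤ._* ℤ.+ d) (sym (ℤ.pos-* a b))) (sym (ℤ.pos-* (a * b) d))

      pos-*₄ : ∀ a b d f → ℤ.+ a ℤ.* ℤ.+ b ℤ.* (ℤ.+ d ℤ.* ℤ.+ f) ≡ ℤ.+ (a * b * d * f)
      pos-*₄ a b d f = trans (sym (ℤ.*-assoc (ℤ.+ a ℤ.* ℤ.+ b) (ℤ.+ d) (ℤ.+ f)))
        (trans (cong (ℤ._* ℤ.+ f) (pos-*₃ a b d)) (sym (ℤ.pos-* (a * b * d) f)))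

    module _ (near : ∀ j → D (p (β j mod t)) ≤ D j) where

      scaled-root : ∀ s i j → scaled s (root i) j ≡ ℤ.+ (s ^ W) ℤ.* δ (β j mod t) i
      scaled-root s i j with β j mod t Fin.≟ i
      ... | no _     = trans (ℤ.*-zeroʳ (ℤ.+ (s ^ D (p i)) ℤ.* ℤ.+ (s ^ (W ∸ D j)))) (sym (ℤ.*-zeroʳ (ℤ.+ (s ^ W))))
      ... | yes refl = begin
        ℤ.+ a ℤ.* ℤ.+ b ℤ.* (ℤ.1ℤ ℤ.* ℤ.+ d) ≡⟨ cong (ℤ.+ a ℤ.* ℤ.+ b ℤ.*_) (ℤ.*-identityˡ _) ⟩
        ℤ.+ a ℤ.* ℤ.+ b ℤ.* ℤ.+ d            ≡⟨ pos-*₃ a b d ⟩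
        ℤ.+ (a * b * d)                      ≡⟨ cong ℤ.+_ (trans (^-+₃ s (D (p i)) (W ∸ D j) (D j ∸ D (p i))) (cong (s ^_) exponent)) ⟩
        ℤ.+ (s ^ W)                          ≡⟨ ℤ.*-identityʳ _ ⟨
        ℤ.+ (s ^ W) ℤ.* ℤ.1ℤ                 ∎
        where
        open ≡-Reasoning
        a = s ^ D (p i)
        b = s ^ (W ∸ D j)
        d = s ^ (D j ∸ D (p i))
        swap : ∀ x y z → x + y + z ≡ y + (z + x)
        swap = solve-∀
        exponent : D (p i) + (W ∸ D j) + (D j ∸ D (p i)) ≡ W
        exponent = trans (swap (D (p i)) _ _) (trans (cong (W ∸ D j +_) (m∸n+n≡m (near j))) (m∸n+n≡m (D≤W j)))

      scaled-var : ∀ s l j → scaled s (var l) j ≡ ℤ.+ (s ^ W * 2 ^ (w l * F)) ℤ.* ℤ.+ (M s l ^ β j)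
      scaled-var s l j = trans (pos-*₄ (s ^ c) (s ^ (W ∸ D j)) (s ^ (4 * β j + D j ∸ c)) (2 ^ (w l * (F + β j)))) (trans (cong ℤ.+_ (begin
        s ^ c * s ^ (W ∸ D j) * s ^ (4 * β j + D j ∸ c) * 2 ^ (w l * (F + β j))
          ≡⟨ cong₂ _*_ (trans (^-+₃ s c _ _) (trans (cong (s ^_) exponent) (^-distribˡ-+-* s W (4 * β j))))
                       (trans (cong (2 ^_) (*-distribˡ-+ (w l) F (β j))) (^-distribˡ-+-* 2 (w l * F) (w l * β j))) ⟩
        s ^ W * s ^ (4 * β j) * (2 ^ (w l * F) * 2 ^ (w l * β j))
          ≡⟨ interchange (s ^ W) (s ^ (4 * β j)) _ _ ⟩
        s ^ W * 2 ^ (w l * F) * (s ^ (4 * β j) * 2 ^ (w l * β j))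
          ≡⟨ cong (s ^ W * 2 ^ (w l * F) *_) (M^ s l (β j)) ⟨
        s ^ W * 2 ^ (w l * F) * M s l ^ β j ∎)) (ℤ.pos-* (s ^ W * 2 ^ (w l * F)) (M s l ^ β j)))
        where
        open ≡-Reasoning
        interchange : ∀ a b c d → a * b * (c * d) ≡ a * c * (b * d)
        interchange = solve-∀
        c≤4β+D : c ≤ 4 * β j + D j
        c≤4β+D = m≤n+∣n-m∣ c (4 * β j)
        swap : ∀ x y z → x + y + z ≡ y + (z + x)
        swap = solve-∀
        shuffle : ∀ x y z → x + (y + z) ≡ x + z + y
        shuffle = solve-∀
        exponent : c + (W ∸ D j) + (4 * β j + D j ∸ c) ≡ W + 4 * β j
        exponent = trans (swap c _ _) (trans (cong (W ∸ D j +_) (m∸n+n≡m c≤4β+D))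
          (trans (shuffle (W ∸ D j) _ _) (cong (_+ 4 * β j) (m∸n+n≡m (D≤W j)))))

      scaled-inv : ∀ s l j → scaled s (inv l) j ≡ ℤ.+ (s ^ W) ℤ.* ℤ.+ (M s l ^ (e ∸ β j))
      scaled-inv s l j = trans (pos-*₄ (s ^ (4 * e ∸ c)) (s ^ (W ∸ D j)) (s ^ (c + D j ∸ 4 * β j)) (2 ^ (w l * (e ∸ β j)))) (trans (cong ℤ.+_ (begin
        s ^ (4 * e ∸ c) * s ^ (W ∸ D j) * s ^ (c + D j ∸ 4 * β j) * 2 ^ (w l * (e ∸ β j))
          ≡⟨ cong (_* 2 ^ (w l * (e ∸ β j))) (trans (^-+₃ s (4 * e ∸ c) _ _)
               (trans (cong (s ^_) exponent) (^-distribˡ-+-* s W (4 * (e ∸ β j))))) ⟩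
        s ^ W * s ^ (4 * (e ∸ β j)) * 2 ^ (w l * (e ∸ β j))
          ≡⟨ trans (*-assoc (s ^ W) _ _) (cong (s ^ W *_) (sym (M^ s l (e ∸ β j)))) ⟩
        s ^ W * M s l ^ (e ∸ β j) ∎)) (ℤ.pos-* (s ^ W) (M s l ^ (e ∸ β j))))
        where
        open ≡-Reasoning
        collect : ∀ E V X c D b → E + V + X + (c + D + b) ≡ (E + c) + (V + D) + (X + b)
        collect = solve-∀
        distribute : ∀ Y W c D b → 4 * (Y + b) + W + (c + D) ≡ W + 4 * Y + (c + D + 4 * b)
        distribute = solve-∀
        exponent : (4 * e ∸ c) + (W ∸ D j) + (c + D j ∸ 4 * β j) ≡ W + 4 * (e ∸ β j)
        exponent = +-cancelʳ-≡ (c + D j + 4 * β j) _ _ (begin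
          (4 * e ∸ c) + (W ∸ D j) + (c + D j ∸ 4 * β j) + (c + D j + 4 * β j)
            ≡⟨ collect (4 * e ∸ c) _ _ c (D j) (4 * β j) ⟩
          (4 * e ∸ c + c) + (W ∸ D j + D j) + (c + D j ∸ 4 * β j + 4 * β j)
            ≡⟨ cong₂ _+_ (cong₂ _+_ (trans (m∸n+n≡m c≤4e) (cong (4 *_) (sym (m∸n+n≡m (β≤e j))))) (m∸n+n≡m (D≤W j)))
                         (m∸n+n≡m (m≤n+∣m-n∣ (4 * β j) c)) ⟩
          4 * (e ∸ β j + β j) + W + (c + D j)
            ≡⟨ distribute (e ∸ β j) W c (D j) (β j) ⟩
          W + 4 * (e ∸ β j) + (c + D j + 4 * β j) ∎)

    B-mod : ∀ s ρ j → B s ρ j ≈ B 0 ρ j mod ℤ.+ s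
    B-mod s (root i) j = *-mod (refl-mod (δ (β j mod t) i)) (power-mod s (D j ∸ D (p i)))
    B-mod s (var l)  j = *-mod (power-mod s (4 * β j + D j ∸ c)) (refl-mod (ℤ.+ (2 ^ (w l * (F + β j)))))
    B-mod s (inv l)  j = *-mod (power-mod s (c + D j ∸ 4 * β j)) (refl-mod (ℤ.+ (2 ^ (w l * (e ∸ β j)))))

    -- The determinant of `B s` vanishes, since the extracted powers are nonzero, and it is
    -- congruent to that of `B 0` modulo `s`. Taking `s` larger than the absolute value of the
    -- latter makes it 0.
    det-B0 : (∀ s → 2 ≤ s → det (λ i j → scaled s (row i) j) ≡ 0ℤ) → det (λ i j → B 0 (row i) j) ≡ 0ℤ
    det-B0 h = ∣small⇒≡0 (m<n⇒m<1+n (n<1+n _)) (subst (λ x → b₀ ≈ x mod ℤ.+ s) bₛ≡0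
      (sym-mod (det-mod (λ i j → B s (row i) j) (λ i j → B 0 (row i) j) λ i → B-mod s (row i))))
      where
      b₀ = det (λ i j → B 0 (row i) j)
      s = 2 + ℤ.∣ b₀ ∣
      bₛ = det (λ i j → B s (row i) j)
      u v : Vector ℤ N
      u i = ℤ.+ (s ^ rowExponent (row i))
      v j = ℤ.+ (s ^ (W ∸ D j))
      power≢0 : ∀ k → ℤ.+ (s ^ k) ≢ 0ℤ
      power≢0 k e = ≢-nonZero⁻¹ (s ^ k) {{m^n≢0 s k}} (ℤ.+-injective e)
      bₛ≡0 : bₛ ≡ 0ℤ
      bₛ≡0 with ℤ.i*j≡0⇒i≡0∨j≡0 (∏ u ℤ.* ∏ v) (trans (sym (det-scale u v _)) (h s (s≤s (s≤s z≤n))))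
      ... | inj₁ ∏≡0 = contradiction ∏≡0 (*-≢0 (∏≢0 u λ i → power≢0 (rowExponent (row i))) (∏≢0 v λ j → power≢0 (W ∸ D j)))
      ... | inj₂ e   = e

    kernel-B0 : (∀ s → 2 ≤ s → det (λ i j → scaled s (row i) j) ≡ 0ℤ) →
                ∃ λ κ → (∃ λ j → κ j ≢ 0ℤ) × (∀ ρ → ∑ (λ j → B 0 ρ j ℤ.* κ j) ≡ 0ℤ)
    kernel-B0 h with kernel (λ i j → B 0 (row i) j) (det-B0 h)
    ... | κ , κ≢0 , Bκ≡0 = κ , κ≢0 , λ ρ →
      trans (∑-cong λ j → cong (λ σ → B 0 σ j ℤ.* κ j) (sym (row-index ρ))) (Bκ≡0 (index ρ))

module ConstantTermKernel (t r : ℕ) .{{_ : ℕ.NonZero t}}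
  (β : Fin (t ℕ.+ r ℕ.* 2) → ℕ) where
  import Data.Integer.Properties as ℤ
  open ConstantTerm t r β
  open RowIndex t r
  open Summation (CommutativeRing.semiring ℤ.+-*-commutativeRing)
  open import Data.Integer.Base as ℤ using (ℤ; 0ℤ)
  open import Data.Nat.Base
  open import Data.Nat.DivMod using (_mod_)
  open import Data.Product.Base using (∃; _×_)
  open import Relation.Binary.PropositionalEquality.Core

  -- What the combinatorial argument takes from the Schur function, with the field eliminated. The
  -- threshold `c`, the exponents `w` and the shift `F` stay free because they are instantiated in
  -- three ways.
  ConstantTermsSingular : Set
  ConstantTermsSingular =
    ∀ c e F (β≤e : ∀ j → β j ≤ e) (c≤4e : c ≤ 4 * e) (w : Fin r → ℕ) →
    (∀ k l → w k ≡ w l → k ≡ l) → (p : Fin t → Fin (t + r * 2)) →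
    (∀ j → ∣ 4 * β (p (β j mod t)) - c ∣ ≤ ∣ 4 * β j - c ∣) →
    ∃ λ (κ : Fin (t + r * 2) → ℤ) → (∃ λ j → κ j ≢ 0ℤ) × (∀ ρ → ∑ (λ j → B c e F β≤e c≤4e w p 0 ρ j ℤ.* κ j) ≡ 0ℤ)

-- From a vanishing Schur function to singular constant terms.

module VanishingSchur {c ℓ₁ ℓ₂} (K : HeytingField c ℓ₁ ℓ₂) where
  open import Defs
  open Powers
  open Specialization K hiding (β)
  import Data.Integer.Properties as ℤ
  open CommutativeRing R using (trans; sym)
  open Determinant R
  open IntegerImage R using (ι; ι-*; ι-cong)
  open import Data.Integer.Base as ℤ using (ℤ)
  open import Data.Nat.Base hiding (ℕ)
  open import Data.Nat.Properties
    using (≤-trans; m≤m*n; *-cancelˡ-≡; m^n≢0)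
  open import Data.Vec.Functional using (Vector)
  open import Function.Base using (_∘_)
  open import Relation.Binary.PropositionalEquality as ≡ using (_≡_; _≢_)

  constantTermsSingular :
    Schur.CharacteristicZero K → (t r : ℕ) .{{_ : NonZero t}} →
    ∀ ζ → Schur.IsPrimitiveRoot K t ζ → (lam : Vector ℕ (t + r * 2)) →
    Schur.VanishesIdentically K t r ζ lam →
    ConstantTermKernel.ConstantTermsSingular t r (shifted lam)
  constantTermsSingular char0 t r ζ prim lam vanishes c e F β≤e c≤4e w w-inj p near =
    kernel-B0 c e F β≤e c≤4e w p λ s s≥2 →
      integer-det-zero char0 t r ζ prim (M′ s) (M≥2 s s≥2) (M-inj s s≥2) lam vanishes
        (λ i j → scaled′ s (row i) j) (λ i → scaled-span s s≥2 (row i))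
    where
    open ConstantTerm t r (shifted lam)
    open RowIndex t r
    scaled′ = scaled c e F β≤e c≤4e w p
    M′ = M c e F β≤e c≤4e w p
    M≥2 : ∀ s → 2 ≤ s → ∀ l → 2 ≤ M′ s l
    M≥2 s s≥2 l = ≤-trans (≤-trans s≥2 (m≤m*n s (s ^ 3) {{m^n≢0 s 3 {{>-nonZero s≥2′}}}}))
                          (m≤m*n (s ^ 4) (2 ^ w l) {{m^n≢0 2 (w l)}})
      where
      s≥2′ : 0 < s
      s≥2′ = ≤-trans (s≤s z≤n) s≥2
    M-inj : ∀ s → 2 ≤ s → ∀ k l → k ≢ l → M′ s k ≢ M′ s l
    M-inj s s≥2 k l k≢l e = k≢l (w-inj k l (2^-injective
      (*-cancelˡ-≡ _ _ (s ^ 4) {{m^n≢0 s 4 {{>-nonZero (≤-trans (s≤s z≤n) s≥2)}}}} e)))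
    scaled-span : ∀ s (s≥2 : 2 ≤ s) ρ →
                  Span (A char0 t r ζ prim (M′ s) (M≥2 s s≥2) (M-inj s s≥2) lam) (ι ∘ scaled′ s ρ)
    scaled-span s s≥2 (root i) = span-resp
      (λ j → trans (sym (ι-* (ℤ.+ (s ^ W c e F β≤e c≤4e w p)) _)) (ι-cong (≡.sym (scaled-root c e F β≤e c≤4e w p near s i j))))
      (span-scale _ (class-span char0 t r ζ prim (M′ s) (M≥2 s s≥2) (M-inj s s≥2) lam i))
    scaled-span s s≥2 (var l) = span-resp
      (λ j → trans (sym (ι-* (ℤ.+ (s ^ W c e F β≤e c≤4e w p * 2 ^ (w l * F))) _)) (ι-cong (≡.sym (scaled-var c e F β≤e c≤4e w p near s l j))))
      (span-scale _ (var-span char0 t r ζ prim (M′ s) (M≥2 s s≥2) (M-inj s s≥2) lam l))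
    scaled-span s s≥2 (inv l) = span-resp
      (λ j → trans (sym (ι-* (ℤ.+ (s ^ W c e F β≤e c≤4e w p)) _)) (ι-cong (≡.sym (scaled-inv c e F β≤e c≤4e w p near s l j))))
      (span-scale _ (inv-span char0 t r ζ prim (M′ s) (M≥2 s s≥2) (M-inj s s≥2) lam l e β≤e))

-- Integer weights with vanishing moments.

module Moments where
  import Data.Integer.Properties as ℤ
  open Summation (CommutativeRing.semiring ℤ.+-*-commutativeRing)
  open IntegerKernel using (*-≢0)
  open import Data.Integer.Base hiding (suc; _<_; _≤_)
  open import Data.Integer.Tactic.RingSolver using (solve-∀)
  open import Data.List.Base using (List; []; _∷_; length; foldr; filter)
  open import Data.List.Membership.Propositional using (_∈_; lose)
  open import Data.List.Membership.Propositional.Properties using (∈-filter⁺; ∈-filter⁻)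
  open import Data.List.Properties using (filter-notAll)
  open import Data.List.Relation.Unary.Any using (here; there)
  open import Data.Nat.Base using (suc; _<_; _≤_)
  import Data.Nat.Base as ℕ
  import Data.Nat.Properties as ℕ
  open import Data.Product.Base using (proj₂)
  open import Data.Vec.Functional using (Vector)
  open import Function.Base using (_∘_)
  open import Relation.Binary.PropositionalEquality
  open import Relation.Nullary.Decidable.Core using (yes; no; ¬?)
  open import Relation.Nullary.Negation.Core using (¬_; contradiction)

  ∏[_-_] : ℤ → List ℤ → ℤ
  ∏[ x - bs ] = foldr (λ b y → (x - b) * y) 1ℤ bs

  Σ[_] : List ℤ → ℤ
  Σ[_] = foldr _+_ 0ℤ

  ∏≡0 : ∀ {x bs} → x ∈ bs → ∏[ x - bs ] ≡ 0ℤ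
  ∏≡0 {x} {b ∷ bs} (here refl) = trans (cong (_* ∏[ x - bs ]) (ℤ.+-inverseʳ x)) (ℤ.*-zeroˡ ∏[ x - bs ])
  ∏≡0 {x} {b ∷ bs} (there x∈bs) = trans (cong ((x - b) *_) (∏≡0 x∈bs)) (ℤ.*-zeroʳ (x - b))

  ∏≢0 : ∀ {x bs} → ¬ x ∈ bs → ∏[ x - bs ] ≢ 0ℤ
  ∏≢0 {x} {[]}     x∉bs ()
  ∏≢0 {x} {b ∷ bs} x∉bs = *-≢0 (λ e → x∉bs (here (ℤ.i-j≡0⇒i≡j x b e))) (∏≢0 (x∉bs ∘ there))

  module _ {n : ℕ} (a μ : Vector ℤ n) where

    Moment≡0 : ℕ → Set
    Moment≡0 i = ∑ (λ j → μ j * a j ^ i) ≡ 0ℤ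

    -- The polynomial x^i ∏ (x - b) has degree below `k`. The free power `i` absorbs the x of each
    -- factor that is split off.
    moments-∏ : ∀ k → (∀ i → i < k → Moment≡0 i) → ∀ bs i → i ℕ.+ length bs < k →
                ∑ (λ j → μ j * (a j ^ i * ∏[ a j - bs ])) ≡ 0ℤ
    moments-∏ k M≡0 []       i i+0<k =
      trans (∑-cong λ j → cong (μ j *_) (ℤ.*-identityʳ (a j ^ i)))
            (M≡0 i (subst (_< k) (ℕ.+-identityʳ i) i+0<k))
    moments-∏ k M≡0 (b ∷ bs) i i+1+|bs|<k = begin
      ∑ (λ j → μ j * (a j ^ i * ((a j - b) * ∏[ a j - bs ])))
        ≡⟨ ∑-cong (λ j → expand (μ j) (a j) (a j ^ i) b ∏[ a j - bs ]) ⟩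
      ∑ (λ j → 1ℤ * (μ j * (a j ^ suc i * ∏[ a j - bs ])) + - b * (μ j * (a j ^ i * ∏[ a j - bs ])))
        ≡⟨ ∑-linear 1ℤ (- b) _ _ ⟩
      1ℤ * ∑ (λ j → μ j * (a j ^ suc i * ∏[ a j - bs ])) + - b * ∑ (λ j → μ j * (a j ^ i * ∏[ a j - bs ]))
        ≡⟨ cong₂ (λ x y → 1ℤ * x + - b * y) (moments-∏ k M≡0 bs (suc i) <k) (moments-∏ k M≡0 bs i (ℕ.<-trans (ℕ.n<1+n _) <k)) ⟩
      1ℤ * 0ℤ + - b * 0ℤ
        ≡⟨ cong (λ x → 1ℤ * 0ℤ + x) (ℤ.*-zeroʳ (- b)) ⟩
      0ℤ ∎
      where
      open ≡-Reasoning
      <k : suc (i ℕ.+ length bs) < k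
      <k = subst (_< k) (ℕ.+-suc i (length bs)) i+1+|bs|<k
      expand : ∀ m x p b y → m * (p * ((x - b) * y)) ≡ 1ℤ * (m * (x * p * y)) + - b * (m * (p * y))
      expand = solve-∀

    -- ∏ (x - b) (x + ∑ b) has no term in x ^ length bs.
    moments-gap : ∀ k → (∀ i → i < k → Moment≡0 i) → Moment≡0 (suc k) → ∀ bs i → i ℕ.+ length bs ≡ k →
                  ∑ (λ j → μ j * (a j ^ i * (∏[ a j - bs ] * (a j + Σ[ bs ])))) ≡ 0ℤ
    moments-gap k M≡0 M′≡0 []       i i+0≡k =
      trans (∑-cong λ j → tidy (μ j) (a j) (a j ^ i))
            (subst Moment≡0 (cong suc (trans (sym i+0≡k) (ℕ.+-identityʳ i))) M′≡0)
      where
      tidy : ∀ m x p → m * (p * (1ℤ * (x + 0ℤ))) ≡ m * (x * p)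
      tidy = solve-∀
    moments-gap k M≡0 M′≡0 (b ∷ bs) i i+1+|bs|≡k = begin
      ∑ (λ j → μ j * (a j ^ i * ((a j - b) * ∏[ a j - bs ] * (a j + (b + Σ[ bs ])))))
        ≡⟨ ∑-cong (λ j → expand (μ j) (a j) (a j ^ i) b ∏[ a j - bs ] Σ[ bs ]) ⟩
      ∑ (λ j → 1ℤ * (μ j * (a j ^ suc i * (∏[ a j - bs ] * (a j + Σ[ bs ])))) +
               - (b * (b + Σ[ bs ])) * (μ j * (a j ^ i * ∏[ a j - bs ])))
        ≡⟨ ∑-linear 1ℤ (- (b * (b + Σ[ bs ]))) _ _ ⟩
      1ℤ * ∑ (λ j → μ j * (a j ^ suc i * (∏[ a j - bs ] * (a j + Σ[ bs ])))) +
      - (b * (b + Σ[ bs ])) * ∑ (λ j → μ j * (a j ^ i * ∏[ a j - bs ]))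
        ≡⟨ cong₂ (λ x y → 1ℤ * x + - (b * (b + Σ[ bs ])) * y) (moments-gap k M≡0 M′≡0 bs (suc i) ≡k)
             (moments-∏ k M≡0 bs i (ℕ.≤-reflexive ≡k)) ⟩
      1ℤ * 0ℤ + - (b * (b + Σ[ bs ])) * 0ℤ
        ≡⟨ cong (λ x → 1ℤ * 0ℤ + x) (ℤ.*-zeroʳ (- (b * (b + Σ[ bs ])))) ⟩
      0ℤ ∎
      where
      open ≡-Reasoning
      ≡k : suc (i ℕ.+ length bs) ≡ k
      ≡k = trans (sym (ℕ.+-suc i (length bs))) i+1+|bs|≡k
      expand : ∀ m x p b y s → m * (p * ((x - b) * y * (x + (b + s)))) ≡
               1ℤ * (m * (x * p * (y * (x + s)))) + - (b * (b + s)) * (m * (p * y))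
      expand = solve-∀

    -- Testing against the product over the points of `xs` other than `a j` isolates the term of
    -- `j`; the removal of that point brings the degree below `k`.
    moments-support : ∀ k → (∀ i → i < k → Moment≡0 i) → (∀ i j → a i ≡ a j → i ≡ j) →
                      ∀ xs → length xs ≤ k → (∀ j → μ j ≢ 0ℤ → a j ∈ xs) → ∀ j → μ j ≡ 0ℤ
    moments-support k M≡0 a-inj xs |xs|≤k supp j with μ j ℤ.≟ 0ℤ
    ... | yes μj≡0 = μj≡0
    ... | no μj≢0  = contradiction (begin
      μ j * (1ℤ * ∏[ a j - bs ])
        ≡⟨ ∑-single j others ⟨
      ∑ (λ i → μ i * (1ℤ * ∏[ a i - bs ]))
        ≡⟨ moments-∏ k M≡0 bs 0 (ℕ.<-≤-trans (filter-notAll ≢aj? xs (lose (supp j μj≢0) λ ≢ → ≢ refl)) |xs|≤k) ⟩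
      0ℤ ∎)
      (*-≢0 μj≢0 (*-≢0 {1ℤ} (λ ()) (∏≢0 λ aj∈bs → proj₂ (∈-filter⁻ ≢aj? {xs = xs} aj∈bs) refl)))
      where
      open ≡-Reasoning
      ≢aj? = λ b → ¬? (b ℤ.≟ a j)
      bs = filter ≢aj? xs
      others : ∀ i → i ≢ j → μ i * (1ℤ * ∏[ a i - bs ]) ≡ 0ℤ
      others i i≢j with μ i ℤ.≟ 0ℤ
      ... | yes μi≡0 = trans (cong (_* (1ℤ * ∏[ a i - bs ])) μi≡0) (ℤ.*-zeroˡ (1ℤ * ∏[ a i - bs ]))
      ... | no μi≢0  = trans (cong (λ y → μ i * (1ℤ * y))
        (∏≡0 (∈-filter⁺ ≢aj? (supp i μi≢0) λ ai≡aj → i≢j (a-inj i j ai≡aj)))) (ℤ.*-zeroʳ (μ i))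

-- Lists without repetition, binary expansions, and two auxiliary facts.

module UniqueLists where
  open import Data.List.Base hiding (sum)
  open import Data.List.Membership.Propositional using (_∈_)
  open import Data.List.Membership.Propositional.Properties using (∈-filter⁺; ∈-filter⁻)
  open import Data.List.Membership.DecPropositional using () renaming (_∈?_ to dec∈)
  open import Data.List.Properties using (filter-accept; filter-reject; filter-all)
  open import Data.List.Relation.Unary.All as All using (All; []; _∷_)
  open import Data.List.Relation.Unary.AllPairs using ([]; _∷_)
  open import Data.List.Relation.Unary.Any using (here; there)
  open import Data.List.Relation.Unary.Unique.Propositional using (Unique)
  import Data.List.Relation.Unary.Unique.Propositional.Properties as Unique
  open import Data.Nat.Base
  open import Data.Nat.ListAction using (sum)
  open import Data.Nat.Properties
  open import Data.Product.Base using (proj₁; proj₂)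
  open import Function.Base using (_∘_)
  open import Relation.Binary.PropositionalEquality
  open import Relation.Nullary.Decidable.Core using (yes; no; ¬?)
  open import Relation.Nullary.Negation.Core using (¬_; contradiction)

  unique-map : ∀ {a b} {A : Set a} {B : Set b} {f : A → B} {xs} →
               (∀ {x y} → x ∈ xs → y ∈ xs → f x ≡ f y → x ≡ y) → Unique xs → Unique (map f xs)
  unique-map {xs = []}     inj []         = []
  unique-map {f = f} {x ∷ xs} inj (x∉ ∷ uniq) =
    fresh xs there x∉ ∷ unique-map (λ p q → inj (there p) (there q)) uniq
    where
    fresh : ∀ ys → (∀ {y} → y ∈ ys → y ∈ x ∷ xs) → All (x ≢_) ys → All (f x ≢_) (map f ys)
    fresh []       sub []         = []
    fresh (y ∷ ys) sub (x≢y ∷ ps) = (x≢y ∘ inj (here refl) (sub (here refl))) ∷ fresh ys (sub ∘ there) ps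

  _∖_ : List ℕ → ℕ → List ℕ
  xs ∖ b = filter (λ x → ¬? (x ≟ b)) xs

  sum-∖ : ∀ (f : ℕ → ℕ) {xs b} → Unique xs → b ∈ xs → sum (map f xs) ≡ f b + sum (map f (xs ∖ b))
  sum-∖ f {x ∷ xs} (x∉ ∷ uniq) (here refl) = cong (λ ys → f x + sum (map f ys))
    (sym (trans (filter-reject (λ y → ¬? (y ≟ x)) {x} {xs} (λ x≢x → x≢x refl))
                (filter-all (λ y → ¬? (y ≟ x)) (All.map (_∘ sym) x∉))))
  sum-∖ f {x ∷ xs} {b} (x∉ ∷ uniq) (there b∈xs) = begin
    f x + sum (map f xs)                   ≡⟨ cong (f x +_) (sum-∖ f uniq b∈xs) ⟩
    f x + (f b + sum (map f (xs ∖ b)))     ≡⟨ +-assoc (f x) (f b) _ ⟨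
    f x + f b + sum (map f (xs ∖ b))       ≡⟨ cong (_+ sum (map f (xs ∖ b))) (+-comm (f x) (f b)) ⟩
    f b + f x + sum (map f (xs ∖ b))       ≡⟨ +-assoc (f b) (f x) _ ⟩
    f b + sum (map f (x ∷ (xs ∖ b)))       ≡⟨ cong (λ ys → f b + sum (map f ys)) (filter-accept (λ y → ¬? (y ≟ b)) (All.lookup x∉ b∈xs)) ⟨
    f b + sum (map f ((x ∷ xs) ∖ b))       ∎
    where open ≡-Reasoning

  ∈-∖⁺ : ∀ {xs b x} → x ∈ xs → x ≢ b → x ∈ xs ∖ b
  ∈-∖⁺ = ∈-filter⁺ (λ x → ¬? (x ≟ _))

  ∈-∖⁻ : ∀ {xs b x} → x ∈ xs ∖ b → x ∈ xs
  ∈-∖⁻ {xs} x∈ = proj₁ (∈-filter⁻ (λ x → ¬? (x ≟ _)) {xs = xs} x∈)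

  ∖-unique : ∀ {xs} b → Unique xs → Unique (xs ∖ b)
  ∖-unique b = Unique.filter⁺ (λ x → ¬? (x ≟ b))

  private
    Below : ℕ → List ℕ → Set
    Below b xs = ∀ {x} → x ∈ xs → x < b

    ∖-below : ∀ {b xs} → Below (suc b) xs → Below b (xs ∖ b)
    ∖-below {b} {xs} h x∈ =
      ≤∧≢⇒< (s≤s⁻¹ (h (∈-∖⁻ x∈))) (proj₂ (∈-filter⁻ (λ x → ¬? (x ≟ b)) {xs = xs} x∈))

    ∉-below : ∀ {b xs} → Below (suc b) xs → ¬ b ∈ xs → Below b xs
    ∉-below h b∉ x∈ = ≤∧≢⇒< (s≤s⁻¹ (h x∈)) λ { refl → b∉ x∈ }

  binary : List ℕ → ℕ
  binary xs = sum (map (2 ^_) xs)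

  binary-< : ∀ b {xs} → Unique xs → (∀ {x} → x ∈ xs → x < b) → binary xs < 2 ^ b
  binary-< zero {[]}     uniq below = z<s
  binary-< zero {x ∷ xs} uniq below = contradiction (below (here refl)) λ ()
  binary-< (suc b) {xs} uniq below with dec∈ _≟_ b xs
  ... | yes b∈ = subst₂ _<_ (sym (sum-∖ (2 ^_) uniq b∈)) (cong (2 ^ b +_) (sym (+-identityʳ (2 ^ b))))
                   (+-monoʳ-< (2 ^ b) (binary-< b (∖-unique b uniq) (∖-below below)))
  ... | no b∉  = <-≤-trans (binary-< b uniq (∉-below below b∉)) (m≤m+n (2 ^ b) _)

  -- The bits below `b` add up to less than 2 ^ b, so the sum decides whether the top bit is
  -- present. A common top bit is removed from both lists before descending.
  binary-injective : ∀ b {xs ys} → Unique xs → Unique ys → (∀ {x} → x ∈ xs → x < b) →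
    (∀ {x} → x ∈ ys → x < b) → binary xs ≡ binary ys → ∀ {x} → x ∈ xs → x ∈ ys
  binary-injective zero ux uy bx by eq x∈xs = contradiction (bx x∈xs) λ ()
  binary-injective (suc b) {xs} {ys} ux uy bx by eq {x} x∈xs with dec∈ _≟_ b xs | dec∈ _≟_ b ys
  ... | yes b∈xs | no b∉ys = contradiction (binary-< b uy (∉-below by b∉ys))
    (≤⇒≯ (≤-trans (m≤m+n (2 ^ b) _) (≤-reflexive (trans (sym (sum-∖ (2 ^_) ux b∈xs)) eq))))
  ... | no b∉xs | yes b∈ys = contradiction (binary-< b ux (∉-below bx b∉xs))
    (≤⇒≯ (≤-trans (m≤m+n (2 ^ b) _) (≤-reflexive (trans (sym (sum-∖ (2 ^_) uy b∈ys)) (sym eq)))))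
  ... | no b∉xs | no b∉ys =
    binary-injective b ux uy (∉-below bx b∉xs) (∉-below by b∉ys) eq x∈xs
  ... | yes b∈xs | yes b∈ys with x ≟ b
  ...   | yes refl = b∈ys
  ...   | no x≢b   = ∈-∖⁻ (binary-injective b (∖-unique b ux) (∖-unique b uy) (∖-below bx) (∖-below by)
    (+-cancelˡ-≡ (2 ^ b) _ _ (trans (sym (sum-∖ (2 ^_) ux b∈xs)) (trans eq (sum-∖ (2 ^_) uy b∈ys))))
    (∈-∖⁺ x∈xs x≢b))

module FiniteMinimum {n : ℕ} where
  open import Data.Fin.Properties using (any?)
  open import Data.Nat.Base using (_<_; _≤_)
  open import Data.Nat.Induction using (<-wellFounded; Acc; acc)
  open import Data.Nat.Properties using (_<?_; ≮⇒≥)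
  open import Data.Product.Base using (∃; _×_; _,_)
  open import Relation.Nullary.Decidable.Core using (yes; no; _×-dec_)
  open import Relation.Unary using (Decidable)

  private
    search : ∀ {p} (f : Fin n → ℕ) {P : Fin n → Set p} → Decidable P → ∀ j → P j → Acc _<_ (f j) →
             ∃ λ k → P k × (∀ l → P l → f k ≤ f l)
    search f P? j Pj (acc rs) with any? (λ l → P? l ×-dec f l <? f j)
    ... | yes (l , Pl , fl<fj) = search f P? l Pl (rs fl<fj)
    ... | no ∄l = j , Pj , λ l Pl → ≮⇒≥ λ fl<fj → ∄l (l , Pl , fl<fj)

  minimizer : ∀ {p} (f : Fin n → ℕ) {P : Fin n → Set p} → Decidable P → ∀ j → P j →
              ∃ λ k → P k × (∀ l → P l → f k ≤ f l)
  minimizer f P? j Pj = search f P? j Pj (<-wellFounded (f j))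

module CrossProducts where
  import Data.Integer.Properties as ℤ
  open import Data.Integer.Base
  open import Data.Integer.Tactic.RingSolver using (solve-∀)
  open import Data.Sum.Base using (inj₁; inj₂)
  open import Relation.Binary.PropositionalEquality
  open import Relation.Nullary.Negation.Core using (contradiction)
  open IntegerKernel using (*-≢0)

  private
    interchange : ∀ a b c d → a * b * (c * d) ≡ a * c * (b * d)
    interchange = solve-∀

    expand : ∀ x y p q → (x - y) * (q - p) ≡ (x + p) * (y + q) - (y + p) * (x + q)
    expand = solve-∀

  -- Dividing the second relation by the first leaves (x + p)(y + q) = (y + p)(x + q), that is, (x -
  -- y)(q - p) = 0.
  shifts-equal : ∀ {a₁ a₂ b₁ b₂ x y p q} → a₁ ≢ 0ℤ → b₂ ≢ 0ℤ → x ≢ y → a₁ * b₂ ≡ a₂ * b₁ →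
    (a₁ * (x + p)) * (b₂ * (y + q)) ≡ (a₂ * (y + p)) * (b₁ * (x + q)) → p ≡ q
  shifts-equal {a₁} {a₂} {b₁} {b₂} {x} {y} {p} {q} a₁≢0 b₂≢0 x≢y e₁ e₂
    with ℤ.i*j≡0⇒i≡0∨j≡0 (x - y) {q - p} (trans (expand x y p q) (ℤ.i≡j⇒i-j≡0 {(x + p) * (y + q)} cancelled))
    where
    cancelled : (x + p) * (y + q) ≡ (y + p) * (x + q)
    cancelled = ℤ.*-cancelˡ-≡ (a₁ * b₂) _ _ {{≢-nonZero (*-≢0 a₁≢0 b₂≢0)}} (begin
      a₁ * b₂ * ((x + p) * (y + q))     ≡⟨ interchange a₁ (x + p) b₂ (y + q) ⟨
      a₁ * (x + p) * (b₂ * (y + q))     ≡⟨ e₂ ⟩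
      a₂ * (y + p) * (b₁ * (x + q))     ≡⟨ interchange a₂ (y + p) b₁ (x + q) ⟩
      a₂ * b₁ * ((y + p) * (x + q))     ≡⟨ cong (_* ((y + p) * (x + q))) e₁ ⟨
      a₁ * b₂ * ((y + p) * (x + q))     ∎)
      where open ≡-Reasoning
  ... | inj₁ x-y≡0 = contradiction (ℤ.i-j≡0⇒i≡j x y x-y≡0) x≢y
  ... | inj₂ q-p≡0 = sym (ℤ.i-j≡0⇒i≡j q p q-p≡0)

open import Data.List.Base using (List)
open import Data.List.Membership.Propositional using (_∈_)
open import Data.Nat.DivMod using (_mod_)
open import Data.Product.Base using (∃; ∃₂; _×_; _,_)
open import Data.Sum.Base using (_⊎_)
open import Relation.Binary.PropositionalEquality.Core using (_≡_)

-- Distances to a threshold, and ties.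

module Distance where
  open import Data.Nat.Base
  open import Data.Nat.Properties
  open import Relation.Binary.PropositionalEquality

  -- In this case and the next, `m` lies between `c` and `n`. In the last two `n` lies across `c`,
  -- and the comparison of `m + n` with 2c decides.
  ∣-∣-far₁ : ∀ {m n c} → c ≤ m → m < n → ∣ m - c ∣ < ∣ n - c ∣
  ∣-∣-far₁ c≤m m<n = subst₂ _<_ (sym (m≤n⇒∣n-m∣≡n∸m c≤m)) (sym (m≤n⇒∣n-m∣≡n∸m (≤-trans c≤m (<⇒≤ m<n))))
    (∸-monoˡ-< m<n c≤m)

  ∣-∣-far₂ : ∀ {m n c} → m ≤ c → n < m → ∣ m - c ∣ < ∣ n - c ∣
  ∣-∣-far₂ m≤c n<m = subst₂ _<_ (sym (m≤n⇒∣m-n∣≡n∸m m≤c)) (sym (m≤n⇒∣m-n∣≡n∸m (≤-trans (<⇒≤ n<m) m≤c)))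
    (∸-monoʳ-< n<m m≤c)

  ∣-∣-far₃ : ∀ {m n c} → c ≤ m → m + n < c + c → ∣ m - c ∣ < ∣ n - c ∣
  ∣-∣-far₃ {m} {n} {c} c≤m m+n<2c = subst₂ _<_ (sym (m≤n⇒∣n-m∣≡n∸m c≤m)) (sym (m≤n⇒∣m-n∣≡n∸m n≤c))
    (m+n≤o⇒m≤o∸n (suc (m ∸ c)) (+-cancelˡ-< c _ _ (subst (_< c + c)
      (trans (cong (_+ n) (sym (m+[n∸m]≡n c≤m))) (+-assoc c (m ∸ c) n)) m+n<2c)))
    where
    n≤c : n ≤ c
    n≤c = +-cancelˡ-≤ c _ _ (≤-trans (+-monoˡ-≤ n c≤m) (<⇒≤ m+n<2c))

  ∣-∣-far₄ : ∀ {m n c} → m ≤ c → c + c < m + n → ∣ m - c ∣ < ∣ n - c ∣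
  ∣-∣-far₄ {m} {n} {c} m≤c 2c<m+n = subst₂ _<_ (sym (m≤n⇒∣m-n∣≡n∸m m≤c)) (sym (m≤n⇒∣n-m∣≡n∸m c≤n))
    (+-cancelˡ-< m _ _ (subst (_< m + (n ∸ c)) (sym (m+[n∸m]≡n m≤c)) (+-cancelʳ-< c _ _
      (subst (c + c <_) (trans (cong (m +_) (sym (m∸n+n≡m c≤n))) (sym (+-assoc m (n ∸ c) c))) 2c<m+n))))
    where
    c≤n : c ≤ n
    c≤n = +-cancelˡ-≤ c _ _ (≤-trans (<⇒≤ 2c<m+n) (+-monoˡ-≤ n m≤c))

module TiePairs {N t : ℕ} (β : Fin N → ℕ) (res : Fin N → Fin t) (𝒫 : List (ℕ × ℕ)) where
  open import Data.List.Base using (length)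
  open import Data.List.Relation.Unary.Unique.Propositional using (Unique)
  open import Data.Nat.Base hiding (ℕ)
  open import Relation.Binary.PropositionalEquality.Core
  open import Relation.Nullary.Negation.Core using (¬_)

  -- 𝒫 lists the pairs of consecutive values of the classes of res; a tie is such a
  -- pair with sum s.
  record Tie (s : ℕ) : Set where
    field
      j k   : Fin N
      j+k≡s : β j + β k ≡ s
      k<j   : β k < β j
      mate  : res j ≡ res k
      j∈    : (β j , β k) ∈ 𝒫
      gap   : ∀ l → res l ≡ res j → β j ≤ β l ⊎ β l ≤ β k
  open Tie

  -- A pair with sum above `s` is recorded by its larger element and one with sum below `s` by its
  -- smaller element. Besides the ends of the two ties, only these can support a kernel vector at
  -- the threshold s/2.
  record Configuration (s m : ℕ) : Set where
    field
      tie₁ tie₂ : Tie s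
      distinct  : res (j tie₁) ≢ res (j tie₂)
      us ls     : List ℕ
      us-unique : Unique us
      ls-unique : Unique ls
      |us|      : length us ≡ m
      |ls|      : length ls ≡ m
      us-sound  : ∀ {x} → x ∈ us → ∃ λ y → (x , y) ∈ 𝒫 × s < x + y
      ls-sound  : ∀ {y} → y ∈ ls → ∃ λ x → (x , y) ∈ 𝒫 × x + y < s
      us⊆β      : ∀ {x} → x ∈ us → ∃ λ l → x ≡ β l
      j∉us      : (T : Tie s) → ¬ β (j T) ∈ us
      k∉ls      : (T : Tie s) → ¬ β (k T) ∈ ls
      cover⁺    : ∀ {x y} → (x , y) ∈ 𝒫 → s < x + y → x ∈ us
      cover⁻    : ∀ {x y} → (x , y) ∈ 𝒫 → x + y < s → y ∈ ls
      cover⁼    : ∀ {x y} → (x , y) ∈ 𝒫 → x + y ≡ s →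
                  (x ≡ β (j tie₁) × y ≡ β (k tie₁)) ⊎ (x ≡ β (j tie₂) × y ≡ β (k tie₂))

-- Supports of kernel vectors, and the reflection of the two sides.

module PairKernel (t r : ℕ) .{{_ : ℕ.NonZero t}}
  (β : Fin (t ℕ.+ r ℕ.* 2) → ℕ)
  (β-injective : ∀ {j k} → β j ≡ β k → j ≡ k)
  (inhabited : ∀ i → ∃ λ j → β j mod t ≡ i)
  (singular : ConstantTermKernel.ConstantTermsSingular t r β)
  (𝒫 : List (ℕ × ℕ))
  (lower : ∀ j k → β j mod t ≡ β k mod t → β k ℕ.< β j →
           ∃ λ y → (β j , y) ∈ 𝒫 × β k ℕ.≤ y)
  (upper : ∀ j k → β j mod t ≡ β k mod t → β k ℕ.< β j →
           ∃ λ x → (x , β k) ∈ 𝒫 × x ℕ.≤ β j)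
  where
  open Distance
  open RowIndex t r
  open ConstantTerm t r β using (B)
  import Data.Integer.Properties as ℤ
  open Determinant ℤ.+-*-commutativeRing using (δ; δ-≡; δ-≢)
  open Summation (CommutativeRing.semiring ℤ.+-*-commutativeRing)
  open FiniteMinimum using (minimizer)
  open CrossProducts using (shifts-equal)
  open Powers
  open Moments
  open import Data.Fin.Base using (toℕ; fromℕ<)
  open import Data.Fin.Properties using (toℕ-injective; toℕ-fromℕ<)
  import Data.Fin.Properties as Fin
  open import Data.Integer.Base as ℤ using (ℤ; 0ℤ; 1ℤ)
  import Data.List.Base as List
  open import Data.List.Membership.Propositional using (lose; find)
  open import Data.List.Membership.Propositional.Properties using (∈-map⁺; ∈-map⁻; ∈-++⁺ˡ; ∈-++⁺ʳ)
  open import Data.List.Relation.Unary.Unique.Propositional using (Unique)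
  open import Data.Nat.ListAction using (sum)
  import Data.List.Properties as List
  open import Data.List.Relation.Unary.Any as Any using (Any)
  open import Data.Nat.Base hiding (ℕ)
  open import Data.Nat.Properties
  open import Data.Integer.Tactic.RingSolver using () renaming (solve-∀ to ℤ-solve-∀)
  open import Data.Nat.Tactic.RingSolver using (solve-∀)
  open import Data.Product.Base using (proj₁; proj₂)
  open import Data.Sum.Base using (inj₁; inj₂)
  open import Function.Base using (_∘_)
  open import Relation.Binary.Definitions using (Tri; tri<; tri≈; tri>)
  open import Relation.Binary.PropositionalEquality
  open import Relation.Nullary.Decidable.Core using (Dec; yes; no; _×-dec_)
  open import Relation.Nullary.Negation.Core using (¬_; contradiction)

  private
    N = t + r * 2

  res : Fin N → Fin t
  res j = β j mod t

  open TiePairs β res 𝒫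

  D : ℕ → Fin N → ℕ
  D c j = ∣ 4 * β j - c ∣

  a⁺ a⁻ : ℕ → ℕ → ℤ
  a⁺ e u = ℤ.+ (2 ^ (e ∸ u))
  a⁻ F u = ℤ.+ (2 ^ (F + u))

  a⁻-injective : ∀ F {x y} → a⁻ F x ≡ a⁻ F y → x ≡ y
  a⁻-injective F eq = +-cancelˡ-≡ F _ _ (2^-injective (ℤ.+-injective eq))

  a⁺-injective : ∀ {e x y} → x ≤ e → y ≤ e → a⁺ e x ≡ a⁺ e y → x ≡ y
  a⁺-injective x≤e y≤e eq = ∸-cancelˡ-≡ x≤e y≤e (2^-injective (ℤ.+-injective eq))

  -- A vector in the kernel of B 0; μ⁺ and μ⁻ are its parts supported on 4 β ≥ c and 4 β ≤ c.
  record KernelVector (c e F : ℕ) (w : Fin r → ℕ) : Set where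
    field
      κ μ⁻ μ⁺   : Fin N → ℤ
      κ≢0       : ∃ λ j → κ j ≢ 0ℤ
      κ-nearest : ∀ j → (∀ l → res l ≡ res j → l ≢ j → D c j < D c l) → κ j ≡ 0ℤ
      κ-tie     : ∀ j k → j ≢ k → res j ≡ res k → D c j ≡ D c k →
                  (∀ l → res l ≡ res j → l ≢ j → l ≢ k → D c j < D c l) → κ j ℤ.+ κ k ≡ 0ℤ
      moment⁻   : ∀ l → Moment≡0 (a⁻ F ∘ β) μ⁻ (w l)
      moment⁺   : ∀ l → Moment≡0 (a⁺ e ∘ β) μ⁺ (w l)
      μ⁻≡κ      : ∀ j → 4 * β j ≤ c → μ⁻ j ≡ κ j
      μ⁺≡κ      : ∀ j → c ≤ 4 * β j → μ⁺ j ≡ κ j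
      μ⁻≢0      : ∀ j → μ⁻ j ≢ 0ℤ → 4 * β j ≤ c × κ j ≢ 0ℤ
      μ⁺≢0      : ∀ j → μ⁺ j ≢ 0ℤ → c ≤ 4 * β j × κ j ≢ 0ℤ

  module FromSingular (c e F : ℕ) (β≤e : ∀ j → β j ≤ e) (c≤4e : c ≤ 4 * e)
           (w : Fin r → ℕ) (w-inj : ∀ k l → w k ≡ w l → k ≡ l) where

    private
      nearest : ∀ i → ∃ λ k → res k ≡ i × (∀ l → res l ≡ i → D c k ≤ D c l)
      nearest i with inhabited i
      ... | j , rj≡i = minimizer (D c) (λ l → res l Fin.≟ i) j rj≡i

      p : Fin t → Fin N
      p i = proj₁ (nearest i)

      p-res : ∀ i → res (p i) ≡ i
      p-res i = proj₁ (proj₂ (nearest i))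

      p-min : ∀ i l → res l ≡ i → D c (p i) ≤ D c l
      p-min i = proj₂ (proj₂ (nearest i))

      solution = singular c e F β≤e c≤4e w w-inj p (λ j → p-min (res j) j refl)

    κ : Fin N → ℤ
    κ = proj₁ solution

    κ≢0 : ∃ λ j → κ j ≢ 0ℤ
    κ≢0 = proj₁ (proj₂ solution)

    private
      Bκ≡0 = proj₂ (proj₂ solution)

      0^>0 : ∀ {k} → 0 < k → 0 ^ k ≡ 0
      0^>0 {suc k} _ = refl

      far-term : ∀ {j l} → res j ≡ res l → D c j < D c l → B c e F β≤e c≤4e w p 0 (root (res j)) l ℤ.* κ l ≡ 0ℤ
      far-term {j} {l} rj≡rl Dj<Dl = trans (cong (λ x → δ (res l) (res j) ℤ.* ℤ.+ x ℤ.* κ l)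
        (0^>0 (m<n⇒0<n∸m (≤-<-trans (p-min (res j) j refl) Dj<Dl))))
        (cong (ℤ._* κ l) (ℤ.*-zeroʳ (δ (res l) (res j))))

      other-term : ∀ {i l} → res l ≢ i → B c e F β≤e c≤4e w p 0 (root i) l ℤ.* κ l ≡ 0ℤ
      other-term {i} {l} rl≢i = cong (λ x → x ℤ.* ℤ.+ (0 ^ (D c l ∸ D c (p i))) ℤ.* κ l) (δ-≢ (res l) i rl≢i)

      near-term : ∀ {i l} → res l ≡ i → D c l ≡ D c (p i) → B c e F β≤e c≤4e w p 0 (root i) l ℤ.* κ l ≡ κ l
      near-term {i} {l} refl Dl≡ = trans (cong₂ (λ x y → x ℤ.* ℤ.+ (0 ^ y) ℤ.* κ l) (δ-≡ (res l))
        (trans (cong (_∸ D c (p i)) Dl≡) (n∸n≡0 (D c (p i))))) (ℤ.*-identityˡ (κ l))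

    -- In the row of the class every farther element carries a positive power of 0, so this equation
    -- of the system reduces to the single unknown `κ j`.
    κ-nearest : ∀ j → (∀ l → res l ≡ res j → l ≢ j → D c j < D c l) → κ j ≡ 0ℤ
    κ-nearest j far = trans (sym (near-term refl Dj≡))
      (trans (sym (∑-single j λ l l≢j → term l l≢j (res l Fin.≟ res j))) (Bκ≡0 (root (res j))))
      where
      Dj≡ : D c j ≡ D c (p (res j))
      Dj≡ with p (res j) Fin.≟ j
      ... | yes p≡j = cong (D c) (sym p≡j)
      ... | no p≢j  = contradiction (p-min (res j) j refl) (<⇒≱ (far _ (p-res (res j)) p≢j))
      term : ∀ l → l ≢ j → Dec (res l ≡ res j) → _
      term l l≢j (yes rl≡rj) = far-term (sym rl≡rj) (far l rl≡rj l≢j)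
      term l l≢j (no rl≢rj)  = other-term rl≢rj

    κ-tie : ∀ j k → j ≢ k → res j ≡ res k → D c j ≡ D c k →
            (∀ l → res l ≡ res j → l ≢ j → l ≢ k → D c j < D c l) → κ j ℤ.+ κ k ≡ 0ℤ
    κ-tie j k j≢k rj≡rk Dj≡Dk far = trans (sym (cong₂ ℤ._+_ (near-term refl Dj≡) (near-term (sym rj≡rk) (trans (sym Dj≡Dk) Dj≡))))
      (trans (sym (∑-two j≢k λ l l≢j l≢k → term l l≢j l≢k (res l Fin.≟ res j))) (Bκ≡0 (root (res j))))
      where
      Dj≡ : D c j ≡ D c (p (res j))
      Dj≡ with p (res j) Fin.≟ j | p (res j) Fin.≟ k
      ... | yes p≡j | _       = cong (D c) (sym p≡j)
      ... | no _    | yes p≡k = trans Dj≡Dk (cong (D c) (sym p≡k))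
      ... | no p≢j  | no p≢k  = contradiction (p-min (res j) j refl) (<⇒≱ (far _ (p-res (res j)) p≢j p≢k))
      term : ∀ l → l ≢ j → l ≢ k → Dec (res l ≡ res j) → _
      term l l≢j l≢k (yes rl≡rj) = far-term (sym rl≡rj) (far l rl≡rj l≢j l≢k)
      term l l≢j l≢k (no rl≢rj)  = other-term rl≢rj

    μ⁻ μ⁺ : Fin N → ℤ
    μ⁻ j = ℤ.+ (0 ^ (4 * β j + D c j ∸ c)) ℤ.* κ j
    μ⁺ j = ℤ.+ (0 ^ (c + D c j ∸ 4 * β j)) ℤ.* κ j

    private
      pos-^ : ∀ m k → (ℤ.+ m) ℤ.^ k ≡ ℤ.+ (m ^ k)
      pos-^ m zero    = refl
      pos-^ m (suc k) = trans (cong (ℤ.+ m ℤ.*_) (pos-^ m k)) (sym (ℤ.pos-* m (m ^ k)))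

      power : ∀ k i → (ℤ.+ (2 ^ k)) ℤ.^ i ≡ ℤ.+ (2 ^ (i * k))
      power k i = trans (pos-^ (2 ^ k) i) (cong ℤ.+_ (trans (^-*-assoc 2 k i) (cong (2 ^_) (*-comm k i))))

      swap-* : ∀ x y z → x ℤ.* y ℤ.* z ≡ x ℤ.* z ℤ.* y
      swap-* x y z = trans (ℤ.*-assoc x y z) (trans (cong (x ℤ.*_) (ℤ.*-comm y z)) (sym (ℤ.*-assoc x z y)))

    moment⁻ : ∀ l → Moment≡0 (a⁻ F ∘ β) μ⁻ (w l)
    moment⁻ l = trans (∑-cong λ j → trans (cong (μ⁻ j ℤ.*_) (power (F + β j) (w l)))
      (swap-* (ℤ.+ (0 ^ (4 * β j + D c j ∸ c))) (κ j) _)) (Bκ≡0 (var l))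

    moment⁺ : ∀ l → Moment≡0 (a⁺ e ∘ β) μ⁺ (w l)
    moment⁺ l = trans (∑-cong λ j → trans (cong (μ⁺ j ℤ.*_) (power (e ∸ β j) (w l)))
      (swap-* (ℤ.+ (0 ^ (c + D c j ∸ 4 * β j))) (κ j) _)) (Bκ≡0 (inv l))

    private
      0^≡1 : ∀ {k} x → k ≡ 0 → ℤ.+ (0 ^ k) ℤ.* x ≡ x
      0^≡1 x refl = ℤ.*-identityˡ x

      0^≢0 : ∀ k {x} → ℤ.+ (0 ^ k) ℤ.* x ≢ 0ℤ → k ≡ 0 × x ≢ 0ℤ
      0^≢0 zero    h = refl , λ x≡0 → h (trans (cong (ℤ.+ 1 ℤ.*_) x≡0) (ℤ.*-zeroʳ (ℤ.+ 1)))
      0^≢0 (suc k) h = contradiction refl h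

    μ⁻≡κ : ∀ j → 4 * β j ≤ c → μ⁻ j ≡ κ j
    μ⁻≡κ j 4β≤c = 0^≡1 (κ j) (m≤n⇒m∸n≡0 (≤-reflexive
      (trans (cong (4 * β j +_) (m≤n⇒∣m-n∣≡n∸m 4β≤c)) (m+[n∸m]≡n 4β≤c))))

    μ⁺≡κ : ∀ j → c ≤ 4 * β j → μ⁺ j ≡ κ j
    μ⁺≡κ j c≤4β = 0^≡1 (κ j) (m≤n⇒m∸n≡0 (≤-reflexive
      (trans (cong (c +_) (m≤n⇒∣n-m∣≡n∸m c≤4β)) (m+[n∸m]≡n c≤4β))))

    μ⁻≢0 : ∀ j → μ⁻ j ≢ 0ℤ → 4 * β j ≤ c × κ j ≢ 0ℤ
    μ⁻≢0 j h = ≤-trans (m≤m+n _ (D c j)) (m∸n≡0⇒m≤n (proj₁ (0^≢0 (4 * β j + D c j ∸ c) h))) , proj₂ (0^≢0 (4 * β j + D c j ∸ c) h)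

    μ⁺≢0 : ∀ j → μ⁺ j ≢ 0ℤ → c ≤ 4 * β j × κ j ≢ 0ℤ
    μ⁺≢0 j h = ≤-trans (m≤m+n _ (D c j)) (m∸n≡0⇒m≤n (proj₁ (0^≢0 (c + D c j ∸ 4 * β j) h))) , proj₂ (0^≢0 (c + D c j ∸ 4 * β j) h)

    kernelVector : KernelVector c e F w
    kernelVector = record
      { κ = κ ; μ⁻ = μ⁻ ; μ⁺ = μ⁺ ; κ≢0 = κ≢0 ; κ-nearest = κ-nearest ; κ-tie = κ-tie
      ; moment⁻ = moment⁻ ; moment⁺ = moment⁺ ; μ⁻≡κ = μ⁻≡κ ; μ⁺≡κ = μ⁺≡κ ; μ⁻≢0 = μ⁻≢0 ; μ⁺≢0 = μ⁺≢0 }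

  private
    quadruple : ∀ m n → 2 * (m + n) + 2 * (m + n) ≡ 4 * m + 4 * n
    quadruple = solve-∀

  module Support {c e F : ℕ} {w : Fin r → ℕ} (v : KernelVector c e F w) (β≤e : ∀ j → β j ≤ e) where
    open KernelVector v

    -- Otherwise `j` would be the unique nearest element of its class: larger classmates are farther
    -- anyway, and smaller ones are farther when their sums with `β j` stay below c/2.
    support⁺ : ∀ j → κ j ≢ 0ℤ → c ≤ 4 * β j → ∃ λ y → (β j , y) ∈ 𝒫 × c ≤ 2 * (β j + y)
    support⁺ j κj≢0 c≤4β = decide (Any.any? (λ q → proj₁ q ≟ β j ×-dec c ≤? 2 * (β j + proj₂ q)) 𝒫)
      where
      Found : ℕ × ℕ → Set
      Found q = proj₁ q ≡ β j × c ≤ 2 * (β j + proj₂ q)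
      far : ¬ Any Found 𝒫 → ∀ l → res l ≡ res j → l ≢ j → D c j < D c l
      far ∄q l rl≡rj l≢j = byOrder (<-cmp (β j) (β l))
        where
        below : (∃ λ y → (β j , y) ∈ 𝒫 × β l ≤ y) → D c j < D c l
        below (y , q∈𝒫 , βl≤y) =
          ∣-∣-far₃ c≤4β (subst (_< c + c) (quadruple (β j) (β l)) (+-mono-< 2s<c 2s<c))
          where
          2s<c : 2 * (β j + β l) < c
          2s<c = ≤-<-trans (*-monoʳ-≤ 2 (+-monoʳ-≤ (β j) βl≤y)) (≰⇒> λ c≤ → ∄q (lose q∈𝒫 (refl , c≤)))
        byOrder : Tri (β j < β l) (β j ≡ β l) (β l < β j) → D c j < D c l
        byOrder (tri< βj<βl _ _) = ∣-∣-far₁ c≤4β (*-monoʳ-< 4 βj<βl)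
        byOrder (tri≈ _ βj≡βl _) = contradiction (β-injective (sym βj≡βl)) l≢j
        byOrder (tri> _ _ βl<βj) = below (lower j l (sym rl≡rj) βl<βj)
      decide : Dec (Any Found 𝒫) → ∃ λ y → (β j , y) ∈ 𝒫 × c ≤ 2 * (β j + y)
      decide (no ∄q)     = contradiction (κ-nearest j (far ∄q)) κj≢0
      decide (yes found) = extract (find found)
        where
        extract : (∃ λ q → q ∈ 𝒫 × Found q) → ∃ λ y → (β j , y) ∈ 𝒫 × c ≤ 2 * (β j + y)
        extract ((_ , y) , q∈𝒫 , x≡ , c≤) = y , subst (λ x → (x , y) ∈ 𝒫) x≡ q∈𝒫 , c≤

    support⁻ : ∀ j → κ j ≢ 0ℤ → 4 * β j ≤ c → ∃ λ x → (x , β j) ∈ 𝒫 × 2 * (x + β j) ≤ c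
    support⁻ j κj≢0 4β≤c = decide (Any.any? (λ q → proj₂ q ≟ β j ×-dec 2 * (proj₁ q + β j) ≤? c) 𝒫)
      where
      Found : ℕ × ℕ → Set
      Found q = proj₂ q ≡ β j × 2 * (proj₁ q + β j) ≤ c
      far : ¬ Any Found 𝒫 → ∀ l → res l ≡ res j → l ≢ j → D c j < D c l
      far ∄q l rl≡rj l≢j = byOrder (<-cmp (β j) (β l))
        where
        above : (∃ λ x → (x , β j) ∈ 𝒫 × x ≤ β l) → D c j < D c l
        above (x , q∈𝒫 , x≤βl) = ∣-∣-far₄ 4β≤c (subst (c + c <_)
          (trans (quadruple (β l) (β j)) (+-comm (4 * β l) (4 * β j))) (+-mono-< c<2s c<2s))
          where
          c<2s : c < 2 * (β l + β j)
          c<2s = <-≤-trans (≰⇒> λ ≤c → ∄q (lose q∈𝒫 (refl , ≤c))) (*-monoʳ-≤ 2 (+-monoˡ-≤ (β j) x≤βl))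
        byOrder : Tri (β j < β l) (β j ≡ β l) (β l < β j) → D c j < D c l
        byOrder (tri< βj<βl _ _) = above (upper l j rl≡rj βj<βl)
        byOrder (tri≈ _ βj≡βl _) = contradiction (β-injective (sym βj≡βl)) l≢j
        byOrder (tri> _ _ βl<βj) = ∣-∣-far₂ 4β≤c (*-monoʳ-< 4 βl<βj)
      decide : Dec (Any Found 𝒫) → ∃ λ x → (x , β j) ∈ 𝒫 × 2 * (x + β j) ≤ c
      decide (no ∄q)     = contradiction (κ-nearest j (far ∄q)) κj≢0
      decide (yes found) = extract (find found)
        where
        extract : (∃ λ q → q ∈ 𝒫 × Found q) → ∃ λ x → (x , β j) ∈ 𝒫 × 2 * (x + β j) ≤ c
        extract ((x , _) , q∈𝒫 , y≡ , ≤c) = x , subst (λ y → (x , y) ∈ 𝒫) y≡ q∈𝒫 , ≤c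

    -- Each half of `κ` satisfies `k` moment equations on at most `k` nodes and so vanishes, but `κ`
    -- does not.
    no-small-support : ∀ k → (∀ i → i < k → ∃ λ l → w l ≡ i) → (us ls : List ℕ) →
      List.length us ≤ k → List.length ls ≤ k →
      (∀ j → κ j ≢ 0ℤ → c ≤ 4 * β j → β j ∈ us) → ¬ (∀ j → κ j ≢ 0ℤ → 4 * β j ≤ c → β j ∈ ls)
    no-small-support k w-onto us ls |us|≤k |ls|≤k κ-us κ-ls = proj₂ κ≢0 (κ≡0 (proj₁ κ≢0))
      where
      moments : ∀ (a μ : Fin N → ℤ) → (∀ l → Moment≡0 a μ (w l)) → ∀ i → i < k → Moment≡0 a μ i
      moments a μ h i i<k = subst (Moment≡0 a μ) (proj₂ (w-onto i i<k)) (h (proj₁ (w-onto i i<k)))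
      P = List.map (a⁺ e) us
      Q = List.map (a⁻ F) ls
      μ⁺≡0 : ∀ j → μ⁺ j ≡ 0ℤ
      μ⁺≡0 = moments-support (a⁺ e ∘ β) μ⁺ k (moments (a⁺ e ∘ β) μ⁺ moment⁺)
        (λ j k → β-injective ∘ a⁺-injective (β≤e j) (β≤e k)) P
        (subst (_≤ k) (sym (List.length-map _ us)) |us|≤k)
        λ j μj≢0 → ∈-map⁺ (a⁺ e) (κ-us j (proj₂ (μ⁺≢0 j μj≢0)) (proj₁ (μ⁺≢0 j μj≢0)))
      μ⁻≡0 : ∀ j → μ⁻ j ≡ 0ℤ
      μ⁻≡0 = moments-support (a⁻ F ∘ β) μ⁻ k (moments (a⁻ F ∘ β) μ⁻ moment⁻)
        (λ _ _ → β-injective ∘ a⁻-injective F) Q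
        (subst (_≤ k) (sym (List.length-map _ ls)) |ls|≤k)
        λ j μj≢0 → ∈-map⁺ (a⁻ F) (κ-ls j (proj₂ (μ⁻≢0 j μj≢0)) (proj₁ (μ⁻≢0 j μj≢0)))
      κ≡0 : ∀ j → κ j ≡ 0ℤ
      κ≡0 j with ≤-total c (4 * β j)
      ... | inj₁ c≤4β = trans (sym (μ⁺≡κ j c≤4β)) (μ⁺≡0 j)
      ... | inj₂ 4β≤c = trans (sym (μ⁻≡κ j 4β≤c)) (μ⁻≡0 j)

  -- At such a threshold each half of the support fits into `r` nodes, and the exponents 0, ..., r -
  -- 1 give as many moments.
  no-balanced-threshold : ∀ c e → (∀ j → β j ≤ e) → c ≤ 4 * e → (us ls : List ℕ) →
    List.length us ≤ r → List.length ls ≤ r →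
    (∀ {x y} → (x , y) ∈ 𝒫 → c ≤ 2 * (x + y) → x ∈ us) →
    ¬ (∀ {x y} → (x , y) ∈ 𝒫 → 2 * (x + y) ≤ c → y ∈ ls)
  no-balanced-threshold c e β≤e c≤4e us ls |us|≤r |ls|≤r cover⁺ cover⁻ =
    no-small-support r (λ i i<r → fromℕ< i<r , toℕ-fromℕ< i<r) us ls |us|≤r |ls|≤r
      (λ j κj≢0 c≤4β → let (_ , q∈𝒫 , c≤) = support⁺ j κj≢0 c≤4β in cover⁺ q∈𝒫 c≤)
      (λ j κj≢0 4β≤c → let (_ , q∈𝒫 , ≤c) = support⁻ j κj≢0 4β≤c in cover⁻ q∈𝒫 ≤c)
    where
    open Support (FromSingular.kernelVector c e 0 β≤e c≤4e toℕ (λ _ _ → toℕ-injective)) β≤e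

  module Ties (τ e : ℕ) (β≤e : ∀ j → β j ≤ e) (τ≤e : τ ≤ e) (r′ : ℕ) (r≡1+r′ : r ≡ suc r′)
              (C : Configuration τ r′) where
    open Configuration C
    open Tie

    private
      j₁ j₂ k₁ k₂ : Fin N
      j₁ = j tie₁
      j₂ = j tie₂
      k₁ = k tie₁
      k₂ = k tie₂

    -- This shift makes the nodes of both sides comparable: `a⁺ e x` and `a⁻ F y` coincide when x +
    -- y = τ, so the two ends of a tie share the node `T₁` or `T₂`.
    F : ℕ
    F = e ∸ τ

    P Q : List ℤ
    P = List.map (a⁺ e) us
    Q = List.map (a⁻ F) ls

    T₁ T₂ : ℤ
    T₁ = a⁻ F (β k₁)
    T₂ = a⁻ F (β k₂)

    private
      2τ≤4e : 2 * τ ≤ 4 * e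
      2τ≤4e = ≤-trans (*-monoʳ-≤ 2 τ≤e) (*-monoˡ-≤ e {2} {4} (s≤s (s≤s z≤n)))

      module TiePair (T : Tie τ) where

        quad : 4 * β (j T) + 4 * β (k T) ≡ 2 * τ + 2 * τ
        quad = trans (lemma (β (j T)) (β (k T))) (cong (λ s → 2 * s + 2 * s) (j+k≡s T))
          where
          lemma : ∀ m n → 4 * m + 4 * n ≡ 2 * (m + n) + 2 * (m + n)
          lemma = solve-∀

        c≤4j : 2 * τ ≤ 4 * β (j T)
        c≤4j = subst₂ _≤_ (cong (2 *_) (j+k≡s T)) (lemma (β (j T))) (*-monoʳ-≤ 2 (+-monoʳ-≤ (β (j T)) (<⇒≤ (k<j T))))
          where
          lemma : ∀ m → 2 * (m + m) ≡ 4 * m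
          lemma = solve-∀

        4k≤c : 4 * β (k T) ≤ 2 * τ
        4k≤c = subst₂ _≤_ (lemma (β (k T))) (cong (2 *_) (j+k≡s T)) (*-monoʳ-≤ 2 (+-monoˡ-≤ (β (k T)) (<⇒≤ (k<j T))))
          where
          lemma : ∀ m → 2 * (m + m) ≡ 4 * m
          lemma = solve-∀

        j≢k : j T ≢ k T
        j≢k e = <⇒≢ (k<j T) (cong β (sym e))

        D≡ : ∣ 4 * β (j T) - 2 * τ ∣ ≡ ∣ 4 * β (k T) - 2 * τ ∣
        D≡ = trans (m≤n⇒∣n-m∣≡n∸m c≤4j) (trans (+-cancelʳ-≡ (2 * τ + 4 * β (k T)) _ _ (begin
          (4 * β (j T) ∸ 2 * τ) + (2 * τ + 4 * β (k T)) ≡⟨ +-assoc (4 * β (j T) ∸ 2 * τ) _ _ ⟨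
          (4 * β (j T) ∸ 2 * τ) + 2 * τ + 4 * β (k T)   ≡⟨ cong (_+ 4 * β (k T)) (m∸n+n≡m c≤4j) ⟩
          4 * β (j T) + 4 * β (k T)                     ≡⟨ quad ⟩
          2 * τ + 2 * τ                         ≡⟨ cong (_+ 2 * τ) (m∸n+n≡m 4k≤c) ⟨
          (2 * τ ∸ 4 * β (k T)) + 4 * β (k T) + 2 * τ   ≡⟨ trans (+-assoc (2 * τ ∸ 4 * β (k T)) _ _) (cong (2 * τ ∸ 4 * β (k T) +_) (+-comm (4 * β (k T)) _)) ⟩
          (2 * τ ∸ 4 * β (k T)) + (2 * τ + 4 * β (k T)) ∎)) (sym (m≤n⇒∣m-n∣≡n∸m 4k≤c)))
          where open ≡-Reasoning

        far : ∀ l → res l ≡ res (j T) → l ≢ j T → l ≢ k T → ∣ 4 * β (j T) - 2 * τ ∣ < ∣ 4 * β l - 2 * τ ∣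
        far l rl≡rj l≢j l≢k with gap T l rl≡rj
        ... | inj₁ j≤l = ∣-∣-far₁ c≤4j (*-monoʳ-< 4 (≤∧≢⇒< j≤l (l≢j ∘ β-injective ∘ sym)))
        ... | inj₂ l≤k = ∣-∣-far₃ c≤4j (subst (4 * β (j T) + 4 * β l <_) quad
          (+-monoʳ-< (4 * β (j T)) (*-monoʳ-< 4 (≤∧≢⇒< l≤k (l≢k ∘ β-injective)))))

      module Pair₁ = TiePair tie₁
      module Pair₂ = TiePair tie₂

      j₁≢j₂ : j₁ ≢ j₂
      j₁≢j₂ e = distinct (cong res e)

      k₁≢k₂ : k₁ ≢ k₂
      k₁≢k₂ e = distinct (trans (mate tie₁) (trans (cong res e) (sym (mate tie₂))))

      a⁺≡a⁻ : ∀ {x y} → x + y ≡ τ → a⁺ e x ≡ a⁻ F y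
      a⁺≡a⁻ {x} {y} x+y≡τ = cong (λ n → ℤ.+ (2 ^ n)) (begin
        e ∸ x               ≡⟨ cong (_∸ x) (m∸n+n≡m τ≤e) ⟨
        F + τ ∸ x           ≡⟨ cong (λ s → F + s ∸ x) (trans (sym x+y≡τ) (+-comm x y)) ⟩
        F + (y + x) ∸ x     ≡⟨ cong (_∸ x) (+-assoc F y x) ⟨
        F + y + x ∸ x       ≡⟨ m+n∸n≡m (F + y) x ⟩
        F + y               ∎)
        where open ≡-Reasoning

    -- (f T₁ , f T₂) and (g T₁ , g T₂) are both orthogonal to (κ j₁ , κ j₂) ≠ 0.
    proportional : (w : Fin r → ℕ) (w-inj : ∀ k l → w k ≡ w l → k ≡ l) →
      (∀ i → i < r′ → ∃ λ l → w l ≡ i) → (f g : ℤ → ℤ) →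
      (∀ u → u ∈ us → f (a⁺ e u) ≡ 0ℤ) → (∀ u → u ∈ ls → g (a⁻ F u) ≡ 0ℤ) →
      (∀ (a μ : Fin N → ℤ) → (∀ l → Moment≡0 a μ (w l)) → ∑ (λ j → μ j ℤ.* f (a j)) ≡ 0ℤ) →
      (∀ (a μ : Fin N → ℤ) → (∀ l → Moment≡0 a μ (w l)) → ∑ (λ j → μ j ℤ.* g (a j)) ≡ 0ℤ) →
      f T₁ ℤ.* g T₂ ≡ f T₂ ℤ.* g T₁
    proportional w w-inj w-onto f g f-us g-ls f-moment g-moment =
      cross-multiply (κ j₁) (κ j₂) (f T₁) (f T₂) (g T₁) (g T₂) eq⁺ eq⁻ not-both-zero
      where
      v : KernelVector (2 * τ) e F w
      v = FromSingular.kernelVector (2 * τ) e F β≤e 2τ≤4e w w-inj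
      open KernelVector v
      open Support v β≤e
      f′ g′ : Fin N → ℤ
      f′ j = f (a⁺ e (β j))
      g′ j = g (a⁻ F (β j))

      -- Cramer's rule: if `u * v′ - v * u′` were nonzero, both `A` and `B` would vanish.
      cross-multiply : ∀ A B u v u′ v′ → A ℤ.* u ℤ.+ B ℤ.* v ≡ 0ℤ → A ℤ.* u′ ℤ.+ B ℤ.* v′ ≡ 0ℤ →
                       ¬ (A ≡ 0ℤ × B ≡ 0ℤ) → u ℤ.* v′ ≡ v ℤ.* u′
      cross-multiply A B u v u′ v′ p q nz with u ℤ.* v′ ℤ.≟ v ℤ.* u′
      ... | yes e = e
      ... | no ne = contradiction
        (factor≡0 A (trans (byA A B u v u′ v′) (trans (cong₂ (λ x y → v′ ℤ.* x ℤ.- v ℤ.* y) p q) (vanish v′ v))) ,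
         factor≡0 B (trans (byB A B u v u′ v′) (trans (cong₂ (λ x y → u ℤ.* x ℤ.- u′ ℤ.* y) q p) (vanish u u′)))) nz
        where
        byA : ∀ A B u v u′ v′ → A ℤ.* (u ℤ.* v′ ℤ.- v ℤ.* u′) ≡
              v′ ℤ.* (A ℤ.* u ℤ.+ B ℤ.* v) ℤ.- v ℤ.* (A ℤ.* u′ ℤ.+ B ℤ.* v′)
        byA = ℤ-solve-∀
        byB : ∀ A B u v u′ v′ → B ℤ.* (u ℤ.* v′ ℤ.- v ℤ.* u′) ≡
              u ℤ.* (A ℤ.* u′ ℤ.+ B ℤ.* v′) ℤ.- u′ ℤ.* (A ℤ.* u ℤ.+ B ℤ.* v)
        byB = ℤ-solve-∀
        vanish : ∀ x y → x ℤ.* 0ℤ ℤ.- y ℤ.* 0ℤ ≡ 0ℤ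
        vanish = ℤ-solve-∀
        factor≡0 : ∀ X → X ℤ.* (u ℤ.* v′ ℤ.- v ℤ.* u′) ≡ 0ℤ → X ≡ 0ℤ
        factor≡0 X h with ℤ.i*j≡0⇒i≡0∨j≡0 X h
        ... | inj₁ X≡0 = X≡0
        ... | inj₂ d≡0 = contradiction (ℤ.i-j≡0⇒i≡j _ _ d≡0) ne

      classify⁺ : ∀ j → κ j ≢ 0ℤ → 2 * τ ≤ 4 * β j → β j ∈ us ⊎ (j ≡ j₁ ⊎ j ≡ j₂)
      classify⁺ j κj≢0 c≤4β with support⁺ j κj≢0 c≤4β
      ... | y , q∈𝒫 , 2τ≤ with m≤n⇒m<n∨m≡n (*-cancelˡ-≤ 2 2τ≤)
      ...   | inj₁ τ< = inj₁ (cover⁺ q∈𝒫 τ<)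
      ...   | inj₂ τ≡ with cover⁼ q∈𝒫 (sym τ≡)
      ...     | inj₁ (βj≡ , _) = inj₂ (inj₁ (β-injective βj≡))
      ...     | inj₂ (βj≡ , _) = inj₂ (inj₂ (β-injective βj≡))

      classify⁻ : ∀ j → κ j ≢ 0ℤ → 4 * β j ≤ 2 * τ → β j ∈ ls ⊎ (j ≡ k₁ ⊎ j ≡ k₂)
      classify⁻ j κj≢0 4β≤c with support⁻ j κj≢0 4β≤c
      ... | x , q∈𝒫 , ≤2τ with m≤n⇒m<n∨m≡n (*-cancelˡ-≤ 2 ≤2τ)
      ...   | inj₁ <τ = inj₁ (cover⁻ q∈𝒫 <τ)
      ...   | inj₂ ≡τ with cover⁼ q∈𝒫 ≡τ
      ...     | inj₁ (_ , βj≡) = inj₂ (inj₁ (β-injective βj≡))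
      ...     | inj₂ (_ , βj≡) = inj₂ (inj₂ (β-injective βj≡))

      tie-sum₁ : κ j₁ ℤ.+ κ k₁ ≡ 0ℤ
      tie-sum₁ = κ-tie j₁ k₁ Pair₁.j≢k (mate tie₁) Pair₁.D≡ Pair₁.far

      tie-sum₂ : κ j₂ ℤ.+ κ k₂ ≡ 0ℤ
      tie-sum₂ = κ-tie j₂ k₂ Pair₂.j≢k (mate tie₂) Pair₂.D≡ Pair₂.far

      zero-partner : ∀ {x y} → x ℤ.+ y ≡ 0ℤ → x ≡ 0ℤ → y ≡ 0ℤ
      zero-partner {y = y} h refl = trans (sym (ℤ.+-identityˡ y)) h

      -- With both zero the support shrinks to `r′` elements on either side, and all exponents below
      -- `r′` occur among the `w l`.
      not-both-zero : ¬ (κ j₁ ≡ 0ℤ × κ j₂ ≡ 0ℤ)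
      not-both-zero (κ₁≡0 , κ₂≡0) = no-small-support r′ w-onto us ls (≤-reflexive |us|) (≤-reflexive |ls|)
        (λ j κj≢0 c≤4β → exclude κj≢0 κ₁≡0 κ₂≡0 (classify⁺ j κj≢0 c≤4β))
        (λ j κj≢0 4β≤c → exclude κj≢0 (zero-partner tie-sum₁ κ₁≡0) (zero-partner tie-sum₂ κ₂≡0) (classify⁻ j κj≢0 4β≤c))
        where
        exclude : ∀ {j x y} {A : Set} → κ j ≢ 0ℤ → κ x ≡ 0ℤ → κ y ≡ 0ℤ → A ⊎ (j ≡ x ⊎ j ≡ y) → A
        exclude κj≢0 κx≡0 κy≡0 (inj₁ a)           = a
        exclude κj≢0 κx≡0 κy≡0 (inj₂ (inj₁ refl)) = contradiction κx≡0 κj≢0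
        exclude κj≢0 κx≡0 κy≡0 (inj₂ (inj₂ refl)) = contradiction κy≡0 κj≢0

      eq⁺ : κ j₁ ℤ.* f T₁ ℤ.+ κ j₂ ℤ.* f T₂ ≡ 0ℤ
      eq⁺ = begin
        κ j₁ ℤ.* f T₁ ℤ.+ κ j₂ ℤ.* f T₂
          ≡⟨ cong₂ (λ x y → κ j₁ ℤ.* f x ℤ.+ κ j₂ ℤ.* f y) (a⁺≡a⁻ (j+k≡s tie₁)) (a⁺≡a⁻ (j+k≡s tie₂)) ⟨
        κ j₁ ℤ.* f′ j₁ ℤ.+ κ j₂ ℤ.* f′ j₂
          ≡⟨ cong₂ (λ x y → x ℤ.* f′ j₁ ℤ.+ y ℤ.* f′ j₂) (μ⁺≡κ j₁ Pair₁.c≤4j) (μ⁺≡κ j₂ Pair₂.c≤4j) ⟨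
        μ⁺ j₁ ℤ.* f′ j₁ ℤ.+ μ⁺ j₂ ℤ.* f′ j₂
          ≡⟨ ∑-two j₁≢j₂ others ⟨
        ∑ (λ j → μ⁺ j ℤ.* f′ j)
          ≡⟨ f-moment (a⁺ e ∘ β) μ⁺ moment⁺ ⟩
        0ℤ ∎
        where
        open ≡-Reasoning
        others : ∀ j → j ≢ j₁ → j ≢ j₂ → μ⁺ j ℤ.* f′ j ≡ 0ℤ
        others j j≢j₁ j≢j₂ with μ⁺ j ℤ.≟ 0ℤ
        ... | yes μj≡0 = trans (cong (ℤ._* f′ j) μj≡0) (ℤ.*-zeroˡ (f′ j))
        ... | no μj≢0 with classify⁺ j (proj₂ (μ⁺≢0 j μj≢0)) (proj₁ (μ⁺≢0 j μj≢0))
        ...   | inj₁ βj∈us          = trans (cong (μ⁺ j ℤ.*_) (f-us (β j) βj∈us)) (ℤ.*-zeroʳ (μ⁺ j))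
        ...   | inj₂ (inj₁ j≡j₁) = contradiction j≡j₁ j≢j₁
        ...   | inj₂ (inj₂ j≡j₂) = contradiction j≡j₂ j≢j₂

      -- The tie equations `κ j + κ k = 0` rewrite the relation of the lower side with the
      -- coefficients of the upper side.
      eq⁻ : κ j₁ ℤ.* g T₁ ℤ.+ κ j₂ ℤ.* g T₂ ≡ 0ℤ
      eq⁻ = begin
        κ j₁ ℤ.* g T₁ ℤ.+ κ j₂ ℤ.* g T₂
          ≡⟨ negate (κ j₁) (κ k₁) (κ j₂) (κ k₂) (g T₁) (g T₂) ⟩
        (κ j₁ ℤ.+ κ k₁) ℤ.* g T₁ ℤ.+ (κ j₂ ℤ.+ κ k₂) ℤ.* g T₂ ℤ.- (κ k₁ ℤ.* g T₁ ℤ.+ κ k₂ ℤ.* g T₂)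
          ≡⟨ cong₂ ℤ._-_ (cong₂ (λ x y → x ℤ.* g T₁ ℤ.+ y ℤ.* g T₂) tie-sum₁ tie-sum₂) (begin
               κ k₁ ℤ.* g T₁ ℤ.+ κ k₂ ℤ.* g T₂
                 ≡⟨ cong₂ (λ x y → x ℤ.* g T₁ ℤ.+ y ℤ.* g T₂) (μ⁻≡κ k₁ Pair₁.4k≤c) (μ⁻≡κ k₂ Pair₂.4k≤c) ⟨
               μ⁻ k₁ ℤ.* g′ k₁ ℤ.+ μ⁻ k₂ ℤ.* g′ k₂
                 ≡⟨ ∑-two k₁≢k₂ others ⟨
               ∑ (λ j → μ⁻ j ℤ.* g′ j)
                 ≡⟨ g-moment (a⁻ F ∘ β) μ⁻ moment⁻ ⟩
               0ℤ ∎) ⟩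
        0ℤ ℤ.* g T₁ ℤ.+ 0ℤ ℤ.* g T₂ ℤ.- 0ℤ
          ≡⟨ vanish (g T₁) (g T₂) ⟩
        0ℤ ∎
        where
        open ≡-Reasoning
        negate : ∀ a b c d x y → a ℤ.* x ℤ.+ c ℤ.* y ≡
                 (a ℤ.+ b) ℤ.* x ℤ.+ (c ℤ.+ d) ℤ.* y ℤ.- (b ℤ.* x ℤ.+ d ℤ.* y)
        negate = ℤ-solve-∀
        vanish : ∀ x y → 0ℤ ℤ.* x ℤ.+ 0ℤ ℤ.* y ℤ.- 0ℤ ≡ 0ℤ
        vanish = ℤ-solve-∀
        others : ∀ j → j ≢ k₁ → j ≢ k₂ → μ⁻ j ℤ.* g′ j ≡ 0ℤ
        others j j≢k₁ j≢k₂ with μ⁻ j ℤ.≟ 0ℤ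
        ... | yes μj≡0 = trans (cong (ℤ._* g′ j) μj≡0) (ℤ.*-zeroˡ (g′ j))
        ... | no μj≢0 with classify⁻ j (proj₂ (μ⁻≢0 j μj≢0)) (proj₁ (μ⁻≢0 j μj≢0))
        ...   | inj₁ βj∈ls          = trans (cong (μ⁻ j ℤ.*_) (g-ls (β j) βj∈ls)) (ℤ.*-zeroʳ (μ⁻ j))
        ...   | inj₂ (inj₁ j≡k₁) = contradiction j≡k₁ j≢k₁
        ...   | inj₂ (inj₂ j≡k₂) = contradiction j≡k₂ j≢k₂

    private
      r′<r : r′ < r
      r′<r = ≤-reflexive (sym r≡1+r′)

      onto : ∀ i → i < r → ∃ λ (l : Fin r) → toℕ l ≡ i
      onto i i<r = fromℕ< i<r , toℕ-fromℕ< i<r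

      P-zero : ∀ u → u ∈ us → ∏[ a⁺ e u - P ] ≡ 0ℤ
      P-zero u u∈us = ∏≡0 (∈-map⁺ (a⁺ e) u∈us)

      Q-zero : ∀ u → u ∈ ls → ∏[ a⁻ F u - Q ] ≡ 0ℤ
      Q-zero u u∈ls = ∏≡0 (∈-map⁺ (a⁻ F) u∈ls)

      |P|≡r′ : List.length P ≡ r′
      |P|≡r′ = trans (List.length-map (a⁺ e) us) |us|

      |Q|≡r′ : List.length Q ≡ r′
      |Q|≡r′ = trans (List.length-map (a⁻ F) ls) |ls|

      -- Skipping the exponent r - 1 gives the hypotheses of moments-gap.
      skip : Fin r → ℕ
      skip l with toℕ l <? r′
      ... | yes _ = toℕ l
      ... | no _  = r

      skip-injective : ∀ k l → skip k ≡ skip l → k ≡ l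
      skip-injective k l eq with toℕ k <? r′ | toℕ l <? r′
      ... | yes _    | yes _    = toℕ-injective eq
      ... | yes k<r′ | no _     = contradiction (<-trans k<r′ r′<r) (<-irrefl eq)
      ... | no _     | yes l<r′ = contradiction (<-trans l<r′ r′<r) (<-irrefl (sym eq))
      ... | no k≮r′  | no l≮r′  = toℕ-injective (trans (last k k≮r′) (sym (last l l≮r′)))
        where
        last : ∀ (k : Fin r) → ¬ toℕ k < r′ → toℕ k ≡ r′
        last k k≮r′ = ≤-antisym (s≤s⁻¹ (subst (toℕ k <_) r≡1+r′ (Fin.toℕ<n k))) (≮⇒≥ k≮r′)

      skip-onto : ∀ i → i < r′ → ∃ λ l → skip l ≡ i
      skip-onto i i<r′ = l , skip-l
        where
        l : Fin r
        l = fromℕ< (<-trans i<r′ r′<r)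
        l≡i : toℕ l ≡ i
        l≡i = toℕ-fromℕ< (<-trans i<r′ r′<r)
        skip-l : skip l ≡ i
        skip-l with toℕ l <? r′
        ... | yes _   = l≡i
        ... | no l≮r′ = contradiction (subst (_< r′) (sym l≡i) i<r′) l≮r′

      skip-last : ∃ λ l → skip l ≡ suc r′
      skip-last = l , skip-l
        where
        l : Fin r
        l = fromℕ< r′<r
        skip-l : skip l ≡ suc r′
        skip-l with toℕ l <? r′
        ... | yes l<r′ = contradiction l<r′ (<-irrefl (toℕ-fromℕ< r′<r))
        ... | no _     = r≡1+r′

      ∏-moment : ∀ bs → List.length bs ≡ r′ → (a μ : Fin N → ℤ) → (∀ (l : Fin r) → Moment≡0 a μ (toℕ l)) →
                 ∑ (λ j → μ j ℤ.* (1ℤ ℤ.* ∏[ a j - bs ])) ≡ 0ℤ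
      ∏-moment bs |bs|≡r′ a μ h = moments-∏ a μ r
        (λ i i<r → subst (Moment≡0 a μ) (toℕ-fromℕ< i<r) (h (fromℕ< i<r))) bs 0
        (subst (_< r) (sym |bs|≡r′) r′<r)

      gap-moment : ∀ bs → List.length bs ≡ r′ → (a μ : Fin N → ℤ) → (∀ l → Moment≡0 a μ (skip l)) →
                   ∑ (λ j → μ j ℤ.* (1ℤ ℤ.* (∏[ a j - bs ] ℤ.* (a j ℤ.+ Σ[ bs ])))) ≡ 0ℤ
      gap-moment bs |bs|≡r′ a μ h = moments-gap a μ r′
        (λ i i<r′ → subst (Moment≡0 a μ) (proj₂ (skip-onto i i<r′)) (h (proj₁ (skip-onto i i<r′))))
        (subst (Moment≡0 a μ) (proj₂ skip-last) (h (proj₁ skip-last))) bs 0 |bs|≡r′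

    products-agree : ∏[ T₁ - P ] ℤ.* ∏[ T₂ - Q ] ≡ ∏[ T₂ - P ] ℤ.* ∏[ T₁ - Q ]
    products-agree = subst₂ _≡_ (ones ∏[ T₁ - P ] ∏[ T₂ - Q ]) (ones ∏[ T₂ - P ] ∏[ T₁ - Q ]) (proportional toℕ (λ _ _ → toℕ-injective)
      (λ i i<r′ → onto i (<-trans i<r′ r′<r)) (λ x → 1ℤ ℤ.* ∏[ x - P ]) (λ x → 1ℤ ℤ.* ∏[ x - Q ])
      (λ u h → cong (1ℤ ℤ.*_) (P-zero u h)) (λ u h → cong (1ℤ ℤ.*_) (Q-zero u h))
      (∏-moment P |P|≡r′) (∏-moment Q |Q|≡r′))
      where
      ones : ∀ x y → 1ℤ ℤ.* x ℤ.* (1ℤ ℤ.* y) ≡ x ℤ.* y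
      ones = ℤ-solve-∀

    -- The changed exponents bring another kernel vector, but `proportional` eliminates it, so this
    -- relation and `products-agree` involve the same four products.
    shifted-products-agree :
      (∏[ T₁ - P ] ℤ.* (T₁ ℤ.+ Σ[ P ])) ℤ.* (∏[ T₂ - Q ] ℤ.* (T₂ ℤ.+ Σ[ Q ])) ≡
      (∏[ T₂ - P ] ℤ.* (T₂ ℤ.+ Σ[ P ])) ℤ.* (∏[ T₁ - Q ] ℤ.* (T₁ ℤ.+ Σ[ Q ]))
    shifted-products-agree = subst₂ _≡_
      (ones (∏[ T₁ - P ] ℤ.* (T₁ ℤ.+ Σ[ P ])) (∏[ T₂ - Q ] ℤ.* (T₂ ℤ.+ Σ[ Q ])))
      (ones (∏[ T₂ - P ] ℤ.* (T₂ ℤ.+ Σ[ P ])) (∏[ T₁ - Q ] ℤ.* (T₁ ℤ.+ Σ[ Q ])))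
      (proportional skip skip-injective skip-onto
      (λ x → 1ℤ ℤ.* (∏[ x - P ] ℤ.* (x ℤ.+ Σ[ P ]))) (λ x → 1ℤ ℤ.* (∏[ x - Q ] ℤ.* (x ℤ.+ Σ[ Q ])))
      (λ u h → cong (λ y → 1ℤ ℤ.* (y ℤ.* (a⁺ e u ℤ.+ Σ[ P ]))) (P-zero u h))
      (λ u h → cong (λ y → 1ℤ ℤ.* (y ℤ.* (a⁻ F u ℤ.+ Σ[ Q ]))) (Q-zero u h))
      (gap-moment P |P|≡r′) (gap-moment Q |Q|≡r′))
      where
      ones : ∀ x y → 1ℤ ℤ.* x ℤ.* (1ℤ ℤ.* y) ≡ x ℤ.* y
      ones = ℤ-solve-∀

    open UniqueLists

    private
      us≤e : ∀ {u} → u ∈ us → u ≤ e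
      us≤e u∈us = subst (_≤ e) (sym (proj₂ (us⊆β u∈us))) (β≤e (proj₁ (us⊆β u∈us)))

      complementary : ∀ {u y} → u ≤ e → e ∸ u ≡ F + y → u + y ≡ τ
      complementary {u} {y} u≤e eq = +-cancelʳ-≡ F _ _ (begin
        u + y + F       ≡⟨ trans (+-assoc u y F) (cong (u +_) (+-comm y F)) ⟩
        u + (F + y)     ≡⟨ cong (u +_) eq ⟨
        u + (e ∸ u)     ≡⟨ m+[n∸m]≡n u≤e ⟩
        e               ≡⟨ m+[n∸m]≡n τ≤e ⟨
        τ + F           ∎)
        where open ≡-Reasoning

      -- Keeps the product at the node nonzero, so that it can be cancelled. The node is also `a⁺ e`
      -- of the upper end of the tie, which is not in `us`.
      T∉P : (T : Tie τ) → ¬ a⁻ F (β (k T)) ∈ P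
      T∉P T T∈P = from (∈-map⁻ (a⁺ e) T∈P)
        where
        from : ¬ ∃ λ u → u ∈ us × a⁻ F (β (k T)) ≡ a⁺ e u
        from (u , u∈us , eq) = j∉us T (subst (_∈ us)
          (a⁺-injective (us≤e u∈us) (β≤e (j T)) (sym (trans (a⁺≡a⁻ (j+k≡s T)) eq))) u∈us)

      T∉Q : (T : Tie τ) → ¬ a⁻ F (β (k T)) ∈ Q
      T∉Q T T∈Q = from (∈-map⁻ (a⁻ F) T∈Q)
        where
        from : ¬ ∃ λ u → u ∈ ls × a⁻ F (β (k T)) ≡ a⁻ F u
        from (u , u∈ls , eq) = k∉ls T (subst (_∈ ls) (sym (a⁻-injective F eq)) u∈ls)

    sums-agree : Σ[ P ] ≡ Σ[ Q ]
    sums-agree = shifts-equal {∏[ T₁ - P ]} {∏[ T₂ - P ]} {∏[ T₁ - Q ]} {∏[ T₂ - Q ]} {T₁} {T₂} {Σ[ P ]} {Σ[ Q ]}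
      (∏≢0 (T∉P tie₁)) (∏≢0 (T∉Q tie₂))
      (λ T₁≡T₂ → k₁≢k₂ (β-injective (a⁻-injective F T₁≡T₂))) products-agree shifted-products-agree

    private
      P′ Q′ : List ℕ
      P′ = List.map (e ∸_) us
      Q′ = List.map (F +_) ls

      Σ-binary : ∀ (f : ℕ → ℕ) xs → Σ[ List.map (λ u → ℤ.+ (2 ^ f u)) xs ] ≡ ℤ.+ binary (List.map f xs)
      Σ-binary f List.[]       = refl
      Σ-binary f (x List.∷ xs) = cong (λ y → ℤ.+ (2 ^ f x) ℤ.+ y) (Σ-binary f xs)

      binary≡ : binary P′ ≡ binary Q′
      binary≡ = ℤ.+-injective (trans (sym (Σ-binary (e ∸_) us)) (trans sums-agree (Σ-binary (F +_) ls)))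

      P′-unique : Unique P′
      P′-unique = unique-map (λ p q → ∸-cancelˡ-≡ (us≤e p) (us≤e q)) us-unique

      Q′-unique : Unique Q′
      Q′-unique = unique-map (λ _ _ → +-cancelˡ-≡ F _ _) ls-unique

      bound : ℕ
      bound = suc (sum (P′ List.++ Q′))

      ∈⇒≤sum : ∀ {x xs} → x ∈ xs → x ≤ sum xs
      ∈⇒≤sum (Any.here refl) = m≤m+n _ _
      ∈⇒≤sum (Any.there x∈)  = ≤-trans (∈⇒≤sum x∈) (m≤n+m _ _)

      P′-bound : ∀ {x} → x ∈ P′ → x < bound
      P′-bound x∈ = s≤s (∈⇒≤sum (∈-++⁺ˡ x∈))

      Q′-bound : ∀ {x} → x ∈ Q′ → x < bound
      Q′-bound x∈ = s≤s (∈⇒≤sum (∈-++⁺ʳ P′ x∈))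

    -- Equal sums of distinct powers of 2 have the same exponents, and an exponent `e ∸ u` of one
    -- side that equals `F + l` on the other means u + l = τ.
    complement⁺ : ∀ {u} → u ∈ us → ∃ λ l → l ∈ ls × u + l ≡ τ
    complement⁺ {u} u∈us = finish (∈-map⁻ (F +_)
      (binary-injective bound P′-unique Q′-unique P′-bound Q′-bound binary≡ (∈-map⁺ (e ∸_) u∈us)))
      where
      finish : (∃ λ l → l ∈ ls × e ∸ u ≡ F + l) → ∃ λ l → l ∈ ls × u + l ≡ τ
      finish (l , l∈ls , eq) = l , l∈ls , complementary (us≤e u∈us) eq

    complement⁻ : ∀ {l} → l ∈ ls → ∃ λ u → u ∈ us × u + l ≡ τ
    complement⁻ {l} l∈ls = finish (∈-map⁻ (e ∸_)
      (binary-injective bound Q′-unique P′-unique Q′-bound P′-bound (sym binary≡) (∈-map⁺ (F +_) l∈ls)))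
      where
      finish : (∃ λ u → u ∈ us × F + l ≡ e ∸ u) → ∃ λ u → u ∈ us × u + l ≡ τ
      finish (u , u∈us , eq) = u , u∈us , complementary (us≤e u∈us) (sym eq)

-- Consecutive pairs in a decreasing list.

module ConsecutivePairs where
  open import Defs using (consecutiveSums)
  open import Data.List.Base
  open import Data.List.Membership.Propositional using (_∈_)
  open import Data.List.Relation.Unary.All as All using (All; []; _∷_)
  open import Data.List.Relation.Unary.AllPairs using (AllPairs; []; _∷_)
  open import Data.List.Relation.Unary.Any using (here; there)
  open import Data.List.Relation.Unary.Unique.Propositional using (Unique)
  open import Data.Nat.Base using (_<_; _>_; _≤_; _+_; pred)
  open import Data.Nat.Properties
  open import Data.Product.Base using (∃; _×_; _,_; proj₁; uncurry)
  open import Data.Sum.Base using (_⊎_; inj₁; inj₂)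
  open import Relation.Binary.PropositionalEquality
  open import Relation.Nullary.Negation.Core using (contradiction)

  Decreasing : List ℕ → Set
  Decreasing = AllPairs _>_

  pairs : List ℕ → List (ℕ × ℕ)
  pairs []           = []
  pairs (x ∷ [])     = []
  pairs (x ∷ y ∷ xs) = (x , y) ∷ pairs (y ∷ xs)

  consecutiveSums≡ : ∀ xs → consecutiveSums xs ≡ map (uncurry _+_) (pairs xs)
  consecutiveSums≡ []           = refl
  consecutiveSums≡ (x ∷ [])     = refl
  consecutiveSums≡ (x ∷ y ∷ xs) = cong (x + y ∷_) (consecutiveSums≡ (y ∷ xs))

  length-pairs : ∀ xs → length (pairs xs) ≡ pred (length xs)
  length-pairs []           = refl
  length-pairs (x ∷ [])     = refl
  length-pairs (x ∷ y ∷ xs) = cong ℕ.suc (length-pairs (y ∷ xs))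

  head-≤ : ∀ {x xs z} → Decreasing (x ∷ xs) → z ∈ x ∷ xs → z ≤ x
  head-≤ (_    ∷ _) (here refl)  = ≤-refl
  head-≤ (x>xs ∷ _) (there z∈xs) = <⇒≤ (All.lookup x>xs z∈xs)

  pairs-sound : ∀ {xs x y} → Decreasing xs → (x , y) ∈ pairs xs →
                x ∈ xs × y ∈ xs × y < x × (∀ {z} → z ∈ xs → x ≤ z ⊎ z ≤ y)
  pairs-sound {x ∷ []} dec ()
  pairs-sound {x ∷ y ∷ xs} ((x>y ∷ x>xs) ∷ dec) (here refl) =
    here refl , there (here refl) , x>y , λ
      { (here refl) → inj₁ ≤-refl
      ; (there z∈)  → inj₂ (head-≤ dec z∈) }
  pairs-sound {x ∷ y ∷ xs} (x>yxs ∷ dec) (there q∈) with pairs-sound dec q∈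
  ... | u∈ , v∈ , v<u , gap = there u∈ , there v∈ , v<u , λ
    { (here refl) → inj₁ (<⇒≤ (All.lookup x>yxs u∈))
    ; (there z∈)  → gap z∈ }

  pairs-lower : ∀ {xs x z} → Decreasing xs → x ∈ xs → z ∈ xs → z < x → ∃ λ y → (x , y) ∈ pairs xs × z ≤ y
  pairs-lower dec (here refl) (here refl) z<x = contradiction refl (<⇒≢ z<x)
  pairs-lower {x ∷ y ∷ xs} (_ ∷ dec) (here refl) (there z∈) z<x = y , here refl , head-≤ dec z∈
  pairs-lower {w ∷ y ∷ xs} (w> ∷ dec) (there x∈) (here refl) z<x =
    contradiction z<x (<-asym (All.lookup w> x∈))
  pairs-lower {w ∷ y ∷ xs} (_ ∷ dec) (there x∈) (there z∈) z<x with pairs-lower dec x∈ z∈ z<x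
  ... | v , q∈ , z≤v = v , there q∈ , z≤v

  pairs-upper : ∀ {xs x z} → Decreasing xs → x ∈ xs → z ∈ xs → z < x → ∃ λ w → (w , z) ∈ pairs xs × w ≤ x
  pairs-upper dec (here refl) (here refl) z<x = contradiction refl (<⇒≢ z<x)
  pairs-upper {x ∷ y ∷ xs} (_ ∷ dec) (here refl) (there (here refl)) z<x = x , here refl , ≤-refl
  pairs-upper {x ∷ y ∷ xs} ((x>y ∷ _) ∷ (y> ∷ dec)) (here refl) (there (there z∈)) z<x
    with pairs-upper (y> ∷ dec) (here refl) (there z∈) (All.lookup y> z∈)
  ... | w , q∈ , w≤y = w , there q∈ , ≤-trans w≤y (<⇒≤ x>y)
  pairs-upper {w ∷ y ∷ xs} (w> ∷ dec) (there x∈) (here refl) z<x =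
    contradiction z<x (<-asym (All.lookup w> x∈))
  pairs-upper {w ∷ y ∷ xs} (_ ∷ dec) (there x∈) (there z∈) z<x with pairs-upper dec x∈ z∈ z<x
  ... | v , q∈ , v≤x = v , there q∈ , v≤x

  pairs-unique : ∀ {xs} → Decreasing xs → Unique (pairs xs)
  pairs-unique {[]}         dec         = []
  pairs-unique {x ∷ []}     dec         = []
  pairs-unique {x ∷ y ∷ xs} (x> ∷ dec) =
    All.tabulate (λ { q∈ refl → <-irrefl refl (All.lookup x> (proj₁ (pairs-sound dec q∈))) }) ∷ pairs-unique dec

-- Counting by sums of indicators.

module Counting where
  open import Data.Bool.Base using (Bool; true; false)
  open import Data.Fin.Base using (zero; suc)
  open import Data.Fin.Properties using () renaming (_≟_ to _≟ᶠ_)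
  open import Data.Fin.Subset using (Subset; _─_; ∣_∣) renaming (_∈_ to _∈ˢ_; _∉_ to _∉ˢ_)
  open import Data.Fin.Subset.Properties using (_∈?_; p─q⊆p)
  open import Data.List.Base using (List; length; filter; concatMap; tabulate)
  open import Data.List.Properties using (length-++)
  open import Data.Nat.Base hiding (ℕ)
  open import Data.Nat.Properties
  open import Data.Product.Base using (∃; _×_; _,_)
  open import Data.Sum.Base using (inj₁; inj₂)
  import Data.Vec.Base as Vec
  open import Data.Vec.Properties using (lookup∘tabulate; []=⇒lookup; lookup⇒[]=)
  open import Function.Base using (_∘_)
  open import Function.Bundles using (mk⇔)
  open import Relation.Binary.PropositionalEquality
  open import Relation.Nullary.Decidable using (Dec; does; yes; no; does-⇔; _×-dec_; dec-true; dec-false)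
  open import Relation.Nullary.Negation.Core using (¬_; contradiction)
  open import Relation.Unary using (Decidable)
  open Summation +-*-semiring public

  private variable
    n : ℕ

  bit : Bool → ℕ
  bit true  = 1
  bit false = 0

  ⟦_⟧ : ∀ {p} {P : Set p} → Dec P → ℕ
  ⟦ P? ⟧ = bit (does P?)

  ⟦⟧-⇔ : ∀ {p q} {P : Set p} {Q : Set q} (P? : Dec P) (Q? : Dec Q) → (P → Q) → (Q → P) → ⟦ P? ⟧ ≡ ⟦ Q? ⟧
  ⟦⟧-⇔ P? Q? f g = cong bit (does-⇔ (mk⇔ f g) P? Q?)

  ⟦⟧-yes : ∀ {p} {P : Set p} (P? : Dec P) → P → ⟦ P? ⟧ ≡ 1
  ⟦⟧-yes P? p = cong bit (dec-true P? p)

  ⟦⟧-no : ∀ {p} {P : Set p} (P? : Dec P) → ¬ P → ⟦ P? ⟧ ≡ 0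
  ⟦⟧-no P? ¬p = cong bit (dec-false P? ¬p)

  ⟦⟧-× : ∀ {p q} {P : Set p} {Q : Set q} (P? : Dec P) (Q? : Dec Q) → ⟦ P? ×-dec Q? ⟧ ≡ ⟦ P? ⟧ * ⟦ Q? ⟧
  ⟦⟧-× P? Q? with does P?
  ... | true  = sym (+-identityʳ _)
  ... | false = refl

  ∣∣≡∑ : (p : Subset n) → ∣ p ∣ ≡ ∑ λ j → ⟦ j ∈? p ⟧
  ∣∣≡∑ Vec.[]            = sym (∑-[] _)
  ∣∣≡∑ (true Vec.∷ p)  = trans (cong ℕ.suc (∣∣≡∑ p)) (sym (∑-suc _))
  ∣∣≡∑ (false Vec.∷ p) = trans (∣∣≡∑ p) (sym (∑-suc _))

  length-filter : ∀ {a p} {A : Set a} {P : A → Set p} (P? : Decidable P) (f : Fin n → A) →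
                  length (filter P? (tabulate f)) ≡ ∑ λ j → ⟦ P? (f j) ⟧
  length-filter {ℕ.zero}  P? f = sym (∑-[] _)
  length-filter {ℕ.suc n} P? f with P? (f zero) in eq
  ... | yes _ = trans (cong ℕ.suc (length-filter P? (f ∘ suc)))
                  (trans (cong (λ d → ⟦ d ⟧ + ∑ (λ j → ⟦ P? (f (suc j)) ⟧)) (sym eq)) (sym (∑-suc _)))
  ... | no _  = trans (length-filter P? (f ∘ suc))
                  (trans (cong (λ d → ⟦ d ⟧ + ∑ (λ j → ⟦ P? (f (suc j)) ⟧)) (sym eq)) (sym (∑-suc _)))

  length-concatMap-filter : ∀ {a b p} {A : Set a} {B : Set b} {P : A → Set p} (P? : Decidable P)
    (h : A → List B) (f : Fin n → A) →
    length (concatMap h (filter P? (tabulate f))) ≡ ∑ λ j → ⟦ P? (f j) ⟧ * length (h (f j))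
  length-concatMap-filter {ℕ.zero}  P? h f = sym (∑-[] _)
  length-concatMap-filter {ℕ.suc n} P? h f with P? (f zero) in eq
  ... | yes _ = trans (length-++ (h (f zero))) (trans (cong₂ _+_ (sym (+-identityʳ _)) (length-concatMap-filter P? h (f ∘ suc)))
                  (trans (cong (λ d → ⟦ d ⟧ * length (h (f zero)) + ∑ (λ j → ⟦ P? (f (suc j)) ⟧ * length (h (f (suc j))))) (sym eq)) (sym (∑-suc _))))
  ... | no _  = trans (length-concatMap-filter P? h (f ∘ suc))
                  (trans (cong (λ d → ⟦ d ⟧ * length (h (f zero)) + ∑ (λ j → ⟦ P? (f (suc j)) ⟧ * length (h (f (suc j))))) (sym eq)) (sym (∑-suc _)))

  ∑-one : ∑ {n} (λ _ → 1) ≡ n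
  ∑-one {ℕ.zero}  = ∑-[] _
  ∑-one {ℕ.suc n} = trans (∑-suc _) (cong ℕ.suc ∑-one)

  ∑-mono : {u v : Fin n → ℕ} → (∀ j → u j ≤ v j) → ∑ u ≤ ∑ v
  ∑-mono {ℕ.zero}  h = ≤-reflexive (trans (∑-[] _) (sym (∑-[] _)))
  ∑-mono {ℕ.suc n} h = subst₂ _≤_ (sym (∑-suc _)) (sym (∑-suc _)) (+-mono-≤ (h zero) (∑-mono (h ∘ suc)))

  ∑-mono-≡ : {u v : Fin n → ℕ} → (∀ j → u j ≤ v j) → ∑ u ≡ ∑ v → ∀ j → u j ≡ v j
  ∑-mono-≡ {ℕ.suc n} {u} {v} h eq zero with m≤n⇒m<n∨m≡n (h zero)
  ... | inj₂ e = e
  ... | inj₁ u<v = contradiction (trans (sym (∑-suc u)) (trans eq (∑-suc v)))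
                        (<⇒≢ (+-mono-<-≤ u<v (∑-mono (h ∘ suc))))
  ∑-mono-≡ {ℕ.suc n} {u} {v} h eq (suc j) = ∑-mono-≡ (h ∘ suc)
    (+-cancelˡ-≡ (u zero) _ _ (trans (sym (∑-suc u)) (trans eq (trans (∑-suc v)
      (cong (_+ ∑ (v ∘ suc)) (sym (∑-mono-≡ h eq zero))))))) j

  ∈-tabulate⁺ : ∀ {p} {P : Fin n → Set p} (P? : ∀ j → Dec (P j)) {j} → P j → j ∈ˢ Vec.tabulate (does ∘ P?)
  ∈-tabulate⁺ P? {j} Pj = lookup⇒[]= j _ (trans (lookup∘tabulate (does ∘ P?) j) (dec-true (P? j) Pj))

  ∈-tabulate⁻ : ∀ {p} {P : Fin n → Set p} (P? : ∀ j → Dec (P j)) {j} → j ∈ˢ Vec.tabulate (does ∘ P?) → P j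
  ∈-tabulate⁻ P? {j} j∈ with P? j in eq
  ... | yes Pj = Pj
  ... | no _   with trans (sym ([]=⇒lookup j∈)) (trans (lookup∘tabulate (does ∘ P?) j) (cong does eq))
  ...   | ()

  ∈-─⁻ : ∀ {p q : Subset n} {j} → j ∈ˢ p ─ q → j ∈ˢ p × j ∉ˢ q
  ∈-─⁻ {p = p} {q} {j} j∈ = p─q⊆p p q j∈ , excluded p q j∈
    where
    excluded : ∀ {n} (p q : Subset n) {j} → j ∈ˢ p ─ q → j ∉ˢ q
    excluded (x Vec.∷ p) (true Vec.∷ q) () Vec.here
    excluded (x Vec.∷ p) (y Vec.∷ q) (Vec.there j∈) (Vec.there j∈q) = excluded p q j∈ j∈q

  ∣∣≡1⁺ : (p : Subset n) → ∀ {j} → j ∈ˢ p → (∀ {k} → k ∈ˢ p → k ≡ j) → ∣ p ∣ ≡ 1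
  ∣∣≡1⁺ p {j} j∈ uniq = trans (∣∣≡∑ p) (trans (∑-single j λ k k≢j → ⟦⟧-no (k ∈? p) (k≢j ∘ uniq)) (⟦⟧-yes (j ∈? p) j∈))

  ∣∣≥1⇒∃ : (p : Subset n) → 1 ≤ ∣ p ∣ → ∃ λ j → j ∈ˢ p
  ∣∣≥1⇒∃ (true Vec.∷ p)  h = zero , Vec.here
  ∣∣≥1⇒∃ (false Vec.∷ p) h with ∣∣≥1⇒∃ p h
  ... | j , j∈ = suc j , Vec.there j∈

  ∣∣≥2 : (p : Subset n) → ∀ {j k} → j ≢ k → j ∈ˢ p → k ∈ˢ p → 2 ≤ ∣ p ∣
  ∣∣≥2 p {j} {k} j≢k j∈ k∈ = subst (2 ≤_) (sym (∣∣≡∑ p)) (subst (_≤ ∑ (λ l → ⟦ l ∈? p ⟧))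
    (trans (∑-two j≢k λ l l≢j l≢k → cong₂ _+_ (⟦⟧-no (l ≟ᶠ j) l≢j) (⟦⟧-no (l ≟ᶠ k) l≢k))
      (cong₂ _+_ (cong₂ _+_ (⟦⟧-yes (j ≟ᶠ j) refl) (⟦⟧-no (j ≟ᶠ k) j≢k))
                 (cong₂ _+_ (⟦⟧-no (k ≟ᶠ j) (j≢k ∘ sym)) (⟦⟧-yes (k ≟ᶠ k) refl))))
    (∑-mono indicator))
    where
    indicator : ∀ l → ⟦ l ≟ᶠ j ⟧ + ⟦ l ≟ᶠ k ⟧ ≤ ⟦ l ∈? p ⟧
    indicator l with l ≟ᶠ j | l ≟ᶠ k
    ... | yes refl | yes refl = contradiction refl j≢k
    ... | yes refl | no _     = ≤-reflexive (sym (⟦⟧-yes (l ∈? p) j∈))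
    ... | no _     | yes refl = ≤-reflexive (sym (⟦⟧-yes (l ∈? p) k∈))
    ... | no _     | no _     = z≤n

  ∣∣≡1⇒≡ : (p : Subset n) → ∣ p ∣ ≡ 1 → ∀ {j k} → j ∈ˢ p → k ∈ˢ p → j ≡ k
  ∣∣≡1⇒≡ p eq {j} {k} j∈ k∈ with j ≟ᶠ k
  ... | yes j≡k = j≡k
  ... | no j≢k  = contradiction (subst (2 ≤_) eq (∣∣≥2 p j≢k j∈ k∈)) λ { (s≤s ()) }

import Data.Vec.Functional
import Defs

-- Order statistics.

module KthLargest where
  open import Defs using (kthLargest)
  open import Data.List.Base
  open import Data.List.Properties using (length-filter; filter-none; filter-accept; filter-reject)
  open import Data.List.Membership.Propositional using (_∈_)
  open import Data.List.Relation.Binary.Permutation.Propositional.Properties using (filter-↭; ↭-length)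
  open import Data.List.Relation.Unary.All as All using (All; []; _∷_)
  open import Data.List.Relation.Unary.AllPairs using (AllPairs; []; _∷_)
  open import Data.List.Relation.Unary.Any using (here; there)
  open import Data.List.Relation.Unary.Sorted.TotalOrder.Properties using (Sorted⇒AllPairs)
  import Data.List.Sort as Sort
  open import Data.Maybe.Base using (just)
  open import Data.Nat.Base using (zero; suc; _<_; _≤_; _≥_; _+_; s≤s)
  open import Data.Nat.Properties
  open import Data.Product.Base using (∃; _×_; _,_)
  open import Function.Base using (_∘_)
  open import Relation.Binary.Bundles using (DecTotalOrder)
  open import Relation.Binary.Construct.Flip.EqAndOrd using (decTotalOrder)
  open import Relation.Binary.Definitions using (tri<; tri≈; tri>)
  open import Relation.Binary.PropositionalEquality
  open import Relation.Unary using (Decidable)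

  #> #< #≡ : ℕ → List ℕ → ℕ
  #> s xs = length (filter (s <?_) xs)
  #< s xs = length (filter (_<? s) xs)
  #≡ s xs = length (filter (_≟ s) xs)

  private
    split : ∀ {us us′ vs vs′ ws ws′ : List ℕ} → us ≡ us′ → vs ≡ vs′ → ws ≡ ws′ →
            length us + length vs + length ws ≡ length us′ + length vs′ + length ws′
    split refl refl refl = refl

  trichotomy : ∀ s xs → #> s xs + #< s xs + #≡ s xs ≡ length xs
  trichotomy s []       = refl
  trichotomy s (x ∷ xs) with <-cmp s x
  ... | tri< s<x s≢x x≮s = trans
    (split (filter-accept (s <?_) s<x) (filter-reject (_<? s) x≮s) (filter-reject (_≟ s) (s≢x ∘ sym)))
    (cong suc (trichotomy s xs))
  ... | tri≈ s≮x s≡x x≮s = trans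
    (split (filter-reject (s <?_) s≮x) (filter-reject (_<? s) x≮s) (filter-accept (_≟ s) (sym s≡x)))
    (trans (+-suc _ (#≡ s xs)) (cong suc (trichotomy s xs)))
  ... | tri> s≮x s≢x x<s = trans
    (split (filter-reject (s <?_) s≮x) (filter-accept (_<? s) x<s) (filter-reject (_≟ s) (s≢x ∘ sym)))
    (trans (cong (_+ #≡ s xs) (+-suc (#> s xs) (#< s xs))) (cong suc (trichotomy s xs)))

  private
    sorted-kth : ∀ k xs → AllPairs _≥_ xs → k < length xs →
                 ∃ λ s → head (drop k xs) ≡ just s × s ∈ xs × #> s xs ≤ k × #< s xs + suc k ≤ length xs
    sorted-kth zero (x ∷ xs) (x≥ ∷ _) _ = x , refl , here refl ,
      ≤-reflexive (cong length (filter-none (x <?_) {xs = x ∷ xs} (<-irrefl refl ∷ All.map ≤⇒≯ x≥))) ,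
      ≤-trans (≤-reflexive (+-comm _ 1)) (s≤s (≤-trans (≤-reflexive (cong length (filter-reject (_<? x) {x} {xs} (<-irrefl refl))))
        (length-filter (_<? x) xs)))
    sorted-kth (suc k) (x ∷ xs) (x≥ ∷ sorted) (s≤s k<) with sorted-kth k xs sorted k<
    ... | s , eq , s∈ , gt , lt = s , eq , there s∈ , gt′ , lt′
      where
      gt′ : #> s (x ∷ xs) ≤ suc k
      gt′ with <-cmp s x
      ... | tri< s<x _ _ = subst (λ ys → length ys ≤ suc k) (sym (filter-accept (s <?_) s<x)) (s≤s gt)
      ... | tri≈ s≮x _ _ = subst (λ ys → length ys ≤ suc k) (sym (filter-reject (s <?_) s≮x)) (m≤n⇒m≤1+n gt)
      ... | tri> s≮x _ _ = subst (λ ys → length ys ≤ suc k) (sym (filter-reject (s <?_) s≮x)) (m≤n⇒m≤1+n gt)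
      lt′ : #< s (x ∷ xs) + suc (suc k) ≤ suc (length xs)
      lt′ = subst (_≤ suc (length xs)) (trans (sym (+-suc (#< s xs) (suc k)))
        (cong (λ ys → length ys + suc (suc k)) (sym (filter-reject (_<? s) {x} {xs} (≤⇒≯ (All.lookup x≥ s∈))))))
        (s≤s lt)

  private
    ≥-order : DecTotalOrder _ _ _
    ≥-order = decTotalOrder ≤-decTotalOrder

  -- The form in which the choice of τ enters the argument, with k = r - 1 and a list of 2r sums: at
  -- most r - 1 of them are larger and at most r smaller.
  kthLargest-spec : ∀ k xs → k < length xs →
    ∃ λ s → kthLargest (suc k) xs ≡ just s × #> s xs ≤ k × #< s xs + suc k ≤ length xs
  kthLargest-spec k xs k< with sorted-kth k ys (Sorted⇒AllPairs (DecTotalOrder.totalOrder ≥-order) (Sort.sort-↗ ≥-order xs)) (subst (k <_) (sym |ys|) k<)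
    where
    ys = Sort.sort ≥-order xs
    |ys| : length ys ≡ length xs
    |ys| = ↭-length (Sort.sort-↭ ≥-order xs)
  ... | s , eq , _ , gt , lt = s , eq ,
    subst (_≤ k) (↭-length (filter-↭ (s <?_) (Sort.sort-↭ ≥-order xs))) gt ,
    subst₂ (λ a b → a + suc k ≤ b) (↭-length (filter-↭ (_<? s) (Sort.sort-↭ ≥-order xs))) (↭-length (Sort.sort-↭ ≥-order xs)) lt

import Data.Nat.Properties

-- Parity of the threshold, and sums over lists.

module Halves where
  open import Data.Nat.Base
  open import Data.Nat.Properties
  open import Relation.Binary.PropositionalEquality

  private
    2*-∸1 : ∀ s → 2 * suc s ∸ 1 ≡ suc (2 * s)
    2*-∸1 s = +-suc s (s + 0)

  -- Serves the odd threshold c = 2s - 1; the positivity of `s` makes the truncated subtraction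
  -- exact.
  odd≤even : ∀ {s m} → 0 < s → 2 * s ∸ 1 ≤ 2 * m → s ≤ m
  odd≤even {suc s} {m} _ h = ≮⇒≥ λ m≤s →
    <⇒≱ (s≤s (*-monoʳ-≤ 2 (s≤s⁻¹ m≤s))) (subst (_≤ 2 * m) (2*-∸1 s) h)

  even≤odd : ∀ {s m} → 0 < s → 2 * m ≤ 2 * s ∸ 1 → m < s
  even≤odd {suc s} {m} _ h = ≰⇒> λ s<m →
    <⇒≱ (<-≤-trans (subst (suc (2 * s) <_) (sym (*-suc 2 s)) ≤-refl) (*-monoʳ-≤ 2 s<m)) (subst (2 * m ≤_) (2*-∸1 s) h)

module ListSums where
  open import Data.List.Base using (List; []; _∷_; map; length; filter; tabulate; take; drop; _++_)
  open import Data.List.Membership.Propositional using (_∈_; lose)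
  open import Data.List.Properties using (filter-notAll)
  open import Data.List.Relation.Unary.All as All using (All; []; _∷_)
  open import Data.List.Relation.Unary.AllPairs using (AllPairs; []; _∷_)
  open import Data.List.Relation.Unary.Any using (here; there)
  open import Data.List.Relation.Unary.Unique.Propositional using (Unique)
  open import Data.Nat.Base hiding (ℕ)
  open import Data.Nat.ListAction using (sum)
  open import Data.Nat.Properties
  open import Data.Nat.Tactic.RingSolver using (solve-∀)
  open import Data.Sum.Base using (inj₁; inj₂)
  open import Function.Base using (_∘_)
  open import Relation.Binary.PropositionalEquality
  open import Relation.Nullary.Decidable.Core using (yes; no; ¬?)
  open import Relation.Nullary.Negation.Core using (contradiction)
  open import Relation.Unary using (Decidable)
  open Counting using (∑; ∑-[]; ∑-suc; ⟦_⟧)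
  open UniqueLists

  sum-mono : ∀ {f g : ℕ → ℕ} → (∀ x → f x ≤ g x) → ∀ xs → sum (map f xs) ≤ sum (map g xs)
  sum-mono f≤g []       = z≤n
  sum-mono f≤g (x ∷ xs) = +-mono-≤ (f≤g x) (sum-mono f≤g xs)

  sum-mono-≡ : ∀ {f g : ℕ → ℕ} → (∀ x → f x ≤ g x) → ∀ {xs} → sum (map f xs) ≡ sum (map g xs) →
               ∀ {x} → x ∈ xs → f x ≡ g x
  sum-mono-≡ f≤g {x ∷ xs} eq x∈ with m≤n⇒m<n∨m≡n (f≤g x)
  ... | inj₁ fx<gx = contradiction eq (<⇒≢ (+-mono-<-≤ fx<gx (sum-mono f≤g xs)))
  sum-mono-≡ f≤g {x ∷ xs} eq (here refl) | inj₂ fx≡gx = fx≡gx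
  sum-mono-≡ {f} {g} f≤g {x ∷ xs} eq (there x∈) | inj₂ fx≡gx =
    sum-mono-≡ f≤g (+-cancelˡ-≡ (f x) _ _ (trans eq (cong (_+ sum (map g xs)) (sym fx≡gx)))) x∈

  sum-cong : ∀ {f g : ℕ → ℕ} {xs} → (∀ {x} → x ∈ xs → f x ≡ g x) → sum (map f xs) ≡ sum (map g xs)
  sum-cong {xs = []}     h = refl
  sum-cong {xs = x ∷ xs} h = cong₂ _+_ (h (here refl)) (sum-cong (h ∘ there))

  sum-+ : ∀ (f g : ℕ → ℕ) xs → sum (map (λ x → f x + g x) xs) ≡ sum (map f xs) + sum (map g xs)
  sum-+ f g []       = refl
  sum-+ f g (x ∷ xs) = trans (cong (f x + g x +_) (sum-+ f g xs)) (interchange (f x) (g x) _ _)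
    where
    interchange : ∀ a b c d → a + b + (c + d) ≡ a + c + (b + d)
    interchange = solve-∀

  sum-const : ∀ c (xs : List ℕ) → sum (map (λ _ → c) xs) ≡ length xs * c
  sum-const c []       = refl
  sum-const c (x ∷ xs) = cong (c +_) (sum-const c xs)

  sum-* : ∀ c xs → sum (map (c *_) xs) ≡ c * sum xs
  sum-* c []       = sym (*-zeroʳ c)
  sum-* c (x ∷ xs) = trans (cong (c * x +_) (sum-* c xs)) (sym (*-distribˡ-+ c x (sum xs)))

  sum-map-++ : ∀ (f : ℕ → ℕ) xs ys → sum (map f (xs ++ ys)) ≡ sum (map f xs) + sum (map f ys)
  sum-map-++ f []       ys = refl
  sum-map-++ f (x ∷ xs) ys = trans (cong (f x +_) (sum-map-++ f xs ys)) (sym (+-assoc (f x) _ _))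

  sum-filter : ∀ {n a p} {A : Set a} {P : A → Set p} (P? : Decidable P) (h : A → ℕ) (f : Fin n → A) →
               sum (map h (filter P? (tabulate f))) ≡ ∑ λ j → ⟦ P? (f j) ⟧ * h (f j)
  sum-filter {ℕ.zero}  P? h f = sym (∑-[] _)
  sum-filter {ℕ.suc n} P? h f with P? (f Fin.zero) in eq
  ... | yes _ = trans (cong₂ _+_ (sym (+-identityʳ (h (f Fin.zero)))) (sum-filter P? h (f ∘ Fin.suc)))
                  (trans (cong (λ d → ⟦ d ⟧ * h (f Fin.zero) + ∑ (λ j → ⟦ P? (f (Fin.suc j)) ⟧ * h (f (Fin.suc j)))) (sym eq)) (sym (∑-suc _)))
  ... | no _  = trans (sum-filter P? h (f ∘ Fin.suc))
                  (trans (cong (λ d → ⟦ d ⟧ * h (f Fin.zero) + ∑ (λ j → ⟦ P? (f (Fin.suc j)) ⟧ * h (f (Fin.suc j)))) (sym eq)) (sym (∑-suc _)))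

  unique-⊆-length : ∀ {xs ys : List ℕ} → Unique xs → (∀ {x} → x ∈ xs → x ∈ ys) → length xs ≤ length ys
  unique-⊆-length {[]}     uniq sub = z≤n
  unique-⊆-length {x ∷ xs} {ys} (x∉ ∷ uniq) sub = ≤-trans
    (s≤s (unique-⊆-length uniq λ y∈ → ∈-∖⁺ (sub (there y∈)) (All.lookup x∉ y∈ ∘ sym)))
    (filter-notAll (λ y → ¬? (y ≟ x)) ys (lose (sub (here refl)) λ x≢x → x≢x refl))

  take>drop : ∀ n {xs : List ℕ} → AllPairs _>_ xs → ∀ {u v} → u ∈ take n xs → v ∈ drop n xs → v < u
  take>drop (ℕ.suc n) {x ∷ xs} (x> ∷ dec) (here refl) v∈ = All.lookup x> (drop⊆ n v∈)
    where
    drop⊆ : ∀ n {ys : List ℕ} {v} → v ∈ drop n ys → v ∈ ys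
    drop⊆ ℕ.zero    v∈ = v∈
    drop⊆ (ℕ.suc n) {y ∷ ys} v∈ = there (drop⊆ n v∈)
  take>drop (ℕ.suc n) {x ∷ xs} (x> ∷ dec) (there u∈) v∈ = take>drop n dec u∈ v∈

-- Classes of beads and their consecutive pairs.

module BeadConfiguration (t r : ℕ) .{{_ : ℕ.NonZero t}}
  (lam : Data.Vec.Functional.Vector ℕ (t ℕ.+ r ℕ.* 2))
  (isPartition : Defs.IsPartition lam)
  (n≥1 : ∀ i → 1 ℕ.≤ Defs.Beads.n t r lam i) where
  open import Defs using (module Beads; IsStable; IsMin; IsMax; kthLargest)
  open Beads t r lam
  open ConsecutivePairs
  open Counting
  open Distance
  open FiniteMinimum using (minimizer)
  open KthLargest
  open ListSums
  open UniqueLists using (unique-map)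
  open import Data.Fin.Base as Fin using (toℕ; zero; suc)
  open import Data.Fin.Properties as Fin using (opposite-prop; toℕ<n; toℕ-injective; toℕ-fromℕ<)
  open import Data.Fin.Subset using (Subset; ∣_∣; _∩_; _─_) renaming (_∈_ to _∈ˢ_)
  open import Data.Fin.Subset.Properties using (_∈?_; x∈p∩q⁺; x∈p∩q⁻; x∈p∧x∉q⇒x∈p─q; ⊆-antisym)
  open import Data.Integer.Base as ℤ using (ℤ)
  import Data.Integer.Properties as ℤ
  open import Data.Integer.Tactic.RingSolver using () renaming (solve-∀ to ℤ-solve-∀)
  open import Data.List.Base using (List; []; _∷_; _++_; map; length; filter; take; drop; allFin; concatMap)
  open import Data.List.Membership.DecPropositional Data.Nat.Properties._≟_ using () renaming (_∈?_ to _∈ᴸ?_)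
  open import Data.List.Membership.Propositional using (_∈_; find; lose)
  open import Data.List.Membership.Propositional.Properties
    using (∈-map⁺; ∈-map⁻; ∈-filter⁺; ∈-filter⁻; ∈-allFin; ∈-concatMap⁺; ∈-concatMap⁻; ∈-++⁺ˡ; ∈-++⁺ʳ)
  open import Data.List.Properties
    using (length-map; length-++; length-take; length-drop; map-∘; map-concatMap; concatMap-cong; take++drop≡id)
  open import Data.List.Relation.Unary.All as All using ([]; _∷_)
  import Data.List.Relation.Unary.All.Properties as All
  open import Data.List.Relation.Unary.AllPairs as AllPairs using ([]; _∷_)
  import Data.List.Relation.Unary.AllPairs.Properties as AllPairs
  open import Data.List.Relation.Unary.Any using (here; there)
  open import Data.List.Relation.Unary.Unique.Propositional using (Unique)
  import Data.List.Relation.Unary.Unique.Propositional.Properties as Unique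
  open import Data.Maybe.Base using (just)
  open import Data.Nat.Base hiding (ℕ)
  open import Data.Nat.Divisibility using (_∣_; divides)
  open import Data.Nat.DivMod using (_/_; _%_; m≡m%n+[m/n]*n; m%n<n)
  open import Data.Nat.ListAction using (sum)
  open import Data.Nat.Properties
  open import Data.Nat.Tactic.RingSolver using (solve-∀)
  open import Data.Product.Base using (∃; ∃₂; _×_; _,_; proj₁; proj₂; uncurry)
  open import Data.Sum.Base as Sum using (_⊎_; inj₁; inj₂)
  import Data.Vec.Base as Vec
  open import Function.Base using (_∘_)
  open import Function.Bundles using (_⇔_; mk⇔; Equivalence)
  open import Relation.Binary.Definitions using (Tri; tri<; tri≈; tri>)
  open import Relation.Binary.PropositionalEquality
  open import Relation.Nullary.Decidable.Core using (Dec; does; yes; no; ¬?; _×-dec_; _⊎-dec_; decidable-stable)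
  open import Relation.Nullary.Negation.Core using (¬_; contradiction)
  open import Relation.Unary using (Decidable)

  β-decreasing : ∀ {j k} → j Fin.< k → β k < β j
  β-decreasing {j} {k} j<k = +-mono-≤-< (isPartition (<⇒≤ j<k))
    (subst₂ _<_ (sym (opposite-prop k)) (sym (opposite-prop j)) (∸-monoʳ-< (s≤s j<k) (toℕ<n k)))

  β-injective : ∀ {j k} → β j ≡ β k → j ≡ k
  β-injective {j} {k} eq with Fin.<-cmp j k
  ... | tri< j<k _ _ = contradiction (sym eq) (<⇒≢ (β-decreasing j<k))
  ... | tri≈ _ j≡k _ = j≡k
  ... | tri> _ _ k<j = contradiction eq (<⇒≢ (β-decreasing k<j))

  values-decreasing : ∀ P → Decreasing (values P)
  values-decreasing P = AllPairs.map⁺ (AllPairs.filter⁺ (_∈? P) (AllPairs.tabulate⁺-< β-decreasing))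

  ∈-values⁺ : ∀ {P j} → j ∈ˢ P → β j ∈ values P
  ∈-values⁺ {P} {j} j∈P = ∈-map⁺ β (∈-filter⁺ (_∈? P) (∈-allFin j) j∈P)

  ∈-values⁻ : ∀ {P x} → x ∈ values P → ∃ λ j → j ∈ˢ P × x ≡ β j
  ∈-values⁻ {P} x∈ with ∈-map⁻ β x∈
  ... | j , j∈ , x≡ = j , proj₂ (∈-filter⁻ (_∈? P) {xs = allFin N} j∈) , x≡

  length-values : ∀ P → length (values P) ≡ ∑ λ j → ⟦ j ∈? P ⟧
  length-values P = trans (length-map β (filter (_∈? P) (allFin N))) (length-filter (_∈? P) (λ j → j))

  ∈-class⁺ : ∀ {i j} → residue j ≡ i → j ∈ˢ class i
  ∈-class⁺ {i} = ∈-tabulate⁺ (λ j → residue j Fin.≟ i)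

  ∈-class⁻ : ∀ {i j} → j ∈ˢ class i → residue j ≡ i
  ∈-class⁻ {i} = ∈-tabulate⁻ (λ j → residue j Fin.≟ i)

  ∈-ℰ⁺ : ∀ {i} → 2 ≤ n i → i ∈ˢ ℰ
  ∈-ℰ⁺ = ∈-tabulate⁺ (λ i → 2 ≤? n i)

  ∈-ℰ⁻ : ∀ {i} → i ∈ˢ ℰ → 2 ≤ n i
  ∈-ℰ⁻ = ∈-tabulate⁻ (λ i → 2 ≤? n i)

  ∈-𝒮⁺ : ∀ {j} → residue j ∈ˢ ℰ → j ∈ˢ 𝒮
  ∈-𝒮⁺ = ∈-tabulate⁺ (λ j → residue j ∈? ℰ)

  ∈-𝒮⁻ : ∀ {j} → j ∈ˢ 𝒮 → residue j ∈ˢ ℰ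
  ∈-𝒮⁻ = ∈-tabulate⁻ (λ j → residue j ∈? ℰ)

  classmates⇒ℰ : ∀ {j k} → j ≢ k → residue j ≡ residue k → residue j ∈ˢ ℰ
  classmates⇒ℰ {j} {k} j≢k eq = ∈-ℰ⁺ (∣∣≥2 (class (residue j)) j≢k (∈-class⁺ refl) (∈-class⁺ (sym eq)))

  inhabited : ∀ i → ∃ λ j → residue j ≡ i
  inhabited i with ∣∣≥1⇒∃ (class i) (n≥1 i)
  ... | j , j∈ = j , ∈-class⁻ j∈

  classValues : Fin t → List ℕ
  classValues i = values (𝒮 ∩ class i)

  ∈-classValues⁺ : ∀ {j} → residue j ∈ˢ ℰ → β j ∈ classValues (residue j)
  ∈-classValues⁺ {j} rj∈ℰ = ∈-values⁺ (x∈p∩q⁺ (∈-𝒮⁺ rj∈ℰ , ∈-class⁺ refl))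

  𝒫 : List (ℕ × ℕ)
  𝒫 = concatMap (pairs ∘ classValues) (filter (_∈? ℰ) (allFin t))

  Δs≡ : Δs ≡ map (uncurry _+_) 𝒫
  Δs≡ = trans (concatMap-cong (consecutiveSums≡ ∘ classValues) (filter (_∈? ℰ) (allFin t)))
              (sym (map-concatMap (uncurry _+_) (pairs ∘ classValues) (filter (_∈? ℰ) (allFin t))))

  ∈-𝒫⁺ : ∀ {i q} → i ∈ˢ ℰ → q ∈ pairs (classValues i) → q ∈ 𝒫
  ∈-𝒫⁺ {i} i∈ℰ q∈ = ∈-concatMap⁺ (pairs ∘ classValues) (lose (∈-filter⁺ (_∈? ℰ) (∈-allFin i) i∈ℰ) q∈)

  ∈-𝒫⁻ : ∀ {q} → q ∈ 𝒫 → ∃ λ i → i ∈ˢ ℰ × q ∈ pairs (classValues i)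
  ∈-𝒫⁻ q∈ with find (∈-concatMap⁻ (pairs ∘ classValues) {xs = filter (_∈? ℰ) (allFin t)} q∈)
  ... | i , i∈ , q∈i = i , proj₂ (∈-filter⁻ (_∈? ℰ) {xs = allFin t} i∈) , q∈i

  record Consecutive (x y : ℕ) : Set where
    field
      hi lo : Fin N
      x≡    : x ≡ β hi
      y≡    : y ≡ β lo
      mates : residue hi ≡ residue lo
      ∈ℰ    : residue hi ∈ˢ ℰ
      y<x   : y < x
      between : ∀ l → residue l ≡ residue hi → x ≤ β l ⊎ β l ≤ y

  sound : ∀ {x y} → (x , y) ∈ 𝒫 → Consecutive x y
  sound {x} {y} q∈ = fromClass (∈-𝒫⁻ q∈)
    where
    fromClass : (∃ λ i → i ∈ˢ ℰ × (x , y) ∈ pairs (classValues i)) → Consecutive x y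
    fromClass (i , i∈ℰ , q∈i) = record
      { hi = hi ; lo = lo ; x≡ = proj₂ (proj₂ x∈) ; y≡ = proj₂ (proj₂ y∈)
      ; mates = trans (residue≡ x∈) (sym (residue≡ y∈))
      ; ∈ℰ = subst (_∈ˢ ℰ) (sym (residue≡ x∈)) i∈ℰ
      ; y<x = proj₁ (proj₂ (proj₂ facts))
      ; between = λ l same → proj₂ (proj₂ (proj₂ facts)) (subst (λ i → β l ∈ classValues i)
          (trans same (residue≡ x∈)) (∈-classValues⁺ (subst (_∈ˢ ℰ) (sym (trans same (residue≡ x∈))) i∈ℰ)))
      }
      where
      facts = pairs-sound (values-decreasing (𝒮 ∩ class i)) q∈i
      residue≡ : ∀ {z} (z∈ : ∃ λ l → l ∈ˢ 𝒮 ∩ class i × z ≡ β l) → residue (proj₁ z∈) ≡ i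
      residue≡ (l , l∈ , _) = ∈-class⁻ (proj₂ (x∈p∩q⁻ 𝒮 (class i) l∈))
      x∈ : ∃ λ l → l ∈ˢ 𝒮 ∩ class i × x ≡ β l
      x∈ = ∈-values⁻ {𝒮 ∩ class i} (proj₁ facts)
      y∈ : ∃ λ l → l ∈ˢ 𝒮 ∩ class i × y ≡ β l
      y∈ = ∈-values⁻ {𝒮 ∩ class i} (proj₁ (proj₂ facts))
      hi lo : Fin N
      hi = proj₁ x∈
      lo = proj₁ y∈

  lower : ∀ j k → residue j ≡ residue k → β k < β j → ∃ λ y → (β j , y) ∈ 𝒫 × β k ≤ y
  lower j k rj≡rk k<j with pairs-lower (values-decreasing (𝒮 ∩ class (residue j)))
      (∈-classValues⁺ j∈ℰ) (subst (λ i → β k ∈ classValues i) (sym rj≡rk) (∈-classValues⁺ (subst (_∈ˢ ℰ) rj≡rk j∈ℰ))) k<j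
    where j∈ℰ = classmates⇒ℰ (λ { refl → <-irrefl refl k<j }) rj≡rk
  ... | y , q∈ , k≤y = y , ∈-𝒫⁺ (classmates⇒ℰ (λ { refl → <-irrefl refl k<j }) rj≡rk) q∈ , k≤y

  upper : ∀ j k → residue j ≡ residue k → β k < β j → ∃ λ x → (x , β k) ∈ 𝒫 × x ≤ β j
  upper j k rj≡rk k<j with pairs-upper (values-decreasing (𝒮 ∩ class (residue j)))
      (∈-classValues⁺ j∈ℰ) (subst (λ i → β k ∈ classValues i) (sym rj≡rk) (∈-classValues⁺ (subst (_∈ˢ ℰ) rj≡rk j∈ℰ))) k<j
    where j∈ℰ = classmates⇒ℰ (λ { refl → <-irrefl refl k<j }) rj≡rk
  ... | x , q∈ , x≤j = x , ∈-𝒫⁺ (classmates⇒ℰ (λ { refl → <-irrefl refl k<j }) rj≡rk) q∈ , x≤j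

  private
    y≤y′ : ∀ {x y y′} → Consecutive x y → Consecutive x y′ → y ≤ y′
    y≤y′ {x} {y} {y′} p p′ = below (P′.between P.lo (trans (sym P.mates) (cong residue (β-injective (trans (sym P.x≡) P′.x≡)))))
      where
      module P = Consecutive p
      module P′ = Consecutive p′
      below : x ≤ β P.lo ⊎ β P.lo ≤ y′ → y ≤ y′
      below (inj₁ x≤y) = contradiction P.y<x (≤⇒≯ (≤-trans x≤y (≤-reflexive (sym P.y≡))))
      below (inj₂ y≤y′) = ≤-trans (≤-reflexive P.y≡) y≤y′

    x≤x′ : ∀ {x x′ y} → Consecutive x y → Consecutive x′ y → x ≤ x′
    x≤x′ {x} {x′} {y} p p′ = above (P.between P′.hi (trans P′.mates (trans (cong residue (β-injective (trans (sym P′.y≡) P.y≡))) (sym P.mates))))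
      where
      module P = Consecutive p
      module P′ = Consecutive p′
      above : x ≤ β P′.hi ⊎ β P′.hi ≤ y → x ≤ x′
      above (inj₁ x≤x′) = ≤-trans x≤x′ (≤-reflexive (sym P′.x≡))
      above (inj₂ x′≤y) = contradiction P′.y<x (≤⇒≯ (≤-trans (≤-reflexive P′.x≡) x′≤y))

  functional⁺ : ∀ {x y y′} → (x , y) ∈ 𝒫 → (x , y′) ∈ 𝒫 → y ≡ y′
  functional⁺ q∈ q′∈ = ≤-antisym (y≤y′ (sound q∈) (sound q′∈)) (y≤y′ (sound q′∈) (sound q∈))

  functional⁻ : ∀ {x x′ y} → (x , y) ∈ 𝒫 → (x′ , y) ∈ 𝒫 → x ≡ x′
  functional⁻ q∈ q′∈ = ≤-antisym (x≤x′ (sound q∈) (sound q′∈)) (x≤x′ (sound q′∈) (sound q∈))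

  𝒫-unique : Unique 𝒫
  𝒫-unique = Unique.concat⁺
    (All.map⁺ (All.tabulate λ {i} _ → pairs-unique (values-decreasing (𝒮 ∩ class i))))
    (AllPairs.map⁺ (AllPairs.map disjoint (Unique.filter⁺ (_∈? ℰ) (Unique.allFin⁺ t))))
    where
    classOf : ∀ {i x y} → (x , y) ∈ pairs (classValues i) → ∃ λ j → x ≡ β j × residue j ≡ i
    classOf {i} q∈ with ∈-values⁻ {𝒮 ∩ class i} (proj₁ (pairs-sound (values-decreasing (𝒮 ∩ class i)) q∈))
    ... | j , j∈ , eq = j , eq , ∈-class⁻ (proj₂ (x∈p∩q⁻ 𝒮 (class i) j∈))
    disjoint : ∀ {i i′} → i ≢ i′ → ∀ {q} → ¬ (q ∈ pairs (classValues i) × q ∈ pairs (classValues i′))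
    disjoint i≢i′ (q∈ , q∈′) with classOf q∈ | classOf q∈′
    ... | j , refl , refl | j′ , eq , refl = i≢i′ (cong residue (β-injective eq))

  ∑-class : ∀ j → ∑ (λ i → ⟦ residue j Fin.≟ i ⟧) ≡ 1
  ∑-class j = trans (∑-single (residue j) λ i i≢ → ⟦⟧-no (residue j Fin.≟ i) (i≢ ∘ sym))
                    (⟦⟧-yes (residue j Fin.≟ residue j) refl)

  n≡∑ : ∀ i → n i ≡ ∑ λ j → ⟦ residue j Fin.≟ i ⟧
  n≡∑ i = trans (∣∣≡∑ (class i)) (∑-cong λ j → ⟦⟧-⇔ (j ∈? class i) (residue j Fin.≟ i) ∈-class⁻ ∈-class⁺)

  ∑n≡N : ∑ n ≡ N
  ∑n≡N = trans (∑-cong n≡∑) (trans (∑-comm _) (trans (∑-cong ∑-class) ∑-one))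

  -- A class with `n i` elements yields `n i` - 1 pairs, none if it has a single element. One more
  -- per class makes the total N = t + 2r.
  length-𝒫 : length 𝒫 ≡ r * 2
  length-𝒫 = +-cancelˡ-≡ t _ _ (begin
    t + length 𝒫
      ≡⟨ cong₂ _+_ (sym ∑-one) (length-concatMap-filter (_∈? ℰ) (pairs ∘ classValues) (λ i → i)) ⟩
    ∑ (λ _ → 1) + ∑ (λ i → ⟦ i ∈? ℰ ⟧ * length (pairs (classValues i)))
      ≡⟨ ∑-+ _ _ ⟨
    ∑ (λ i → 1 + ⟦ i ∈? ℰ ⟧ * length (pairs (classValues i)))
      ≡⟨ ∑-cong size ⟩
    ∑ n
      ≡⟨ ∑n≡N ⟩
    N ∎)
    where
    open ≡-Reasoning
    |class| : ∀ i → i ∈ˢ ℰ → length (classValues i) ≡ n i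
    |class| i i∈ℰ = trans (length-values (𝒮 ∩ class i)) (sym (trans (n≡∑ i) (∑-cong λ j →
      ⟦⟧-⇔ (residue j Fin.≟ i) (j ∈? 𝒮 ∩ class i)
        (λ { refl → x∈p∩q⁺ (∈-𝒮⁺ i∈ℰ , ∈-class⁺ refl) })
        (λ j∈ → ∈-class⁻ (proj₂ (x∈p∩q⁻ 𝒮 (class i) j∈))))))
    size : ∀ i → 1 + ⟦ i ∈? ℰ ⟧ * length (pairs (classValues i)) ≡ n i
    size i = by (i ∈? ℰ)
      where
      by : (d : Dec (i ∈ˢ ℰ)) → 1 + ⟦ d ⟧ * length (pairs (classValues i)) ≡ n i
      by (yes i∈ℰ) = trans (cong ℕ.suc (trans (+-identityʳ _) (trans (length-pairs (classValues i)) (cong pred (|class| i i∈ℰ)))))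
                      (suc-pred (n i) {{>-nonZero (n≥1 i)}})
      by (no i∉ℰ)  = ≤-antisym (n≥1 i) (s≤s⁻¹ (≰⇒> (i∉ℰ ∘ ∈-ℰ⁺)))

  length-Δs : length Δs ≡ r * 2
  length-Δs = trans (cong length Δs≡) (trans (length-map (uncurry _+_) 𝒫) length-𝒫)

  open TiePairs β residue 𝒫

  record Structure (s r′ : ℕ) : Set where
    field
      r≡1+r′        : r ≡ suc r′
      configuration : Configuration s r′
    open Configuration configuration public
    field
      complement⁺ : ∀ {u} → u ∈ us → ∃ λ l → l ∈ ls × u + l ≡ s
      complement⁻ : ∀ {l} → l ∈ ls → ∃ λ u → u ∈ us × u + l ≡ s

  mkTie : ∀ {s x y} → (x , y) ∈ 𝒫 → x + y ≡ s → ∃ λ (T : Tie s) → (x , y) ≡ (β (Tie.j T) , β (Tie.k T))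
  mkTie {s} {x} {y} q∈ sum≡s = tie , cong₂ _,_ x≡ y≡
    where
    open Consecutive (sound q∈)
    tie : Tie s
    tie = record
      { j = hi ; k = lo ; j+k≡s = trans (cong₂ _+_ (sym x≡) (sym y≡)) sum≡s
      ; k<j = subst₂ _<_ y≡ x≡ y<x ; mate = mates
      ; j∈ = subst₂ (λ x y → (x , y) ∈ 𝒫) x≡ y≡ q∈
      ; gap = λ l same → subst₂ (λ x y → x ≤ β l ⊎ β l ≤ y) x≡ y≡ (between l same) }

  private
    crossing : ∀ {s} (T T′ : Tie s) → β (Tie.j T) < β (Tie.j T′) → residue (Tie.j T) ≡ residue (Tie.j T′) →
               β (Tie.j T) + β (Tie.k T) < β (Tie.j T′) + β (Tie.k T′)
    crossing T T′ j<j′ same with Tie.gap T′ (Tie.j T) same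
    ... | inj₁ j′≤j = contradiction j<j′ (≤⇒≯ j′≤j)
    ... | inj₂ j≤k′ = +-mono-< j<j′ (<-≤-trans (Tie.k<j T) j≤k′)

  -- Along a class the sums of consecutive elements strictly decrease, so no two of them equal `s`.
  tie-class : ∀ {s} (T T′ : Tie s) → residue (Tie.j T) ≡ residue (Tie.j T′) →
              β (Tie.j T) ≡ β (Tie.j T′) × β (Tie.k T) ≡ β (Tie.k T′)
  tie-class T T′ same with <-cmp (β (Tie.j T)) (β (Tie.j T′))
  ... | tri≈ _ e _ = e , +-cancelˡ-≡ (β (Tie.j T)) _ _
        (trans (Tie.j+k≡s T) (trans (sym (Tie.j+k≡s T′)) (cong (_+ β (Tie.k T′)) (sym e))))
  ... | tri< j<j′ _ _ = contradiction (trans (Tie.j+k≡s T) (sym (Tie.j+k≡s T′))) (<⇒≢ (crossing T T′ j<j′ same))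
  ... | tri> _ _ j′<j = contradiction (trans (Tie.j+k≡s T′) (sym (Tie.j+k≡s T))) (<⇒≢ (crossing T′ T j′<j (sym same)))

  tie-not-above : ∀ {s} (T : Tie s) {y} → (β (Tie.j T) , y) ∈ 𝒫 → ¬ s < β (Tie.j T) + y
  tie-not-above {s} T q∈ s< = <-irrefl (sym (Tie.j+k≡s T))
    (subst (λ y → s < β (Tie.j T) + y) (functional⁺ q∈ (Tie.j∈ T)) s<)

  tie-not-below : ∀ {s} (T : Tie s) {x} → (x , β (Tie.k T)) ∈ 𝒫 → ¬ x + β (Tie.k T) < s
  tie-not-below {s} T q∈ <s = <-irrefl (Tie.j+k≡s T)
    (subst (λ x → x + β (Tie.k T) < s) (functional⁻ q∈ (Tie.j∈ T)) <s)

  first-determines : ∀ {q q′} → q ∈ 𝒫 → q′ ∈ 𝒫 → proj₁ q ≡ proj₁ q′ → q ≡ q′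
  first-determines q∈ q′∈ refl = cong (_ ,_) (functional⁺ q∈ q′∈)

  second-determines : ∀ {q q′} → q ∈ 𝒫 → q′ ∈ 𝒫 → proj₂ q ≡ proj₂ q′ → q ≡ q′
  second-determines q∈ q′∈ refl = cong (_, _) (functional⁻ q∈ q′∈)

  -- Residues with equal doubles modulo `t`.

  ρ : Fin N → ℕ
  ρ j = β j % t

  residue≡⇔ : ∀ {j k} → ρ j ≡ ρ k → residue j ≡ residue k
  residue≡⇔ {j} {k} e = toℕ-injective (trans (toℕ-fromℕ< (m%n<n (β j) t)) (trans e (sym (toℕ-fromℕ< (m%n<n (β k) t)))))

  tie-residue : ∀ {s} (T : Tie s) → ∃ λ m → s ≡ 2 * ρ (Tie.j T) + t * m
  tie-residue {s} T = β j / t + β k / t , (begin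
    s                                           ≡⟨ j+k≡s ⟨
    β j + β k                                   ≡⟨ cong₂ _+_ (m≡m%n+[m/n]*n (β j) t) (m≡m%n+[m/n]*n (β k) t) ⟩
    ρ j + β j / t * t + (ρ k + β k / t * t)     ≡⟨ cong (λ x → ρ j + β j / t * t + (x + β k / t * t)) ρk≡ρj ⟩
    ρ j + β j / t * t + (ρ j + β k / t * t)     ≡⟨ collect (ρ j) (β j / t) (β k / t) t ⟩
    2 * ρ j + t * (β j / t + β k / t)           ∎)
    where
    open ≡-Reasoning
    open Tie T
    ρk≡ρj : ρ k ≡ ρ j
    ρk≡ρj = trans (sym (toℕ-fromℕ< (m%n<n (β k) t))) (trans (cong toℕ (sym mate)) (toℕ-fromℕ< (m%n<n (β j) t)))
    collect : ∀ a p q t → a + p * t + (a + q * t) ≡ 2 * a + t * (p + q)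
    collect = solve-∀

  -- Two residues a ≠ b with 2a ≡ 2b modulo t differ by t / 2.
  HalfTurn : ℕ → ℕ → Set
  HalfTurn a b = 2 * b ≡ 2 * a + t ⊎ 2 * a ≡ 2 * b + t

  -- The number 2 (b - a) lies strictly between 0 and 2t and is a multiple of `t`, which leaves only
  -- `t` itself.
  halfTurn< : ∀ {a b m m′} → a < b → b < t → 2 * a + t * m ≡ 2 * b + t * m′ → 2 * b ≡ 2 * a + t
  halfTurn< {a} {b} {m} {m′} a<b b<t eq with <-cmp m (suc m′)
  ... | tri< m≤m′ _ _ = contradiction eq (<⇒≢ (+-mono-<-≤ (*-monoʳ-< 2 a<b) (*-monoʳ-≤ t (s≤s⁻¹ m≤m′))))
  ... | tri≈ _ refl _ = sym (+-cancelʳ-≡ (t * m′) _ _ (trans (trans (+-assoc (2 * a) t _) (cong (2 * a +_) (sym (*-suc t m′)))) eq))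
  ... | tri> _ _ 1+m′<m = contradiction (sym eq) (<⇒≢ (begin-strict
    2 * b + t * m′             <⟨ +-monoˡ-< (t * m′) (*-monoʳ-< 2 b<t) ⟩
    2 * t + t * m′             ≡⟨ expand t m′ ⟩
    t * suc (suc m′)           ≤⟨ *-monoʳ-≤ t 1+m′<m ⟩
    t * m                      ≤⟨ m≤n+m (t * m) (2 * a) ⟩
    2 * a + t * m              ∎))
    where
    open ≤-Reasoning
    expand : ∀ t m → 2 * t + t * m ≡ t * suc (suc m)
    expand t m = trans (lemma t m) (sym (trans (*-suc t (suc m)) (cong (t +_) (*-suc t m))))
      where
      lemma : ∀ t m → 2 * t + t * m ≡ t + (t + t * m)
      lemma = solve-∀

  halfTurn : ∀ {a b m m′} → a < t → b < t → a ≢ b → 2 * a + t * m ≡ 2 * b + t * m′ → HalfTurn a b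
  halfTurn {a} {b} {m} {m′} a<t b<t a≢b eq with <-cmp a b
  ... | tri< a<b _ _ = inj₁ (halfTurn< {m = m} {m′} a<b b<t eq)
  ... | tri≈ _ a≡b _ = contradiction a≡b a≢b
  ... | tri> _ _ b<a = inj₂ (halfTurn< {m = m′} {m} b<a a<t (sym eq))

  private
    full-turn : ∀ {a b c} → 2 * b ≡ 2 * a + t → 2 * a ≡ 2 * c + t → 2 * b ≡ 2 * c + 2 * t
    full-turn {c = c} p q = trans p (trans (cong (_+ t) q)
      (trans (+-assoc (2 * c) t t) (cong (λ x → 2 * c + (t + x)) (sym (+-identityʳ t)))))

  -- In the mixed cases `b` and `c` would lie on opposite sides of `a` at distance `t` from each
  -- other, too far for two residues.
  halfTurn-unique : ∀ {a b c} → b < t → c < t → HalfTurn a b → HalfTurn a c → b ≡ c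
  halfTurn-unique b<t c<t (inj₁ p) (inj₁ q) = *-cancelˡ-≡ _ _ 2 (trans p (sym q))
  halfTurn-unique b<t c<t (inj₂ p) (inj₂ q) = *-cancelˡ-≡ _ _ 2 (+-cancelʳ-≡ t _ _ (trans (sym p) q))
  halfTurn-unique {a} {b} {c} b<t c<t (inj₁ p) (inj₂ q) = contradiction (full-turn {a} {b} {c} p q)
    (<⇒≢ (<-≤-trans (*-monoʳ-< 2 b<t) (m≤n+m (2 * t) (2 * c))))
  halfTurn-unique {a} {b} {c} b<t c<t (inj₂ p) (inj₁ q) = contradiction (full-turn {a} {c} {b} q p)
    (<⇒≢ (<-≤-trans (*-monoʳ-< 2 c<t) (m≤n+m (2 * t) (2 * b))))

  halfTurn⇒even : ∀ {a b} → HalfTurn a b → 2 ∣ t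
  halfTurn⇒even {a} {b} (inj₁ p) = divides (b ∸ a) (trans (sym (trans (cong (_∸ 2 * a) p) (m+n∸m≡n (2 * a) t)))
    (trans (sym (*-distribˡ-∸ 2 b a)) (*-comm 2 (b ∸ a))))
  halfTurn⇒even {a} {b} (inj₂ p) = divides (a ∸ b) (trans (sym (trans (cong (_∸ 2 * b) p) (m+n∸m≡n (2 * b) t)))
    (trans (sym (*-distribˡ-∸ 2 a b)) (*-comm 2 (a ∸ b))))

  ties-halfTurn : ∀ {s} (T T′ : Tie s) → residue (Tie.j T) ≢ residue (Tie.j T′) → HalfTurn (ρ (Tie.j T)) (ρ (Tie.j T′))
  ties-halfTurn T T′ ne with tie-residue T | tie-residue T′
  ... | m , eq | m′ , eq′ = halfTurn {m = m} {m′} (m%n<n (β (Tie.j T)) t) (m%n<n (β (Tie.j T′)) t)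
    (ne ∘ residue≡⇔) (trans (sym eq) eq′)

  even : ∀ {s r′} → Structure s r′ → 2 ∣ t
  even st = halfTurn⇒even {ρ (Tie.j tie₁)} {ρ (Tie.j tie₂)} (ties-halfTurn tie₁ tie₂ distinct)
    where open Structure st

  -- The choices of maximal degree.

  module Optimum (s r′ : ℕ) (structure : Structure s r′) where
    open Structure structure
    open Tie

    -- Twice the distance from s/2, the term of an element in the upper bound for twice the degree.
    d : ℕ → ℕ
    d u = ∣ 2 * u - s ∣

    private
      double : ∀ x y → 2 * x + 2 * y ≡ (x + y) + (x + y)
      double = solve-∀

    d-above : ∀ {x y} → y < x → s < x + y → d y < d x
    d-above {x} {y} y<x s< with ≤-total s (2 * y)
    ... | inj₁ s≤2y = ∣-∣-far₁ s≤2y (*-monoʳ-< 2 y<x)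
    ... | inj₂ 2y≤s = ∣-∣-far₄ 2y≤s (subst (s + s <_) (trans (sym (double x y)) (+-comm (2 * x) _)) (+-mono-< s< s<))

    d-below : ∀ {x y} → y < x → x + y < s → d x < d y
    d-below {x} {y} y<x <s with ≤-total s (2 * x)
    ... | inj₁ s≤2x = ∣-∣-far₃ s≤2x (subst (_< s + s) (sym (double x y)) (+-mono-< <s <s))
    ... | inj₂ 2x≤s = ∣-∣-far₂ 2x≤s (*-monoʳ-< 2 y<x)

    d-tie : ∀ {x y} → x + y ≡ s → d x ≡ d y
    d-tie {x} {y} e = begin
      ∣ 2 * x - s ∣                     ≡⟨ ∣m+n-m+o∣≡∣n-o∣ (2 * y) (2 * x) s ⟨
      ∣ 2 * y + 2 * x - 2 * y + s ∣     ≡⟨ cong₂ ∣_-_∣ (trans (+-comm (2 * y) _) (trans (double x y) (cong₂ _+_ e e))) (+-comm (2 * y) s) ⟩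
      ∣ s + s - s + 2 * y ∣             ≡⟨ ∣m+n-m+o∣≡∣n-o∣ s s (2 * y) ⟩
      ∣ s - 2 * y ∣                     ≡⟨ ∣-∣-comm s (2 * y) ⟩
      ∣ 2 * y - s ∣                     ∎
      where open ≡-Reasoning

    d-above-≤ : ∀ {x y} → y < x → s ≤ x + y → d y ≤ d x
    d-above-≤ {x} {y} y<x s≤ with m≤n⇒m<n∨m≡n s≤
    ... | inj₁ s< = <⇒≤ (d-above {x} {y} y<x s<)
    ... | inj₂ s≡ = ≤-reflexive (sym (d-tie {x} {y} (sym s≡)))

    d-below-≤ : ∀ {x y} → y < x → x + y ≤ s → d x ≤ d y
    d-below-≤ {x} {y} y<x ≤s with m≤n⇒m<n∨m≡n ≤s
    ... | inj₁ <s = <⇒≤ (d-below {x} {y} y<x <s)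
    ... | inj₂ ≡s = ≤-reflexive (d-tie {x} {y} ≡s)

    2j>s : (T : Tie s) → s < 2 * β (j T)
    2j>s T = subst₂ _<_ (j+k≡s T) (cong (β (j T) +_) (sym (+-identityʳ _))) (+-monoʳ-< (β (j T)) (k<j T))

    2k<s : (T : Tie s) → 2 * β (k T) < s
    2k<s T = subst₂ _<_ (cong (β (k T) +_) (sym (+-identityʳ _))) (j+k≡s T) (+-monoˡ-< (β (k T)) (k<j T))

    private
      upper-pair : ∀ {u} (u∈ : u ∈ us) → Consecutive u (proj₁ (us-sound u∈))
      upper-pair u∈ = sound (proj₁ (proj₂ (us-sound u∈)))

      lower-pair : ∀ {u} (u∈ : u ∈ ls) → Consecutive (proj₁ (ls-sound u∈)) u
      lower-pair u∈ = sound (proj₁ (proj₂ (ls-sound u∈)))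

    us-above : ∀ {u} → u ∈ us → s < 2 * u
    us-above {u} u∈ = <-trans (proj₂ (proj₂ (us-sound u∈)))
      (<-≤-trans (+-monoʳ-< u (Consecutive.y<x (upper-pair u∈))) (≤-reflexive (cong (u +_) (sym (+-identityʳ u)))))

    ls-below : ∀ {u} → u ∈ ls → 2 * u < s
    ls-below {u} u∈ = <-trans
      (≤-<-trans (≤-reflexive (cong (u +_) (+-identityʳ u))) (+-monoˡ-< u (Consecutive.y<x (lower-pair u∈))))
      (proj₂ (proj₂ (ls-sound u∈)))

    us⊆𝒮 : ∀ {u} → u ∈ us → ∃ λ l → l ∈ˢ 𝒮 × u ≡ β l
    us⊆𝒮 u∈ = hi , ∈-𝒮⁺ ∈ℰ , x≡
      where open Consecutive (upper-pair u∈)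

    ls⊆𝒮 : ∀ {u} → u ∈ ls → ∃ λ l → l ∈ˢ 𝒮 × u ≡ β l
    ls⊆𝒮 u∈ = lo , ∈-𝒮⁺ (subst (_∈ˢ ℰ) mates ∈ℰ) , y≡
      where open Consecutive (lower-pair u∈)

    -- By `near-≤` and `minimal⇒near` these are the nearest elements of their class. The class of a
    -- tie has two of them, every other class in `ℰ` has one.
    record Near (l : Fin N) : Set where
      constructor near
      field
        ∈𝒮  : l ∈ˢ 𝒮
        ∉us : ¬ β l ∈ us
        ∉ls : ¬ β l ∈ ls

    near-tie-j : (T : Tie s) → Near (j T)
    near-tie-j T = near (∈-𝒮⁺ (classmates⇒ℰ (λ e → <⇒≢ (k<j T) (cong β (sym e))) (mate T))) (j∉us T)
      λ j∈ls → <-asym (2j>s T) (ls-below j∈ls)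

    near-tie-k : (T : Tie s) → Near (k T)
    near-tie-k T = near (∈-𝒮⁺ (subst (_∈ˢ ℰ) (mate T) (∈-𝒮⁻ (Near.∈𝒮 (near-tie-j T)))))
      (λ k∈us → <-asym (2k<s T) (us-above k∈us)) (k∉ls T)

    -- Being outside `ls` forces the sum with the next larger classmate up to at least `s`, and
    -- being outside `us` keeps the sum with the next smaller one at most `s`. All classmates on
    -- either side are then at least as far.
    near-≤ : ∀ {l} → Near l → ∀ l′ → residue l′ ≡ residue l → d (β l) ≤ d (β l′)
    near-≤ {l} nl l′ same = byOrder (<-cmp (β l) (β l′))
      where
      byOrder : Tri (β l < β l′) (β l ≡ β l′) (β l′ < β l) → d (β l) ≤ d (β l′)
      byOrder (tri≈ _ e _)    = ≤-reflexive (cong d e)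
      byOrder (tri< l<l′ _ _) = d-above-≤ {β l′} {β l} l<l′ (above (upper l′ l same l<l′))
        where
        above : (∃ λ x → (x , β l) ∈ 𝒫 × x ≤ β l′) → s ≤ β l′ + β l
        above (x , q∈ , x≤l′) = ≤-trans (≮⇒≥ (Near.∉ls nl ∘ cover⁻ q∈)) (+-monoˡ-≤ (β l) x≤l′)
      byOrder (tri> _ _ l′<l) = d-below-≤ {β l} {β l′} l′<l (below (lower l l′ (sym same) l′<l))
        where
        below : (∃ λ y → (β l , y) ∈ 𝒫 × β l′ ≤ y) → β l + β l′ ≤ s
        below (y , q∈ , l′≤y) = ≤-trans (+-monoʳ-≤ (β l) l′≤y) (≮⇒≥ (Near.∉us nl ∘ cover⁺ q∈))

    minimal⇒near : ∀ {l} → l ∈ˢ 𝒮 → (∀ l′ → residue l′ ≡ residue l → d (β l) ≤ d (β l′)) → Near l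
    minimal⇒near {l} l∈𝒮 min = near l∈𝒮 ∉us ∉ls
      where
      ∉us : ¬ β l ∈ us
      ∉us l∈us = <⇒≱ (subst (λ y → d y < d (β l)) y≡ (d-above y<x (proj₂ (proj₂ (us-sound l∈us)))))
        (min lo (trans (sym mates) (cong residue (sym (β-injective x≡)))))
        where open Consecutive (upper-pair l∈us)
      ∉ls : ¬ β l ∈ ls
      ∉ls l∈ls = <⇒≱ (subst (λ x → d x < d (β l)) x≡ (d-below y<x (proj₂ (proj₂ (ls-sound l∈ls)))))
        (min hi (trans mates (cong residue (sym (β-injective y≡)))))
        where open Consecutive (lower-pair l∈ls)

    IsTieOf : Tie s → Fin N → Fin N → Set
    IsTieOf T l l′ = l ≡ j T × l′ ≡ k T

    -- A squeeze: the sum of `l` with its next smaller classmate is at most `s`, while the sum with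
    -- `l′`, which is no larger, is at least `s`. So `l′` is that classmate and the pair is a tie.
    near-classmates : ∀ {l l′} → Near l → Near l′ → residue l ≡ residue l′ → β l′ < β l →
                      IsTieOf tie₁ l l′ ⊎ IsTieOf tie₂ l l′
    near-classmates {l} {l′} nl nl′ same l′<l = combine (lower l l′ same l′<l) (upper l l′ same l′<l)
      where
      combine : (∃ λ y → (β l , y) ∈ 𝒫 × β l′ ≤ y) → (∃ λ x → (x , β l′) ∈ 𝒫 × x ≤ β l) →
                IsTieOf tie₁ l l′ ⊎ IsTieOf tie₂ l l′
      combine (y , q∈ , l′≤y) (x , q′∈ , x≤l) = identify (cover⁼ q∈ l+y≡s)
        where
        l+y≤s : β l + y ≤ s
        l+y≤s = ≮⇒≥ (Near.∉us nl ∘ cover⁺ q∈)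
        s≤l+l′ : s ≤ β l + β l′
        s≤l+l′ = ≤-trans (≮⇒≥ (Near.∉ls nl′ ∘ cover⁻ q′∈)) (+-monoˡ-≤ (β l′) x≤l)
        l+y≡s : β l + y ≡ s
        l+y≡s = ≤-antisym l+y≤s (≤-trans s≤l+l′ (+-monoʳ-≤ (β l) l′≤y))
        l′≡y : β l′ ≡ y
        l′≡y = +-cancelˡ-≡ (β l) (β l′) y (≤-antisym (+-monoʳ-≤ (β l) l′≤y) (≤-trans (≤-reflexive l+y≡s) s≤l+l′))
        identify : (β l ≡ β (j tie₁) × y ≡ β (k tie₁)) ⊎ (β l ≡ β (j tie₂) × y ≡ β (k tie₂)) →
                   IsTieOf tie₁ l l′ ⊎ IsTieOf tie₂ l l′
        identify (inj₁ (e , e′)) = inj₁ (β-injective e , β-injective (trans l′≡y e′))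
        identify (inj₂ (e , e′)) = inj₂ (β-injective e , β-injective (trans l′≡y e′))

    -- The values left over by the choice that takes `j T` and `k T′`: the rejected ends of the two
    -- ties join `us` and `ls`.
    InT : Tie s → Tie s → ℕ → Set
    InT T T′ x = x ∈ β (j T′) ∷ us ⊎ x ∈ β (k T) ∷ ls

    inT? : ∀ T T′ x → Dec (InT T T′ x)
    inT? T T′ x = (x ∈ᴸ? β (j T′) ∷ us) ⊎-dec (x ∈ᴸ? β (k T) ∷ ls)

    -- The choice of the nearest element in every class, which is j in the class of T
    -- and k in the class of T′.
    choose : Tie s → Tie s → Subset N
    choose T T′ = Vec.tabulate λ l → does (l ∈? 𝒮 ×-dec ¬? (inT? T T′ (β l)))

    ∈-choose⁺ : ∀ T T′ {l} → l ∈ˢ 𝒮 → ¬ InT T T′ (β l) → l ∈ˢ choose T T′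
    ∈-choose⁺ T T′ l∈𝒮 l∉ = ∈-tabulate⁺ (λ l → l ∈? 𝒮 ×-dec ¬? (inT? T T′ (β l))) (l∈𝒮 , l∉)

    ∈-choose⁻ : ∀ T T′ {l} → l ∈ˢ choose T T′ → l ∈ˢ 𝒮 × ¬ InT T T′ (β l)
    ∈-choose⁻ T T′ = ∈-tabulate⁻ (λ l → l ∈? 𝒮 ×-dec ¬? (inT? T T′ (β l)))

    choose-near : ∀ T T′ {l} → l ∈ˢ choose T T′ → Near l
    choose-near T T′ {l} l∈ = near (proj₁ parts) (proj₂ parts ∘ inj₁ ∘ there) (proj₂ parts ∘ inj₂ ∘ there)
      where
      parts : l ∈ˢ 𝒮 × ¬ InT T T′ (β l)
      parts = ∈-choose⁻ T T′ l∈

    -- Symmetric in the two ties, so that one argument treats both maximizing choices.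
    record Opposite (T T′ : Tie s) : Set where
      field
        apart   : residue (j T) ≢ residue (j T′)
        exhaust : ∀ {l l′} → Near l → Near l′ → residue l ≡ residue l′ → β l′ < β l →
                  IsTieOf T l l′ ⊎ IsTieOf T′ l l′

    opposite₁₂ : Opposite tie₁ tie₂
    opposite₁₂ = record { apart = distinct ; exhaust = near-classmates }

    opposite-swap : ∀ {T T′} → Opposite T T′ → Opposite T′ T
    opposite-swap o = record
      { apart = Opposite.apart o ∘ sym ; exhaust = λ p q e h → Sum.swap (Opposite.exhaust o p q e h) }

    private
      β≢ : ∀ {l l′} → residue l ≢ residue l′ → β l ≢ β l′
      β≢ ne e = ne (cong residue (β-injective e))

    module Chosen {T T′ : Tie s} (opp : Opposite T T′) where
      open Opposite opp

      choose-j : j T ∈ˢ choose T T′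
      choose-j = ∈-choose⁺ T T′ (Near.∈𝒮 nT) λ
        { (inj₁ (here e))    → β≢ apart e
        ; (inj₁ (there ∈us)) → Near.∉us nT ∈us
        ; (inj₂ (here e))    → <⇒≢ (k<j T) (sym e)
        ; (inj₂ (there ∈ls)) → Near.∉ls nT ∈ls }
        where nT = near-tie-j T

      choose-k : k T′ ∈ˢ choose T T′
      choose-k = ∈-choose⁺ T T′ (Near.∈𝒮 nT) λ
        { (inj₁ (here e))    → <⇒≢ (k<j T′) e
        ; (inj₁ (there ∈us)) → Near.∉us nT ∈us
        ; (inj₂ (here e))    → β≢ (λ e′ → apart (trans (mate T) (trans (sym e′) (sym (mate T′))))) e
        ; (inj₂ (there ∈ls)) → Near.∉ls nT ∈ls }
        where nT = near-tie-k T′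

      k∉choose : ¬ k T ∈ˢ choose T T′
      k∉choose k∈ = proj₂ (∈-choose⁻ T T′ k∈) (inj₂ (here refl))

      j∉choose : ¬ j T′ ∈ˢ choose T T′
      j∉choose j∈ = proj₂ (∈-choose⁻ T T′ j∈) (inj₁ (here refl))

      choose-unique : ∀ {l l′} → l ∈ˢ choose T T′ → l′ ∈ˢ choose T T′ → residue l ≡ residue l′ → l ≡ l′
      choose-unique {l} {l′} l∈ l′∈ same = byOrder (<-cmp (β l) (β l′))
        where
        impossible : ∀ {l l′} {A : Set} → l ∈ˢ choose T T′ → l′ ∈ˢ choose T T′ → IsTieOf T l l′ ⊎ IsTieOf T′ l l′ → A
        impossible l∈ l′∈ (inj₁ (_ , e)) = contradiction (subst (_∈ˢ choose T T′) e l′∈) k∉choose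
        impossible l∈ l′∈ (inj₂ (e , _)) = contradiction (subst (_∈ˢ choose T T′) e l∈) j∉choose
        byOrder : Tri (β l < β l′) (β l ≡ β l′) (β l′ < β l) → l ≡ l′
        byOrder (tri≈ _ e _)    = β-injective e
        byOrder (tri> _ _ l′<l) = impossible l∈ l′∈ (exhaust (choose-near T T′ l∈) (choose-near T T′ l′∈) same l′<l)
        byOrder (tri< l<l′ _ _) = impossible l′∈ l∈ (exhaust (choose-near T T′ l′∈) (choose-near T T′ l∈) (sym same) l<l′)

      choose-some : ∀ i → i ∈ˢ ℰ → ∃ λ l → l ∈ˢ choose T T′ × residue l ≡ i
      choose-some i i∈ℰ = fromMinimum
        (minimizer (d ∘ β) (λ l → residue l Fin.≟ i) (proj₁ (inhabited i)) (proj₂ (inhabited i)))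
        where
        fromMinimum : (∃ λ l → residue l ≡ i × (∀ l′ → residue l′ ≡ i → d (β l) ≤ d (β l′))) →
                      ∃ λ l → l ∈ˢ choose T T′ × residue l ≡ i
        fromMinimum (l , l∈i , min) = decide (inT? T T′ (β l))
          where
          l∈𝒮 : l ∈ˢ 𝒮
          l∈𝒮 = ∈-𝒮⁺ (subst (_∈ˢ ℰ) (sym l∈i) i∈ℰ)
          nl : Near l
          nl = minimal⇒near l∈𝒮 λ l′ same → min l′ (trans same l∈i)
          decide : Dec (InT T T′ (β l)) → ∃ λ l → l ∈ˢ choose T T′ × residue l ≡ i
          decide (no l∉) = l , ∈-choose⁺ T T′ l∈𝒮 l∉ , l∈i
          decide (yes (inj₁ (here e)))    = k T′ , choose-k , trans (sym (trans (cong residue (β-injective e)) (mate T′))) l∈i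
          decide (yes (inj₁ (there ∈us))) = contradiction ∈us (Near.∉us nl)
          decide (yes (inj₂ (here e)))    = j T , choose-j , trans (sym (trans (cong residue (β-injective e)) (sym (mate T)))) l∈i
          decide (yes (inj₂ (there ∈ls))) = contradiction ∈ls (Near.∉ls nl)

      choose-isChoice : IsChoice (choose T T′)
      choose-isChoice = (λ l∈ → proj₁ (∈-choose⁻ T T′ l∈)) , λ i i∈ℰ → one i (choose-some i i∈ℰ)
        where
        one : ∀ i → (∃ λ l → l ∈ˢ choose T T′ × residue l ≡ i) → ∣ choose T T′ ∩ class i ∣ ≡ 1
        one i (l , l∈ , refl) = ∣∣≡1⁺ (choose T T′ ∩ class i) (x∈p∩q⁺ (l∈ , ∈-class⁺ refl)) λ {l′} l′∈ →
          choose-unique (proj₁ (x∈p∩q⁻ (choose T T′) (class i) l′∈)) l∈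
            (∈-class⁻ (proj₂ (x∈p∩q⁻ (choose T T′) (class i) l′∈)))

    choice-unique : ∀ {g} → IsChoice g → ∀ {l l′} → l ∈ˢ g → l′ ∈ˢ g → residue l ≡ residue l′ → l ≡ l′
    choice-unique {g} (g⊆𝒮 , one) {l} {l′} l∈ l′∈ same =
      ∣∣≡1⇒≡ (g ∩ class (residue l)) (one (residue l) (∈-𝒮⁻ (g⊆𝒮 l∈)))
        (x∈p∩q⁺ (l∈ , ∈-class⁺ refl)) (x∈p∩q⁺ (l′∈ , ∈-class⁺ (sym same)))

    choice-some : ∀ {g} → IsChoice g → ∀ {i} → i ∈ˢ ℰ → ∃ λ l → l ∈ˢ g × residue l ≡ i
    choice-some {g} (g⊆𝒮 , one) {i} i∈ℰ = split (∣∣≥1⇒∃ (g ∩ class i) (≤-reflexive (sym (one i i∈ℰ))))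
      where
      split : (∃ λ l → l ∈ˢ g ∩ class i) → ∃ λ l → l ∈ˢ g × residue l ≡ i
      split (l , l∈) = l , proj₁ (x∈p∩q⁻ g (class i) l∈) , ∈-class⁻ (proj₂ (x∈p∩q⁻ g (class i) l∈))

    choice-⊆⇒≡ : ∀ {g h} → IsChoice g → IsChoice h → (∀ {l} → l ∈ˢ g → l ∈ˢ h) → g ≡ h
    choice-⊆⇒≡ {g} {h} cg ch g⊆h = ⊆-antisym g⊆h h⊆g
      where
      h⊆g : ∀ {l} → l ∈ˢ h → l ∈ˢ g
      h⊆g {l} l∈h = same-element (choice-some cg (∈-𝒮⁻ (proj₁ ch l∈h)))
        where
        same-element : (∃ λ l′ → l′ ∈ˢ g × residue l′ ≡ residue l) → l ∈ˢ g
        same-element (l′ , l′∈g , same) = subst (_∈ˢ g) (choice-unique ch (g⊆h l′∈g) l∈h same) l′∈g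

    -- A choice is a section of `residue` over `ℰ`, which turns the sum over its elements into a sum
    -- over classes.
    ∑-choice : ∀ {g} → IsChoice g → ∀ (h : Fin t → ℕ) →
               ∑ (λ l → ⟦ l ∈? g ⟧ * h (residue l)) ≡ ∑ (λ i → ⟦ i ∈? ℰ ⟧ * h i)
    ∑-choice {g} (g⊆𝒮 , one) h = begin
      ∑ (λ l → ⟦ l ∈? g ⟧ * h (residue l))
        ≡⟨ ∑-cong (λ l → sym (trans (∑-single (residue l) λ i i≢ →
             trans (cong (λ x → ⟦ l ∈? g ⟧ * x * h i) (⟦⟧-no (residue l Fin.≟ i) (i≢ ∘ sym))) (cong (_* h i) (*-zeroʳ ⟦ l ∈? g ⟧)))
             (trans (cong (λ x → ⟦ l ∈? g ⟧ * x * h (residue l)) (⟦⟧-yes (residue l Fin.≟ residue l) refl))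
                    (cong (_* h (residue l)) (*-identityʳ ⟦ l ∈? g ⟧))))) ⟩
      ∑ (λ l → ∑ λ i → ⟦ l ∈? g ⟧ * ⟦ residue l Fin.≟ i ⟧ * h i)
        ≡⟨ ∑-comm _ ⟩
      ∑ (λ i → ∑ λ l → ⟦ l ∈? g ⟧ * ⟦ residue l Fin.≟ i ⟧ * h i)
        ≡⟨ ∑-cong (λ i → trans (∑-*ʳ (h i) _) (cong (_* h i) (count i (i ∈? ℰ)))) ⟩
      ∑ (λ i → ⟦ i ∈? ℰ ⟧ * h i) ∎
      where
      open ≡-Reasoning
      count : ∀ i (e : Dec (i ∈ˢ ℰ)) → ∑ (λ l → ⟦ l ∈? g ⟧ * ⟦ residue l Fin.≟ i ⟧) ≡ ⟦ e ⟧
      count i (yes i∈ℰ) = trans (∑-cong λ l → trans (sym (⟦⟧-× (l ∈? g) (residue l Fin.≟ i)))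
        (⟦⟧-⇔ (l ∈? g ×-dec residue l Fin.≟ i) (l ∈? g ∩ class i) (λ (p , q) → x∈p∩q⁺ (p , ∈-class⁺ q))
          (λ l∈ → proj₁ (x∈p∩q⁻ g (class i) l∈) , ∈-class⁻ (proj₂ (x∈p∩q⁻ g (class i) l∈)))))
        (trans (sym (∣∣≡∑ (g ∩ class i))) (one i i∈ℰ))
      count i (no i∉ℰ) = ∑-zero λ l → trans (sym (⟦⟧-× (l ∈? g) (residue l Fin.≟ i)))
        (⟦⟧-no (l ∈? g ×-dec residue l Fin.≟ i) λ { (l∈g , refl) → i∉ℰ (∈-𝒮⁻ (g⊆𝒮 l∈g)) })

    ∑-T : ∀ {g} → IsChoice g → ∀ (h : Fin N → ℕ) →
          ∑ (λ l → ⟦ l ∈? T g ⟧ * h l) + ∑ (λ l → ⟦ l ∈? g ⟧ * h l) ≡ ∑ (λ l → ⟦ l ∈? 𝒮 ⟧ * h l)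
    ∑-T {g} (g⊆𝒮 , _) h = trans (sym (∑-+ _ _)) (∑-cong λ l →
      trans (sym (*-distribʳ-+ (h l) ⟦ l ∈? T g ⟧ ⟦ l ∈? g ⟧)) (cong (_* h l) (split l)))
      where
      split : ∀ l → ⟦ l ∈? T g ⟧ + ⟦ l ∈? g ⟧ ≡ ⟦ l ∈? 𝒮 ⟧
      split l = by (l ∈? g)
        where
        by : (e : Dec (l ∈ˢ g)) → ⟦ l ∈? T g ⟧ + ⟦ e ⟧ ≡ ⟦ l ∈? 𝒮 ⟧
        by (yes l∈g) = trans (cong (_+ 1) (⟦⟧-no (l ∈? T g) λ l∈T → proj₂ (∈-─⁻ l∈T) l∈g))
                             (sym (⟦⟧-yes (l ∈? 𝒮) (g⊆𝒮 l∈g)))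
        by (no l∉g)  = trans (+-identityʳ _) (⟦⟧-⇔ (l ∈? T g) (l ∈? 𝒮) (proj₁ ∘ ∈-─⁻) λ l∈𝒮 → x∈p∧x∉q⇒x∈p─q l∈𝒮 l∉g)

    private
      ∑-𝒮 : ∑ (λ l → ⟦ l ∈? 𝒮 ⟧) + t ≡ N + ∑ (λ i → ⟦ i ∈? ℰ ⟧)
      ∑-𝒮 = begin
        ∑ (λ l → ⟦ l ∈? 𝒮 ⟧) + t
          ≡⟨ cong₂ _+_ 𝒮≡ (sym ∑-one) ⟩
        ∑ (λ i → ⟦ i ∈? ℰ ⟧ * n i) + ∑ (λ _ → 1)
          ≡⟨ ∑-+ _ _ ⟨
        ∑ (λ i → ⟦ i ∈? ℰ ⟧ * n i + 1)
          ≡⟨ ∑-cong (λ i → size i (i ∈? ℰ)) ⟩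
        ∑ (λ i → n i + ⟦ i ∈? ℰ ⟧)
          ≡⟨ trans (∑-+ _ _) (cong (_+ ∑ (λ i → ⟦ i ∈? ℰ ⟧)) ∑n≡N) ⟩
        N + ∑ (λ i → ⟦ i ∈? ℰ ⟧) ∎
        where
        open ≡-Reasoning
        size : ∀ i (e : Dec (i ∈ˢ ℰ)) → ⟦ e ⟧ * n i + 1 ≡ n i + ⟦ e ⟧
        size i (yes _)  = cong (_+ 1) (+-identityʳ (n i))
        size i (no i∉ℰ) = trans (≤-antisym (n≥1 i) (s≤s⁻¹ (≰⇒> (i∉ℰ ∘ ∈-ℰ⁺)))) (sym (+-identityʳ (n i)))
        𝒮≡ : ∑ (λ l → ⟦ l ∈? 𝒮 ⟧) ≡ ∑ (λ i → ⟦ i ∈? ℰ ⟧ * n i)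
        𝒮≡ = begin
          ∑ (λ l → ⟦ l ∈? 𝒮 ⟧)
            ≡⟨ ∑-cong (λ l → trans (⟦⟧-⇔ (l ∈? 𝒮) (residue l ∈? ℰ) ∈-𝒮⁻ ∈-𝒮⁺) (sym (trans
                 (∑-single (residue l) λ i i≢ → trans (cong (⟦ i ∈? ℰ ⟧ *_) (⟦⟧-no (residue l Fin.≟ i) (i≢ ∘ sym))) (*-zeroʳ ⟦ i ∈? ℰ ⟧))
                 (trans (cong (⟦ residue l ∈? ℰ ⟧ *_) (⟦⟧-yes (residue l Fin.≟ residue l) refl)) (*-identityʳ _))))) ⟩
          ∑ (λ l → ∑ λ i → ⟦ i ∈? ℰ ⟧ * ⟦ residue l Fin.≟ i ⟧)
            ≡⟨ ∑-comm _ ⟩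
          ∑ (λ i → ∑ λ l → ⟦ i ∈? ℰ ⟧ * ⟦ residue l Fin.≟ i ⟧)
            ≡⟨ ∑-cong (λ i → trans (∑-*ˡ ⟦ i ∈? ℰ ⟧ _) (cong (⟦ i ∈? ℰ ⟧ *_) (sym (n≡∑ i)))) ⟩
          ∑ (λ i → ⟦ i ∈? ℰ ⟧ * n i) ∎

    -- The choice takes |ℰ| elements out of the 2r + |ℰ| elements of `𝒮`; `∑-𝒮` gives the latter
    -- count with `t` added to both sides.
    length-T : ∀ {g} → IsChoice g → length (values (T g)) ≡ r + r
    length-T {g} cg = +-cancelʳ-≡ (∑ (λ i → ⟦ i ∈? ℰ ⟧) + t) _ _ (begin
      length (values (T g)) + (∑ (λ i → ⟦ i ∈? ℰ ⟧) + t)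
        ≡⟨ cong₂ (λ a b → a + (b + t)) (trans (length-values (T g)) (∑-cong λ l → sym (*-identityʳ _)))
             (trans (∑-cong λ i → sym (*-identityʳ _)) (sym (∑-choice cg (λ _ → 1)))) ⟩
      ∑ (λ l → ⟦ l ∈? T g ⟧ * 1) + (∑ (λ l → ⟦ l ∈? g ⟧ * 1) + t)
        ≡⟨ +-assoc (∑ (λ l → ⟦ l ∈? T g ⟧ * 1)) _ _ ⟨
      ∑ (λ l → ⟦ l ∈? T g ⟧ * 1) + ∑ (λ l → ⟦ l ∈? g ⟧ * 1) + t
        ≡⟨ cong (_+ t) (trans (∑-T cg (λ _ → 1)) (∑-cong λ l → *-identityʳ _)) ⟩
      ∑ (λ l → ⟦ l ∈? 𝒮 ⟧) + t
        ≡⟨ ∑-𝒮 ⟩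
      t + r * 2 + ∑ (λ i → ⟦ i ∈? ℰ ⟧)
        ≡⟨ rearrange t r _ ⟩
      r + r + (∑ (λ i → ⟦ i ∈? ℰ ⟧) + t) ∎)
      where
      open ≡-Reasoning
      rearrange : ∀ t r e → t + r * 2 + e ≡ r + r + (e + t)
      rearrange = solve-∀

    private
      +-squeeze : ∀ {a b x y} → a ≤ x → b ≤ y → a + b ≡ x + y → a ≡ x × b ≡ y
      +-squeeze {a} {b} {x} {y} a≤x b≤y e = a≡x , +-cancelˡ-≡ x b y (trans (cong (_+ b) (sym a≡x)) e)
        where
        a≡x : a ≡ x
        a≡x = ≤-antisym a≤x (+-cancelʳ-≤ y x a (≤-trans (≤-reflexive (sym e)) (+-monoʳ-≤ a b≤y)))

      differences : ∀ a b c d → ℤ.+ a ℤ.- ℤ.+ b ℤ.≤ ℤ.+ c ℤ.- ℤ.+ d ⇔ a + d ≤ c + b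
      differences a b c d = mk⇔
        (λ h → ℤ.drop‿+≤+ (subst₂ ℤ._≤_ (left (ℤ.+ a) (ℤ.+ b) (ℤ.+ d)) (right (ℤ.+ c) (ℤ.+ d) (ℤ.+ b)) (ℤ.+-monoˡ-≤ (ℤ.+ b ℤ.+ ℤ.+ d) h)))
        (λ h → subst₂ ℤ._≤_ (left′ (ℤ.+ a) (ℤ.+ b) (ℤ.+ d)) (right′ (ℤ.+ c) (ℤ.+ d) (ℤ.+ b)) (ℤ.+-monoˡ-≤ (ℤ.- (ℤ.+ b ℤ.+ ℤ.+ d)) (ℤ.+≤+ h)))
        where
        left : ∀ a b d → a ℤ.- b ℤ.+ (b ℤ.+ d) ≡ a ℤ.+ d
        left = ℤ-solve-∀
        right : ∀ c d b → c ℤ.- d ℤ.+ (b ℤ.+ d) ≡ c ℤ.+ b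
        right = ℤ-solve-∀
        left′ : ∀ a b d → a ℤ.+ d ℤ.- (b ℤ.+ d) ≡ a ℤ.- b
        left′ = ℤ-solve-∀
        right′ : ∀ c d b → c ℤ.+ b ℤ.- (b ℤ.+ d) ≡ c ℤ.- d
        right′ = ℤ-solve-∀

    top bottom : Subset N → List ℕ
    top g    = take r (values (T g))
    bottom g = drop r (values (T g))

    nearest : ∀ i → ∃ λ l → residue l ≡ i × (∀ l′ → residue l′ ≡ i → d (β l) ≤ d (β l′))
    nearest i = minimizer (d ∘ β) (λ l → residue l Fin.≟ i) (proj₁ (inhabited i)) (proj₂ (inhabited i))

    dist : Fin t → ℕ
    dist i = d (β (proj₁ (nearest i)))

    dist-≤ : ∀ l → dist (residue l) ≤ d (β l)
    dist-≤ l = proj₂ (proj₂ (nearest (residue l))) l refl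

    dist-near : ∀ {l} → Near l → d (β l) ≡ dist (residue l)
    dist-near {l} nl = ≤-antisym (near-≤ nl (proj₁ (nearest (residue l))) (proj₁ (proj₂ (nearest (residue l))))) (dist-≤ l)

    near-dist : ∀ {l} → l ∈ˢ 𝒮 → d (β l) ≡ dist (residue l) → Near l
    near-dist {l} l∈𝒮 e = minimal⇒near l∈𝒮 λ l′ same →
      ≤-trans (≤-reflexive (trans e (cong dist (sym same)))) (dist-≤ l′)

    total chosen : ℕ
    total  = ∑ λ l → ⟦ l ∈? 𝒮 ⟧ * d (β l)
    chosen = ∑ λ i → ⟦ i ∈? ℰ ⟧ * dist i

    -- 2 deg (T g) ≤ ∑ d over T g, which is total - ∑ d over g; so it is at most total - chosen.
    Optimal : Subset N → Set
    Optimal g = 2 * sum (top g) + chosen ≡ total + 2 * sum (bottom g)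

    sum-values : ∀ P → sum (map d (values P)) ≡ ∑ λ l → ⟦ l ∈? P ⟧ * d (β l)
    sum-values P = trans (cong sum (sym (map-∘ (filter (_∈? P) (allFin N)))))
      (sum-filter (_∈? P) (d ∘ β) (λ l → l))

    module _ {g : Subset N} (cg : IsChoice g) where

      |top| : length (top g) ≡ r
      |top| = trans (length-take r (values (T g))) (trans (cong (r ⊓_) (length-T cg)) (m≤n⇒m⊓n≡m (m≤m+n r r)))

      |bottom| : length (bottom g) ≡ r
      |bottom| = trans (length-drop r (values (T g))) (trans (cong (_∸ r) (length-T cg)) (m+n∸m≡n r r))

      private
        γ A A′ B B′ : ℕ
        γ  = ∑ λ l → ⟦ l ∈? g ⟧ * d (β l)
        A  = 2 * sum (top g)
        B  = 2 * sum (bottom g)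
        A′ = sum (map d (top g))
        B′ = sum (map d (bottom g))

        chosen≡ : chosen ≡ ∑ λ l → ⟦ l ∈? g ⟧ * dist (residue l)
        chosen≡ = sym (∑-choice cg dist)

        term-≤ : ∀ l → ⟦ l ∈? g ⟧ * dist (residue l) ≤ ⟦ l ∈? g ⟧ * d (β l)
        term-≤ l = *-monoʳ-≤ ⟦ l ∈? g ⟧ (dist-≤ l)

        chosen≤γ : chosen ≤ γ
        chosen≤γ = ≤-trans (≤-reflexive chosen≡) (∑-mono term-≤)

        2u≤ : ∀ u → 2 * u ≤ s + d u
        2u≤ u = m≤n+∣m-n∣ (2 * u) s

        s≤ : ∀ u → s ≤ 2 * u + d u
        s≤ u = m≤n+∣n-m∣ s (2 * u)

        A≡ : A ≡ sum (map (2 *_) (top g))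
        A≡ = sym (sum-* 2 (top g))

        A′≡ : sum (map (λ u → s + d u) (top g)) ≡ r * s + A′
        A′≡ = trans (sum-+ (λ _ → s) d (top g)) (cong (_+ A′) (trans (sum-const s (top g)) (cong (_* s) |top|)))

        B≡ : sum (map (λ _ → s) (bottom g)) ≡ r * s
        B≡ = trans (sum-const s (bottom g)) (cong (_* s) |bottom|)

        B′≡ : sum (map (λ u → 2 * u + d u) (bottom g)) ≡ B + B′
        B′≡ = trans (sum-+ (2 *_) d (bottom g)) (cong (_+ B′) (sum-* 2 (bottom g)))

        A≤ : A ≤ r * s + A′
        A≤ = subst₂ _≤_ (sym A≡) A′≡ (sum-mono 2u≤ (top g))

        rs≤ : r * s ≤ B + B′
        rs≤ = subst₂ _≤_ B≡ B′≡ (sum-mono s≤ (bottom g))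

        total≡ : A′ + B′ + γ ≡ total
        total≡ = trans (cong (_+ γ) (trans (sym (sum-map-++ d (top g) (bottom g)))
          (trans (cong (sum ∘ map d) (take++drop≡id r (values (T g)))) (sum-values (T g)))))
          (∑-T cg (d ∘ β))

        lhs : A + (r * s + chosen) ≡ (A + chosen) + r * s
        lhs = shuffle A (r * s) chosen
          where
          shuffle : ∀ a b c → a + (b + c) ≡ a + c + b
          shuffle = solve-∀

        rhs : (r * s + A′) + ((B + B′) + γ) ≡ (total + B) + r * s
        rhs = trans (shuffle (r * s) A′ B B′ γ) (cong (λ x → x + B + r * s) total≡)
          where
          shuffle : ∀ p a b c e → (p + a) + ((b + c) + e) ≡ (a + c + e) + b + p
          shuffle = solve-∀

      -- Add 2u ≤ s + d u over the upper half, s ≤ 2u + d u over the lower half, and the bound of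
      -- the distances over `g` from below by the class minima. Both halves have `r` elements, so
      -- `r * s` cancels.
      bound : 2 * sum (top g) + chosen ≤ total + 2 * sum (bottom g)
      bound = +-cancelʳ-≤ (r * s) _ _ (subst₂ _≤_ lhs rhs (+-mono-≤ A≤ (+-mono-≤ rs≤ chosen≤γ)))

      optimal⁺ : (∀ {l} → l ∈ˢ g → Near l) → (∀ {u} → u ∈ top g → s ≤ 2 * u) →
                 (∀ {u} → u ∈ bottom g → 2 * u ≤ s) → Optimal g
      optimal⁺ g-near above below = +-cancelʳ-≡ (r * s) _ _ (trans (sym lhs) (trans
        (cong₂ _+_ A-eq (cong₂ _+_ rs-eq chosen-eq)) rhs))
        where
        A-eq : A ≡ r * s + A′
        A-eq = trans A≡ (trans (sum-cong {2 *_} {λ u → s + d u} {top g} λ {u} u∈ →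
          sym (trans (cong (s +_) (m≤n⇒∣n-m∣≡n∸m (above u∈))) (m+[n∸m]≡n (above u∈)))) A′≡)
        rs-eq : r * s ≡ B + B′
        rs-eq = trans (sym B≡) (trans (sum-cong {λ _ → s} {λ u → 2 * u + d u} {bottom g} λ {u} u∈ →
          sym (trans (cong (2 * u +_) (m≤n⇒∣m-n∣≡n∸m (below u∈))) (m+[n∸m]≡n (below u∈)))) B′≡)
        chosen-eq : chosen ≡ γ
        chosen-eq = trans chosen≡ (∑-cong λ l → term l (l ∈? g))
          where
          term : ∀ l (e : Dec (l ∈ˢ g)) → ⟦ e ⟧ * dist (residue l) ≡ ⟦ e ⟧ * d (β l)
          term l (yes l∈g) = cong (1 *_) (sym (dist-near (g-near l∈g)))
          term l (no _)    = refl

      private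
        -- Three inequalities that add up to an equality are equalities themselves.
        equalities : Optimal g → A ≡ r * s + A′ × (r * s ≡ B + B′ × chosen ≡ γ)
        equalities opt = proj₁ outer , +-squeeze rs≤ chosen≤γ (proj₂ outer)
          where
          outer : A ≡ r * s + A′ × r * s + chosen ≡ (B + B′) + γ
          outer = +-squeeze A≤ (+-mono-≤ rs≤ chosen≤γ) (trans lhs (trans (cong (_+ r * s) opt) (sym rhs)))

      optimal⇒above : Optimal g → ∀ {u} → u ∈ top g → s ≤ 2 * u
      optimal⇒above opt {u} u∈ = ≤-trans (m≤m+n s (d u)) (≤-reflexive (sym
        (sum-mono-≡ {2 *_} {λ u → s + d u} 2u≤ (trans (sym A≡) (trans (proj₁ (equalities opt)) (sym A′≡))) u∈)))

      optimal⇒below : Optimal g → ∀ {u} → u ∈ bottom g → 2 * u ≤ s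
      optimal⇒below opt {u} u∈ = ≤-trans (m≤m+n (2 * u) (d u)) (≤-reflexive (sym
        (sum-mono-≡ {λ _ → s} {λ u → 2 * u + d u} s≤ (trans B≡ (trans (proj₁ (proj₂ (equalities opt))) (sym B′≡))) u∈)))

      optimal⇒near : Optimal g → ∀ {l} → l ∈ˢ g → Near l
      optimal⇒near opt {l} l∈g = near-dist (proj₁ cg l∈g) (sym (trans (sym (*-identityˡ _)) (trans
        (cong (_* dist (residue l)) (sym (⟦⟧-yes (l ∈? g) l∈g))) (trans
        (∑-mono-≡ term-≤ (trans (sym chosen≡) (proj₂ (proj₂ (equalities opt)))) l)
        (trans (cong (_* d (β l)) (⟦⟧-yes (l ∈? g) l∈g)) (*-identityˡ _))))))

    optimal⇒G : ∀ {g} → IsChoice g → Optimal g → G g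
    optimal⇒G {g} cg opt = cg , λ h ch → Equivalence.from
      (differences (sum (top h)) (sum (bottom h)) (sum (top g)) (sum (bottom g)))
      (*-cancelˡ-≤ 2 (+-cancelʳ-≤ (chosen + total) _ _ (subst₂ _≤_
        (left (sum (top h)) (sum (bottom g)) chosen total) (right (sum (top g)) (sum (bottom h)) chosen total)
        (+-mono-≤ (bound ch) (≤-reflexive (sym opt))))))
      where
      left : ∀ a b c d → 2 * a + c + (d + 2 * b) ≡ 2 * (a + b) + (c + d)
      left = solve-∀
      right : ∀ a b c d → d + 2 * b + (2 * a + c) ≡ 2 * (a + b) + (c + d)
      right = solve-∀

    -- One choice that attains the bound is at hand; a maximizer is at least as good and so attains
    -- it too.
    G⇒optimal : ∀ {g₀ g} → IsChoice g₀ → Optimal g₀ → G g → Optimal g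
    G⇒optimal {g₀} {g} cg₀ opt (cg , max) = ≤-antisym (bound cg) (+-cancelˡ-≤ (2 * sum (top g₀) + chosen) _ _
      (≤-trans (≤-reflexive (left (sum (top g₀)) (sum (bottom g)) chosen total))
        (≤-trans (+-monoˡ-≤ (chosen + total) (*-monoʳ-≤ 2 (Equivalence.to
          (differences (sum (top g₀)) (sum (bottom g₀)) (sum (top g)) (sum (bottom g))) (max g₀ cg₀))))
        (≤-reflexive (trans (sym (right (sum (top g)) (sum (bottom g₀)) chosen total))
          (cong (_+ (2 * sum (top g) + chosen)) (sym opt)))))))
      where
      left : ∀ a b c d → 2 * a + c + (d + 2 * b) ≡ 2 * (a + b) + (c + d)
      left = solve-∀
      right : ∀ a b c d → d + 2 * b + (2 * a + c) ≡ 2 * (a + b) + (c + d)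
      right = solve-∀

    private
      values-unique : ∀ P → Unique (values P)
      values-unique P = AllPairs.map (λ x>y x≡y → <⇒≢ x>y (sym x≡y)) (values-decreasing P)

      |us|<r : length us < r
      |us|<r = ≤-reflexive (trans (cong ℕ.suc |us|) (sym r≡1+r′))

      |ls|<r : length ls < r
      |ls|<r = ≤-reflexive (trans (cong ℕ.suc |ls|) (sym r≡1+r′))

      top⊆ : ∀ {g u} → u ∈ top g → ∃ λ l → l ∈ˢ T g × u ≡ β l
      top⊆ {g} u∈ = ∈-values⁻ {T g} (subst (_ ∈_) (take++drop≡id r (values (T g))) (∈-++⁺ˡ u∈))

      bottom⊆ : ∀ {g u} → u ∈ bottom g → ∃ λ l → l ∈ˢ T g × u ≡ β l
      bottom⊆ {g} u∈ = ∈-values⁻ {T g} (subst (_ ∈_) (take++drop≡id r (values (T g))) (∈-++⁺ʳ (top g) u∈))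

      top-unique : ∀ g → Unique (top g)
      top-unique g = AllPairs.take⁺ r (values-unique (T g))

      bottom-unique : ∀ g → Unique (bottom g)
      bottom-unique g = AllPairs.drop⁺ r (values-unique (T g))

      bottom<top : ∀ {g u v} → u ∈ top g → v ∈ bottom g → v < u
      bottom<top {g} = take>drop r (values-decreasing (T g))

    module Median {T₁ T₂ : Tie s} (opp : Opposite T₁ T₂) where
      open Chosen opp

      g : Subset N
      g = choose T₁ T₂

      ups downs : List ℕ
      ups   = β (j T₂) ∷ us
      downs = β (k T₁) ∷ ls

      ups-above : ∀ {u} → u ∈ ups → s < 2 * u
      ups-above (here e)   = subst (λ u → s < 2 * u) (sym e) (2j>s T₂)
      ups-above (there u∈) = us-above u∈

      downs-below : ∀ {u} → u ∈ downs → 2 * u < s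
      downs-below (here e)   = subst (λ u → 2 * u < s) (sym e) (2k<s T₁)
      downs-below (there u∈) = ls-below u∈

      split : ∀ {u} → (∃ λ l → l ∈ˢ T g × u ≡ β l) → u ∈ ups ⊎ u ∈ downs
      split (l , l∈ , e) = subst (InT T₁ T₂) (sym e) (decidable-stable (inT? T₁ T₂ (β l)) λ l∉ →
        proj₂ (∈-─⁻ l∈) (∈-choose⁺ T₁ T₂ (proj₁ (∈-─⁻ l∈)) l∉))

      -- A value of `downs` in the upper half would drag the whole lower half into `downs`, giving r
      -- + 1 values in a list of length r.
      above : ∀ {u} → u ∈ top g → s ≤ 2 * u
      above {u} u∈ = decide (split (top⊆ {g} u∈))
        where
        decide : u ∈ ups ⊎ u ∈ downs → s ≤ 2 * u
        decide (inj₁ ∈ups)   = <⇒≤ (ups-above ∈ups)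
        decide (inj₂ ∈downs) = contradiction
          (unique-⊆-length {u ∷ bottom g} {downs}
            (All.tabulate (λ v∈ u≡v → <⇒≢ (bottom<top {g} u∈ v∈) (sym u≡v)) ∷ bottom-unique g)
            λ { (here e) → subst (_∈ downs) (sym e) ∈downs ; (there v∈) → low v∈ (split (bottom⊆ {g} v∈)) })
          (<⇒≱ (s≤s (subst (length ls <_) (sym (|bottom| choose-isChoice)) |ls|<r)))
          where
          low : ∀ {v} → v ∈ bottom g → v ∈ ups ⊎ v ∈ downs → v ∈ downs
          low v∈ (inj₂ v∈downs) = v∈downs
          low v∈ (inj₁ v∈ups)   = contradiction (<-trans (ups-above v∈ups) (*-monoʳ-< 2 (bottom<top {g} u∈ v∈)))
                                    (<-asym (downs-below ∈downs))

      below : ∀ {u} → u ∈ bottom g → 2 * u ≤ s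
      below {u} u∈ = decide (split (bottom⊆ {g} u∈))
        where
        decide : u ∈ ups ⊎ u ∈ downs → 2 * u ≤ s
        decide (inj₂ ∈downs) = <⇒≤ (downs-below ∈downs)
        decide (inj₁ ∈ups)   = contradiction
          (unique-⊆-length {u ∷ top g} {ups}
            (All.tabulate (λ v∈ u≡v → <⇒≢ (bottom<top {g} v∈ u∈) u≡v) ∷ top-unique g)
            λ { (here e) → subst (_∈ ups) (sym e) ∈ups ; (there v∈) → high v∈ (split (top⊆ {g} v∈)) })
          (<⇒≱ (s≤s (subst (length us <_) (sym (|top| choose-isChoice)) |us|<r)))
          where
          high : ∀ {v} → v ∈ top g → v ∈ ups ⊎ v ∈ downs → v ∈ ups
          high v∈ (inj₁ v∈ups)   = v∈ups
          high v∈ (inj₂ v∈downs) = contradiction (<-trans (*-monoʳ-< 2 (bottom<top {g} v∈ u∈)) (downs-below v∈downs))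
                                     (<-asym (ups-above ∈ups))

      optimal : Optimal g
      optimal = optimal⁺ choose-isChoice (choose-near T₁ T₂) above below

    tie-member : ∀ {T T′} → Opposite T T′ → ∀ {l} → Near l → residue l ≡ residue (j T) → l ≡ j T ⊎ l ≡ k T
    tie-member {T} {T′} opp {l} nl same = byOrder (<-cmp (β l) (β (j T)))
      where
      open Opposite opp
      byOrder : Tri (β l < β (j T)) (β l ≡ β (j T)) (β (j T) < β l) → l ≡ j T ⊎ l ≡ k T
      byOrder (tri≈ _ e _)   = inj₁ (β-injective e)
      byOrder (tri< l<j _ _) = down (exhaust (near-tie-j T) nl (sym same) l<j)
        where
        down : IsTieOf T (j T) l ⊎ IsTieOf T′ (j T) l → l ≡ j T ⊎ l ≡ k T
        down (inj₁ (_ , e)) = inj₂ e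
        down (inj₂ (e , _)) = contradiction (cong residue e) apart
      byOrder (tri> _ _ j<l) = up (exhaust nl (near-tie-j T) same j<l)
        where
        up : IsTieOf T l (j T) ⊎ IsTieOf T′ l (j T) → l ≡ j T ⊎ l ≡ k T
        up (inj₁ (e , _)) = inj₁ e
        up (inj₂ (e , _)) = contradiction (trans (sym same) (cong residue e)) apart

    module _ {g : Subset N} (cg : IsChoice g) (opt : Optimal g) where

      private
        j≢k : ∀ (T : Tie s) → j T ≢ k T
        j≢k T e = <⇒≢ (k<j T) (cong β (sym e))

        not-both : ∀ (T : Tie s) → j T ∈ˢ g → ¬ k T ∈ˢ g
        not-both T j∈ k∈ = j≢k T (choice-unique cg j∈ k∈ (mate T))

      ≡choose : ∀ {T T′} → Opposite T T′ → j T ∈ˢ g → k T′ ∈ˢ g → g ≡ choose T T′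
      ≡choose {T} {T′} opp j∈ k∈ = choice-⊆⇒≡ cg (Chosen.choose-isChoice opp) λ l∈ →
        ∈-choose⁺ T T′ (proj₁ cg l∈) λ
          { (inj₁ (here e))    → not-both T′ (subst (_∈ˢ g) (β-injective e) l∈) k∈
          ; (inj₁ (there ∈us)) → Near.∉us (optimal⇒near cg opt l∈) ∈us
          ; (inj₂ (here e))    → not-both T j∈ (subst (_∈ˢ g) (β-injective e) l∈)
          ; (inj₂ (there ∈ls)) → Near.∉ls (optimal⇒near cg opt l∈) ∈ls }

      private
        -- By optimality the element of `g` in the same class is near as well, and two near
        -- classmates form a tie.
        partner : ∀ {l} → Near l → ¬ l ∈ˢ g →
                  ∃ λ T → (T ≡ tie₁ ⊎ T ≡ tie₂) × ((l ≡ j T × k T ∈ˢ g) ⊎ (l ≡ k T × j T ∈ˢ g))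
        partner {l} nl l∉g = find-mate (choice-some cg (∈-𝒮⁻ (Near.∈𝒮 nl)))
          where
          find-mate : (∃ λ c → c ∈ˢ g × residue c ≡ residue l) →
                 ∃ λ T → (T ≡ tie₁ ⊎ T ≡ tie₂) × ((l ≡ j T × k T ∈ˢ g) ⊎ (l ≡ k T × j T ∈ˢ g))
          find-mate (c , c∈g , same) = byOrder (<-cmp (β l) (β c))
            where
            byOrder : Tri (β l < β c) (β l ≡ β c) (β c < β l) →
                      ∃ λ T → (T ≡ tie₁ ⊎ T ≡ tie₂) × ((l ≡ j T × k T ∈ˢ g) ⊎ (l ≡ k T × j T ∈ˢ g))
            byOrder (tri≈ _ e _) = contradiction (subst (_∈ˢ g) (sym (β-injective e)) c∈g) l∉g
            byOrder (tri< l<c _ _) = upward (near-classmates (optimal⇒near cg opt c∈g) nl same l<c)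
              where
              upward : IsTieOf tie₁ c l ⊎ IsTieOf tie₂ c l → _
              upward (inj₁ (e , e′)) = tie₁ , inj₁ refl , inj₂ (e′ , subst (_∈ˢ g) e c∈g)
              upward (inj₂ (e , e′)) = tie₂ , inj₂ refl , inj₂ (e′ , subst (_∈ˢ g) e c∈g)
            byOrder (tri> _ _ c<l) = downward (near-classmates nl (optimal⇒near cg opt c∈g) (sym same) c<l)
              where
              downward : IsTieOf tie₁ l c ⊎ IsTieOf tie₂ l c → _
              downward (inj₁ (e , e′)) = tie₁ , inj₁ refl , inj₁ (e , subst (_∈ˢ g) e′ c∈g)
              downward (inj₂ (e , e′)) = tie₂ , inj₂ refl , inj₁ (e , subst (_∈ˢ g) e′ c∈g)

        -- Had `g` taken both upper ends, the upper half of `T g` would contain no end of a tie and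
        -- would have to fit into `us`, which has only r - 1 elements.
        not-both-upper : j tie₁ ∈ˢ g → ¬ j tie₂ ∈ˢ g
        not-both-upper j₁∈ j₂∈ = <⇒≱ |us|<r (subst (_≤ length us) (|top| cg)
          (unique-⊆-length (top-unique g) λ u∈ → inUs u∈ (top⊆ {g} u∈)))
          where
          both : ∀ {T} → T ≡ tie₁ ⊎ T ≡ tie₂ → j T ∈ˢ g
          both (inj₁ refl) = j₁∈
          both (inj₂ refl) = j₂∈
          inUs : ∀ {u} → u ∈ top g → (∃ λ l → l ∈ˢ T g × u ≡ β l) → u ∈ us
          inUs {u} u∈ (l , l∈ , e) = decidable-stable (u ∈ᴸ? us) λ u∉us → conflict
            (partner (near (proj₁ (∈-─⁻ l∈)) (u∉us ∘ subst (_∈ us) (sym e))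
              (λ l∈ls → <⇒≱ (ls-below l∈ls) (subst (λ u → s ≤ 2 * u) e (optimal⇒above cg opt u∈)))) (proj₂ (∈-─⁻ l∈)))
            where
            conflict : ¬ (∃ λ T → (T ≡ tie₁ ⊎ T ≡ tie₂) × ((l ≡ j T × k T ∈ˢ g) ⊎ (l ≡ k T × j T ∈ˢ g)))
            conflict (T , which , inj₁ (_ , k∈))   = not-both T (both which) k∈
            conflict (T , which , inj₂ (l≡k , _)) = <⇒≱ (2k<s T)
              (subst (λ u → s ≤ 2 * u) (trans e (cong β l≡k)) (optimal⇒above cg opt u∈))

        not-both-lower : k tie₁ ∈ˢ g → ¬ k tie₂ ∈ˢ g
        not-both-lower k₁∈ k₂∈ = <⇒≱ |ls|<r (subst (_≤ length ls) (|bottom| cg)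
          (unique-⊆-length (bottom-unique g) λ u∈ → inLs u∈ (bottom⊆ {g} u∈)))
          where
          both : ∀ {T} → T ≡ tie₁ ⊎ T ≡ tie₂ → k T ∈ˢ g
          both (inj₁ refl) = k₁∈
          both (inj₂ refl) = k₂∈
          inLs : ∀ {u} → u ∈ bottom g → (∃ λ l → l ∈ˢ T g × u ≡ β l) → u ∈ ls
          inLs {u} u∈ (l , l∈ , e) = decidable-stable (u ∈ᴸ? ls) λ u∉ls → conflict
            (partner (near (proj₁ (∈-─⁻ l∈))
              (λ l∈us → <⇒≱ (us-above l∈us) (subst (λ u → 2 * u ≤ s) e (optimal⇒below cg opt u∈)))
              (u∉ls ∘ subst (_∈ ls) (sym e))) (proj₂ (∈-─⁻ l∈)))
            where
            conflict : ¬ (∃ λ T → (T ≡ tie₁ ⊎ T ≡ tie₂) × ((l ≡ j T × k T ∈ˢ g) ⊎ (l ≡ k T × j T ∈ˢ g)))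
            conflict (T , which , inj₂ (_ , j∈))   = not-both T j∈ (both which)
            conflict (T , which , inj₁ (l≡j , _)) = <⇒≱ (2j>s T)
              (subst (λ u → 2 * u ≤ s) (trans e (cong β l≡j)) (optimal⇒below cg opt u∈))

        member : ∀ {T T′} → Opposite T T′ → j T ∈ˢ g ⊎ k T ∈ˢ g
        member {T} opp = from (choice-some cg (∈-𝒮⁻ (Near.∈𝒮 (near-tie-j T))))
          where
          from : (∃ λ c → c ∈ˢ g × residue c ≡ residue (j T)) → j T ∈ˢ g ⊎ k T ∈ˢ g
          from (c , c∈g , same) = which (tie-member opp (optimal⇒near cg opt c∈g) same)
            where
            which : c ≡ j T ⊎ c ≡ k T → j T ∈ˢ g ⊎ k T ∈ˢ g
            which (inj₁ e) = inj₁ (subst (_∈ˢ g) e c∈g)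
            which (inj₂ e) = inj₂ (subst (_∈ˢ g) e c∈g)

      optimal⇒choose : g ≡ choose tie₁ tie₂ ⊎ g ≡ choose tie₂ tie₁
      optimal⇒choose = cases (member opposite₁₂) (member (opposite-swap opposite₁₂))
        where
        cases : j tie₁ ∈ˢ g ⊎ k tie₁ ∈ˢ g → j tie₂ ∈ˢ g ⊎ k tie₂ ∈ˢ g → g ≡ choose tie₁ tie₂ ⊎ g ≡ choose tie₂ tie₁
        cases (inj₁ j₁) (inj₁ j₂) = contradiction j₂ (not-both-upper j₁)
        cases (inj₁ j₁) (inj₂ k₂) = inj₁ (≡choose opposite₁₂ j₁ k₂)
        cases (inj₂ k₁) (inj₁ j₂) = inj₂ (≡choose (opposite-swap opposite₁₂) j₂ k₁)
        cases (inj₂ k₁) (inj₂ k₂) = contradiction k₂ (not-both-lower k₁)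

    g₁ g₂ : Subset N
    g₁ = choose tie₁ tie₂
    g₂ = choose tie₂ tie₁

    opposite₂₁ : Opposite tie₂ tie₁
    opposite₂₁ = opposite-swap opposite₁₂

    g₁≢g₂ : g₁ ≢ g₂
    g₁≢g₂ e = Chosen.j∉choose opposite₂₁ (subst (j tie₁ ∈ˢ_) e (Chosen.choose-j opposite₁₂))

    G⇔ : ∀ g → G g ⇔ (g ≡ g₁ ⊎ g ≡ g₂)
    G⇔ g = mk⇔ (λ Gg → optimal⇒choose (proj₁ Gg) (G⇒optimal (Chosen.choose-isChoice opposite₁₂) (Median.optimal opposite₁₂) Gg)) back
      where
      back : g ≡ g₁ ⊎ g ≡ g₂ → G g
      back (inj₁ e) = subst G (sym e) (optimal⇒G (Chosen.choose-isChoice opposite₁₂) (Median.optimal opposite₁₂))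
      back (inj₂ e) = subst G (sym e) (optimal⇒G (Chosen.choose-isChoice opposite₂₁) (Median.optimal opposite₂₁))

    -- The symmetry about s/2 and the extreme values.

    In𝒮 : ℕ → Set
    In𝒮 y = ∃ λ l → l ∈ˢ 𝒮 × y ≡ β l

    tie-in𝒮 : ∀ (T : Tie s) → In𝒮 (β (j T)) × In𝒮 (β (k T))
    tie-in𝒮 T = (j T , Near.∈𝒮 (near-tie-j T) , refl) , (k T , Near.∈𝒮 (near-tie-k T) , refl)

    uncommon : List ℕ
    uncommon = values (𝒮 ─ (g₁ ∩ g₂))

    ∈-uncommon⁺ : ∀ {y} → In𝒮 y → InT tie₁ tie₂ y ⊎ InT tie₂ tie₁ y → y ∈ uncommon
    ∈-uncommon⁺ (l , l∈𝒮 , e) i = subst (_∈ uncommon) (sym e) (∈-values⁺ (x∈p∧x∉q⇒x∈p─q l∈𝒮 (excluded i)))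
      where
      excluded : InT tie₁ tie₂ _ ⊎ InT tie₂ tie₁ _ → ¬ l ∈ˢ g₁ ∩ g₂
      excluded (inj₁ i) l∈ = proj₂ (∈-choose⁻ tie₁ tie₂ (proj₁ (x∈p∩q⁻ g₁ g₂ l∈))) (subst (InT tie₁ tie₂) e i)
      excluded (inj₂ i) l∈ = proj₂ (∈-choose⁻ tie₂ tie₁ (proj₂ (x∈p∩q⁻ g₁ g₂ l∈))) (subst (InT tie₂ tie₁) e i)

    ∈-uncommon⁻ : ∀ {y} → y ∈ uncommon → InT tie₁ tie₂ y ⊎ InT tie₂ tie₁ y
    ∈-uncommon⁻ {y} y∈ = from (∈-values⁻ {𝒮 ─ (g₁ ∩ g₂)} y∈)
      where
      from : (∃ λ l → l ∈ˢ 𝒮 ─ (g₁ ∩ g₂) × y ≡ β l) → InT tie₁ tie₂ y ⊎ InT tie₂ tie₁ y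
      from (l , l∈ , e) = decidable-stable (inT? tie₁ tie₂ y ⊎-dec inT? tie₂ tie₁ y) λ neither →
        proj₂ (∈-─⁻ l∈) (x∈p∩q⁺
          ( ∈-choose⁺ tie₁ tie₂ (proj₁ (∈-─⁻ l∈)) (neither ∘ inj₁ ∘ subst (InT tie₁ tie₂) (sym e))
          , ∈-choose⁺ tie₂ tie₁ (proj₁ (∈-─⁻ l∈)) (neither ∘ inj₂ ∘ subst (InT tie₂ tie₁) (sym e))))

    -- Reflection exchanges what the two choices leave over: an end of a tie rejected by one choice
    -- goes to the opposite end, which the other choice rejects, while `us` and `ls` are exchanged.
    complement : ∀ {T T′ x} → InT T T′ x → ∃ λ y → In𝒮 y × InT T′ T y × x + y ≡ s
    complement {T} {T′} (inj₁ (here e))  = β (k T′) , proj₂ (tie-in𝒮 T′) , inj₂ (here refl) , trans (cong (_+ β (k T′)) e) (j+k≡s T′)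
    complement {T} {T′} (inj₂ (here e))  = β (j T) , proj₁ (tie-in𝒮 T) , inj₁ (here refl) , trans (+-comm _ (β (j T))) (trans (cong (β (j T) +_) e) (j+k≡s T))
    complement {T} {T′} (inj₁ (there u∈)) = from (complement⁺ u∈)
      where
      from : ∀ {u} → (∃ λ l → l ∈ ls × u + l ≡ s) → ∃ λ y → In𝒮 y × InT T′ T y × u + y ≡ s
      from (l , l∈ , e) = l , ls⊆𝒮 l∈ , inj₂ (there l∈) , e
    complement {T} {T′} (inj₂ (there l∈)) = from (complement⁻ l∈)
      where
      from : ∀ {l} → (∃ λ u → u ∈ us × u + l ≡ s) → ∃ λ y → In𝒮 y × InT T′ T y × l + y ≡ s
      from {l} (u , u∈ , e) = u , us⊆𝒮 u∈ , inj₁ (there u∈) , trans (+-comm l u) e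

    stable : IsStable s uncommon
    stable {x} x∈ = reflect (∈-uncommon⁻ x∈)
      where
      difference : ∀ {y} → x + y ≡ s → ℤ.+ y ≡ ℤ.+ s ℤ.- ℤ.+ x
      difference {y} e = trans (cancel (ℤ.+ x) (ℤ.+ y)) (cong (λ s → ℤ.+ s ℤ.- ℤ.+ x) e)
        where
        cancel : ∀ x y → y ≡ x ℤ.+ y ℤ.- x
        cancel = ℤ-solve-∀
      reflect : InT tie₁ tie₂ x ⊎ InT tie₂ tie₁ x → ∃ λ y → y ∈ uncommon × ℤ.+ y ≡ ℤ.+ s ℤ.- ℤ.+ x
      reflect (inj₁ i) = from (complement {tie₁} {tie₂} i)
        where
        from : (∃ λ y → In𝒮 y × InT tie₂ tie₁ y × x + y ≡ s) →
               ∃ λ y → y ∈ uncommon × ℤ.+ y ≡ ℤ.+ s ℤ.- ℤ.+ x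
        from (y , y∈𝒮 , i′ , e) = y , ∈-uncommon⁺ y∈𝒮 (inj₂ i′) , difference e
      reflect (inj₂ i) = from (complement {tie₂} {tie₁} i)
        where
        from : (∃ λ y → In𝒮 y × InT tie₁ tie₂ y × x + y ≡ s) →
               ∃ λ y → y ∈ uncommon × ℤ.+ y ≡ ℤ.+ s ℤ.- ℤ.+ x
        from (y , y∈𝒮 , i′ , e) = y , ∈-uncommon⁺ y∈𝒮 (inj₁ i′) , difference e

    private
      classmate : ∀ {l} → l ∈ˢ 𝒮 → ∃ λ l′ → l′ ∈ˢ 𝒮 × l′ ≢ l × residue l′ ≡ residue l
      classmate {l} l∈𝒮 with Fin.any? (λ l′ → ¬? (l′ Fin.≟ l) ×-dec residue l′ Fin.≟ residue l)
      ... | yes (l′ , ne , same) = l′ , ∈-𝒮⁺ (subst (_∈ˢ ℰ) (sym same) (∈-𝒮⁻ l∈𝒮)) , ne , same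
      ... | no ∄l′ = contradiction (∈-ℰ⁻ (∈-𝒮⁻ l∈𝒮)) (subst (λ m → ¬ 2 ≤ m)
        (sym (∣∣≡1⁺ (class (residue l)) (∈-class⁺ {residue l} {l} refl) λ {l′} l′∈ →
          decidable-stable (l′ Fin.≟ l) λ ne → ∄l′ (l′ , ne , ∈-class⁻ l′∈)))
        λ { (s≤s ()) })

      minimum : ∃ λ m → m ∈ˢ 𝒮 × (∀ l → l ∈ˢ 𝒮 → β m ≤ β l)
      minimum = minimizer β (_∈? 𝒮) (j tie₁) (Near.∈𝒮 (near-tie-j tie₁))

      -- Indices run against values, so the least index in `𝒮` carries the largest value.
      maximum : ∃ λ m → m ∈ˢ 𝒮 × (∀ l → l ∈ˢ 𝒮 → toℕ m ≤ toℕ l)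
      maximum = minimizer toℕ (_∈? 𝒮) (j tie₁) (Near.∈𝒮 (near-tie-j tie₁))

      lo hi : Fin N
      lo = proj₁ minimum
      hi = proj₁ maximum

      lo∈𝒮 : lo ∈ˢ 𝒮
      lo∈𝒮 = proj₁ (proj₂ minimum)

      hi∈𝒮 : hi ∈ˢ 𝒮
      hi∈𝒮 = proj₁ (proj₂ maximum)

      lo≤ : ∀ {y} → In𝒮 y → β lo ≤ y
      lo≤ (l , l∈ , e) = ≤-trans (proj₂ (proj₂ minimum) l l∈) (≤-reflexive (sym e))

      ≤hi : ∀ {y} → In𝒮 y → y ≤ β hi
      ≤hi (l , l∈ , e) = ≤-trans (≤-reflexive e) (byIndex (m≤n⇒m<n∨m≡n (proj₂ (proj₂ maximum) l l∈)))
        where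
        byIndex : toℕ hi < toℕ l ⊎ toℕ hi ≡ toℕ l → β l ≤ β hi
        byIndex (inj₁ hi<l) = <⇒≤ (β-decreasing hi<l)
        byIndex (inj₂ hi≡l) = ≤-reflexive (cong β (sym (Fin.toℕ-injective hi≡l)))

      -- Let y follow the maximum in its class. With a sum below `s`, y would lie in `ls` and its
      -- reflection in `us` would exceed the maximum. With a larger sum the maximum lies in `us` and
      -- has its reflection in `ls`; in a tie the reflection is y.
      hi-complement : ∃ λ y → In𝒮 y × β hi + y ≡ s
      hi-complement = from (classmate hi∈𝒮)
        where
        from : (∃ λ l → l ∈ˢ 𝒮 × l ≢ hi × residue l ≡ residue hi) → ∃ λ y → In𝒮 y × β hi + y ≡ s
        from (l , l∈𝒮 , l≢hi , same) = next (lower hi l (sym same) (≤∧≢⇒< (≤hi (l , l∈𝒮 , refl)) (l≢hi ∘ β-injective)))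
          where
          next : (∃ λ y → (β hi , y) ∈ 𝒫 × β l ≤ y) → ∃ λ y → In𝒮 y × β hi + y ≡ s
          next (y , q∈ , _) = byOrder (<-cmp (β hi + y) s)
            where
            byOrder : Tri (β hi + y < s) (β hi + y ≡ s) (s < β hi + y) → ∃ λ y → In𝒮 y × β hi + y ≡ s
            byOrder (tri> _ _ s<) = found (complement⁺ (cover⁺ q∈ s<))
              where
              found : (∃ λ z → z ∈ ls × β hi + z ≡ s) → ∃ λ y → In𝒮 y × β hi + y ≡ s
              found (z , z∈ , e) = z , ls⊆𝒮 z∈ , e
            byOrder (tri< <s _ _) = contradiction (proj₁ (proj₂ partner′)) (too-large (proj₂ (proj₂ partner′)))
              where
              partner′ : ∃ λ u → u ∈ us × u + y ≡ s
              partner′ = complement⁻ (cover⁻ q∈ <s)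
              too-large : ∀ {u} → u + y ≡ s → ¬ u ∈ us
              too-large {u} e u∈ = <⇒≱ (+-cancelʳ-< y (β hi) u (subst (β hi + y <_) (sym e) <s)) (≤hi (us⊆𝒮 u∈))
            byOrder (tri≈ _ e _) = whichTie (cover⁼ q∈ e)
              where
              whichTie : (β hi ≡ β (j tie₁) × y ≡ β (k tie₁)) ⊎ (β hi ≡ β (j tie₂) × y ≡ β (k tie₂)) →
                         ∃ λ y → In𝒮 y × β hi + y ≡ s
              whichTie (inj₁ (_ , e′)) = y , subst In𝒮 (sym e′) (proj₂ (tie-in𝒮 tie₁)) , e
              whichTie (inj₂ (_ , e′)) = y , subst In𝒮 (sym e′) (proj₂ (tie-in𝒮 tie₂)) , e

      lo-complement : ∃ λ x → In𝒮 x × x + β lo ≡ s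
      lo-complement = from (classmate lo∈𝒮)
        where
        from : (∃ λ l → l ∈ˢ 𝒮 × l ≢ lo × residue l ≡ residue lo) → ∃ λ x → In𝒮 x × x + β lo ≡ s
        from (l , l∈𝒮 , l≢lo , same) = next (upper l lo same (≤∧≢⇒< (lo≤ (l , l∈𝒮 , refl)) (l≢lo ∘ β-injective ∘ sym)))
          where
          next : (∃ λ x → (x , β lo) ∈ 𝒫 × x ≤ β l) → ∃ λ x → In𝒮 x × x + β lo ≡ s
          next (x , q∈ , _) = byOrder (<-cmp (x + β lo) s)
            where
            byOrder : Tri (x + β lo < s) (x + β lo ≡ s) (s < x + β lo) → ∃ λ x → In𝒮 x × x + β lo ≡ s
            byOrder (tri< <s _ _) = found (complement⁻ (cover⁻ q∈ <s))
              where
              found : (∃ λ u → u ∈ us × u + β lo ≡ s) → ∃ λ x → In𝒮 x × x + β lo ≡ s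
              found (u , u∈ , e) = u , us⊆𝒮 u∈ , e
            byOrder (tri> _ _ s<) = contradiction (proj₁ (proj₂ partner′)) (too-small (proj₂ (proj₂ partner′)))
              where
              partner′ : ∃ λ z → z ∈ ls × x + z ≡ s
              partner′ = complement⁺ (cover⁺ q∈ s<)
              too-small : ∀ {z} → x + z ≡ s → ¬ z ∈ ls
              too-small {z} e z∈ = <⇒≱ (+-cancelˡ-< x z (β lo) (subst (_< x + β lo) (sym e) s<)) (lo≤ (ls⊆𝒮 z∈))
            byOrder (tri≈ _ e _) = whichTie (cover⁼ q∈ e)
              where
              whichTie : (x ≡ β (j tie₁) × β lo ≡ β (k tie₁)) ⊎ (x ≡ β (j tie₂) × β lo ≡ β (k tie₂)) →
                         ∃ λ x → In𝒮 x × x + β lo ≡ s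
              whichTie (inj₁ (e′ , _)) = x , subst In𝒮 (sym e′) (proj₁ (tie-in𝒮 tie₁)) , e
              whichTie (inj₂ (e′ , _)) = x , subst In𝒮 (sym e′) (proj₁ (tie-in𝒮 tie₂)) , e

    -- The reflections of the maximum and of the minimum both lie in `𝒮`; the first bounds the
    -- minimum from above, the second the maximum from below.
    extremes : ∃₂ λ m M → IsMin m (values 𝒮) × IsMax M (values 𝒮) × m + M ≡ s
    extremes = β lo , β hi ,
      (∈-values⁺ lo∈𝒮 , λ x∈ → lo≤ (∈-values⁻ {𝒮} x∈)) ,
      (∈-values⁺ hi∈𝒮 , λ x∈ → ≤hi (∈-values⁻ {𝒮} x∈)) ,
      ≤-antisym (low hi-complement) (high lo-complement)
      where
      low : (∃ λ y → In𝒮 y × β hi + y ≡ s) → β lo + β hi ≤ s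
      low (y , y∈ , e) = ≤-trans (≤-reflexive (+-comm (β lo) (β hi))) (≤-trans (+-monoʳ-≤ (β hi) (lo≤ y∈)) (≤-reflexive e))
      high : (∃ λ x → In𝒮 x × x + β lo ≡ s) → s ≤ β lo + β hi
      high (x , x∈ , e) = ≤-trans (≤-reflexive (sym e)) (≤-trans (+-monoˡ-≤ (β lo) (≤hi x∈)) (≤-reflexive (+-comm (β hi) (β lo))))

  Conclusion : Set
  Conclusion = 2 ∣ t × (∃₂ λ (g₁ g₂ : Subset N) →
    (g₁ ≢ g₂ × (∀ g → G g ⇔ (g ≡ g₁ ⊎ g ≡ g₂))) ×
    (∃ λ s → τ ≡ just s ×
      (∃₂ λ m M → IsMin m (values 𝒮) × IsMax M (values 𝒮) × m + M ≡ s) ×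
      IsStable s (values (𝒮 ─ (g₁ ∩ g₂)))))

  conclude : ∀ s r′ → Structure s r′ → τ ≡ just s → Conclusion
  conclude s r′ st τ≡ = even st , Optimum.g₁ s r′ st , Optimum.g₂ s r′ st ,
    (Optimum.g₁≢g₂ s r′ st , Optimum.G⇔ s r′ st) , s , τ≡ , Optimum.extremes s r′ st , Optimum.stable s r′ st

  -- The position of τ among the sums of pairs.

  module _ (singular : ConstantTermKernel.ConstantTermsSingular t r β) where
    σ : ℕ × ℕ → ℕ
    σ (x , y) = x + y

    private
      length-filter-map : ∀ {p} {P : ℕ → Set p} (P? : Decidable P) (qs : List (ℕ × ℕ)) →
                          length (filter P? (map σ qs)) ≡ length (filter (P? ∘ σ) qs)
      length-filter-map P? [] = refl
      length-filter-map P? (q ∷ qs) with P? (σ q)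
      ... | yes _ = cong suc (length-filter-map P? qs)
      ... | no _  = length-filter-map P? qs

      u≤∑u : ∀ {m} (u : Fin m → ℕ) j → u j ≤ ∑ u
      u≤∑u u zero    = ≤-trans (m≤m+n (u zero) _) (≤-reflexive (sym (∑-suc u)))
      u≤∑u u (suc j) = ≤-trans (u≤∑u (u ∘ suc) j) (≤-trans (m≤n+m _ (u zero)) (≤-reflexive (sym (∑-suc u))))

    module _ (s r′ : ℕ) (r≡1+r′ : r ≡ suc r′) (#>s : #> s Δs ≤ r′) (#<s : #< s Δs + suc r′ ≤ length Δs) where

      Us Ls Es : List (ℕ × ℕ)
      Us = filter ((s <?_) ∘ σ) 𝒫
      Ls = filter ((_<? s) ∘ σ) 𝒫
      Es = filter ((_≟ s) ∘ σ) 𝒫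

      -- A crude common bound for `s` and all `β j`, which also ensures c ≤ 4e for both thresholds.
      e : ℕ
      e = ∑ β + s

      private
        β≤e : ∀ j → β j ≤ e
        β≤e j = ≤-trans (u≤∑u β j) (m≤m+n _ s)

        s≤e : s ≤ e
        s≤e = m≤n+m s _

        |Δs| : length Δs ≡ suc r′ + suc r′
        |Δs| = trans (cong length Δs≡) (trans (length-map _ 𝒫) (trans length-𝒫 (trans (*-comm r 2)
          (trans (cong (r +_) (+-identityʳ r)) (cong₂ _+_ r≡1+r′ r≡1+r′)))))

        |Us|≤r′ : length Us ≤ r′
        |Us|≤r′ = subst (_≤ r′) (trans (cong (#> s) Δs≡) (length-filter-map (s <?_) 𝒫)) #>s

        |Ls|≤1+r′ : length Ls ≤ suc r′
        |Ls|≤1+r′ = +-cancelʳ-≤ (suc r′) _ _ (subst₂ (λ a b → a + suc r′ ≤ b)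
          (trans (cong (#< s) Δs≡) (length-filter-map (_<? s) 𝒫)) |Δs| #<s)

        total : length Us + length Ls + length Es ≡ suc r′ + suc r′
        total = trans (sym (cong₂ _+_ (cong₂ _+_ (length-filter-map (s <?_) 𝒫) (length-filter-map (_<? s) 𝒫)) (length-filter-map (_≟ s) 𝒫)))
          (trans (trichotomy s (map σ 𝒫)) (trans (sym (cong length Δs≡)) |Δs|))

        ∈Us : ∀ {x y} → (x , y) ∈ 𝒫 → s < x + y → (x , y) ∈ Us
        ∈Us = ∈-filter⁺ ((s <?_) ∘ σ)

        ∈Ls : ∀ {x y} → (x , y) ∈ 𝒫 → x + y < s → (x , y) ∈ Ls
        ∈Ls = ∈-filter⁺ ((_<? s) ∘ σ)

        ∈Es : ∀ {x y} → (x , y) ∈ 𝒫 → x + y ≡ s → (x , y) ∈ Es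
        ∈Es = ∈-filter⁺ ((_≟ s) ∘ σ)

        positive : 1 ≤ length Ls → 0 < s
        positive h with ∃∈ Ls h
          where
          ∃∈ : ∀ (qs : List (ℕ × ℕ)) → 1 ≤ length qs → ∃ (_∈ qs)
          ∃∈ (q ∷ _) _ = q , here refl
        ... | q , q∈ = ≤-<-trans z≤n (proj₂ (∈-filter⁻ ((_<? s) ∘ σ) {xs = 𝒫} q∈))

        -- The one case that the order statistic leaves open. If r sums lay below `s`, the other r
        -- would be at least `s`, and c = 2s - 1 would separate the two groups without any tie. A
        -- sum below `s` makes `s` positive, so that 2s ∸ 1 is odd.
        |Ls|≢1+r′ : length Ls ≢ suc r′
        |Ls|≢1+r′ |Ls|≡ = PairKernel.no-balanced-threshold t r β β-injective inhabited singular 𝒫 lower upper (2 * s ∸ 1) e β≤e c≤4e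
          (map proj₁ (Us ++ Es)) (map proj₂ Ls)
          (≤-reflexive (trans (length-map proj₁ (Us ++ Es)) (trans (length-++ Us)
            (trans (+-cancelˡ-≡ (suc r′) _ _ (trans (sym rearranged) total)) (sym r≡1+r′)))))
          (≤-reflexive (trans (length-map proj₂ Ls) (trans |Ls|≡ (sym r≡1+r′))))
          (λ {x} {y} q∈ c≤ → ∈-map⁺ proj₁ (above q∈ (m≤n⇒m<n∨m≡n (s≤ (x + y) c≤))))
          (λ {x} {y} q∈ ≤c → ∈-map⁺ proj₂ (∈Ls q∈ (<s (x + y) ≤c)))
          where
          c≤4e : 2 * s ∸ 1 ≤ 4 * e
          c≤4e = ≤-trans (m∸n≤m (2 * s) 1) (≤-trans (*-monoʳ-≤ 2 s≤e) (*-monoˡ-≤ e {2} {4} (s≤s (s≤s z≤n))))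
          rearranged : length Us + length Ls + length Es ≡ suc r′ + (length Us + length Es)
          rearranged = trans (cong (λ l → length Us + l + length Es) |Ls|≡) (swap (length Us) (suc r′) (length Es))
            where
            swap : ∀ a b c → a + b + c ≡ b + (a + c)
            swap = solve-∀
          s>0 : 0 < s
          s>0 = positive (subst (1 ≤_) (sym |Ls|≡) (s≤s z≤n))
          s≤ : ∀ m → 2 * s ∸ 1 ≤ 2 * m → s ≤ m
          s≤ m = Halves.odd≤even s>0
          <s : ∀ m → 2 * m ≤ 2 * s ∸ 1 → m < s
          <s m = Halves.even≤odd s>0
          above : ∀ {x y} → (x , y) ∈ 𝒫 → s < x + y ⊎ s ≡ x + y → (x , y) ∈ Us ++ Es
          above q∈ (inj₁ s<) = ∈-++⁺ˡ (∈Us q∈ s<)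
          above q∈ (inj₂ s≡) = ∈-++⁺ʳ Us (∈Es q∈ (sym s≡))

        |Ls|≤r′ : length Ls ≤ r′
        |Ls|≤r′ = s≤s⁻¹ (≤∧≢⇒< |Ls|≤1+r′ |Ls|≢1+r′)

        Es-unique : Unique Es
        Es-unique = Unique.filter⁺ ((_≟ s) ∘ σ) 𝒫-unique

        tie : ∀ {q} → q ∈ Es → ∃ λ (T : Tie s) → q ≡ (β (Tie.j T) , β (Tie.k T))
        tie q∈ = mkTie (proj₁ (∈-filter⁻ ((_≟ s) ∘ σ) {xs = 𝒫} q∈)) (proj₂ (∈-filter⁻ ((_≟ s) ∘ σ) {xs = 𝒫} q∈))

        separate : ∀ {q q′} (q∈ : q ∈ Es) (q′∈ : q′ ∈ Es) → q ≢ q′ →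
                   residue (Tie.j (proj₁ (tie q∈))) ≢ residue (Tie.j (proj₁ (tie q′∈)))
        separate q∈ q′∈ q≢q′ same = q≢q′ (same-pair (tie q∈) (tie q′∈) same)
          where
          same-pair : ∀ {q q′ : ℕ × ℕ} (t₁ : ∃ λ (T : Tie s) → q ≡ (β (Tie.j T) , β (Tie.k T)))
                  (t₂ : ∃ λ (T : Tie s) → q′ ≡ (β (Tie.j T) , β (Tie.k T))) →
                  residue (Tie.j (proj₁ t₁)) ≡ residue (Tie.j (proj₁ t₂)) → q ≡ q′
          same-pair (T₁ , e₁) (T₂ , e₂) same′ = trans e₁ (trans
            (cong₂ _,_ (proj₁ (tie-class T₁ T₂ same′)) (proj₂ (tie-class T₁ T₂ same′))) (sym e₂))

        |Es|≥2 : 2 ≤ length Es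
        |Es|≥2 = +-cancelˡ-≤ (r′ + r′) _ _ (≤-trans (≤-reflexive (trans (tidy r′) (sym total)))
          (+-monoˡ-≤ (length Es) (+-mono-≤ |Us|≤r′ |Ls|≤r′)))
          where
          tidy : ∀ m → m + m + 2 ≡ suc m + suc m
          tidy = solve-∀

        -- Distinct ties have distinct residues with equal doubles. The residues of a second and a
        -- third tie would both be the half turn of the first, hence equal.
        twoTies : ∀ qs → Es ≡ qs → ∃₂ λ q₁ q₂ → Es ≡ q₁ ∷ q₂ ∷ []
        twoTies []           e = contradiction (subst (λ l → 2 ≤ length l) e |Es|≥2) λ ()
        twoTies (_ ∷ [])     e = contradiction (subst (λ l → 2 ≤ length l) e |Es|≥2) λ { (s≤s ()) }
        twoTies (q₁ ∷ q₂ ∷ []) e = q₁ , q₂ , e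
        twoTies (q₁ ∷ q₂ ∷ q₃ ∷ qs) e = contradiction
          (residue≡⇔ (halfTurn-unique {ρ (j (tieOf 1∈))} (m%n<n (β (j (tieOf 2∈))) t) (m%n<n (β (j (tieOf 3∈))) t)
            (ties-halfTurn (tieOf 1∈) (tieOf 2∈) (separate 1∈ 2∈ (All.lookup (AllPairs.head uniq) (here refl))))
            (ties-halfTurn (tieOf 1∈) (tieOf 3∈) (separate 1∈ 3∈ (All.lookup (AllPairs.head uniq) (there (here refl)))))))
          (separate 2∈ 3∈ (All.lookup (AllPairs.head (AllPairs.tail uniq)) (here refl)))
          where
          open Tie
          uniq : Unique (q₁ ∷ q₂ ∷ q₃ ∷ qs)
          uniq = subst Unique e Es-unique
          tieOf : ∀ {q} → q ∈ Es → Tie s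
          tieOf q∈ = proj₁ (tie q∈)
          1∈ : q₁ ∈ Es
          1∈ = subst (q₁ ∈_) (sym e) (here refl)
          2∈ : q₂ ∈ Es
          2∈ = subst (q₂ ∈_) (sym e) (there (here refl))
          3∈ : q₃ ∈ Es
          3∈ = subst (q₃ ∈_) (sym e) (there (there (here refl)))

        assemble : ∀ q₁ q₂ → Es ≡ q₁ ∷ q₂ ∷ [] → Structure s r′
        assemble q₁ q₂ Es≡ = record
          { r≡1+r′ = r≡1+r′ ; configuration = configuration
          ; complement⁺ = PairKernel.Ties.complement⁺ t r β β-injective inhabited singular 𝒫 lower upper
              s e β≤e s≤e r′ r≡1+r′ configuration
          ; complement⁻ = PairKernel.Ties.complement⁻ t r β β-injective inhabited singular 𝒫 lower upper
              s e β≤e s≤e r′ r≡1+r′ configuration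
          }
          where
          1∈ : q₁ ∈ Es
          1∈ = subst (q₁ ∈_) (sym Es≡) (here refl)
          2∈ : q₂ ∈ Es
          2∈ = subst (q₂ ∈_) (sym Es≡) (there (here refl))
          T₁ T₂ : Tie s
          T₁ = proj₁ (tie 1∈)
          T₂ = proj₁ (tie 2∈)
          open Tie
          q₁≢q₂ : q₁ ≢ q₂
          q₁≢q₂ = All.lookup (AllPairs.head (subst Unique Es≡ Es-unique)) (here refl)
          T₁≢T₂ : residue (j T₁) ≢ residue (j T₂)
          T₁≢T₂ = separate 1∈ 2∈ q₁≢q₂
          us ls : List ℕ
          us = map proj₁ Us
          ls = map proj₂ Ls
          -- Two ties leave 2 r′ sums; since at most `r′` lie on either side of `s`, both bounds are
          -- attained.
          both : length Us + length Ls ≡ r′ + r′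
          both = +-cancelʳ-≡ 2 _ _ (trans (cong (λ l → length Us + length Ls + l) (sym (cong length Es≡)))
            (trans total (tidy r′)))
            where
            tidy : ∀ m → suc m + suc m ≡ m + m + 2
            tidy = solve-∀
          squeeze : ∀ {a b c} → a ≤ c → b ≤ c → a + b ≡ c + c → a ≡ c
          squeeze a≤c b≤c eq with m≤n⇒m<n∨m≡n a≤c
          ... | inj₁ a<c = contradiction eq (<⇒≢ (+-mono-<-≤ a<c b≤c))
          ... | inj₂ a≡c = a≡c
          |us| : length us ≡ r′
          |us| = trans (length-map proj₁ Us) (squeeze |Us|≤r′ |Ls|≤r′ both)
          |ls| : length ls ≡ r′
          |ls| = trans (length-map proj₂ Ls) (squeeze |Ls|≤r′ |Us|≤r′ (trans (+-comm (length Ls) _) both))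
          Us⊆ : ∀ {q} → q ∈ Us → q ∈ 𝒫 × s < σ q
          Us⊆ = ∈-filter⁻ ((s <?_) ∘ σ) {xs = 𝒫}
          Ls⊆ : ∀ {q} → q ∈ Ls → q ∈ 𝒫 × σ q < s
          Ls⊆ = ∈-filter⁻ ((_<? s) ∘ σ) {xs = 𝒫}
          us-unique : Unique us
          us-unique = unique-map (λ p q → first-determines (proj₁ (Us⊆ p)) (proj₁ (Us⊆ q)))
            (Unique.filter⁺ ((s <?_) ∘ σ) 𝒫-unique)
          ls-unique : Unique ls
          ls-unique = unique-map (λ p q → second-determines (proj₁ (Ls⊆ p)) (proj₁ (Ls⊆ q)))
            (Unique.filter⁺ ((_<? s) ∘ σ) 𝒫-unique)
          us-sound : ∀ {x} → x ∈ us → ∃ λ y → (x , y) ∈ 𝒫 × s < x + y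
          us-sound x∈ = finish (∈-map⁻ proj₁ x∈)
            where
            finish : ∀ {x} → (∃ λ q → q ∈ Us × x ≡ proj₁ q) → ∃ λ y → (x , y) ∈ 𝒫 × s < x + y
            finish ((_ , y) , q∈ , refl) = y , Us⊆ q∈
          ls-sound : ∀ {y} → y ∈ ls → ∃ λ x → (x , y) ∈ 𝒫 × x + y < s
          ls-sound y∈ = finish (∈-map⁻ proj₂ y∈)
            where
            finish : ∀ {y} → (∃ λ q → q ∈ Ls × y ≡ proj₂ q) → ∃ λ x → (x , y) ∈ 𝒫 × x + y < s
            finish ((x , _) , q∈ , refl) = x , Ls⊆ q∈
          cover⁺ : ∀ {x y} → (x , y) ∈ 𝒫 → s < x + y → x ∈ us
          cover⁺ q∈ h = ∈-map⁺ proj₁ (∈Us q∈ h)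
          cover⁻ : ∀ {x y} → (x , y) ∈ 𝒫 → x + y < s → y ∈ ls
          cover⁻ q∈ h = ∈-map⁺ proj₂ (∈Ls q∈ h)
          cover⁼ : ∀ {x y} → (x , y) ∈ 𝒫 → x + y ≡ s →
                   (x ≡ β (j T₁) × y ≡ β (k T₁)) ⊎ (x ≡ β (j T₂) × y ≡ β (k T₂))
          cover⁼ {x} {y} q∈ h = identify (subst ((x , y) ∈_) Es≡ (∈Es q∈ h))
            where
            components : ∀ {q} (T : Tie s) → (x , y) ≡ q → q ≡ (β (j T) , β (k T)) → x ≡ β (j T) × y ≡ β (k T)
            components T refl e = cong proj₁ e , cong proj₂ e
            identify : (x , y) ∈ q₁ ∷ q₂ ∷ [] → (x ≡ β (j T₁) × y ≡ β (k T₁)) ⊎ (x ≡ β (j T₂) × y ≡ β (k T₂))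
            identify (here e)         = inj₁ (components T₁ e (proj₂ (tie 1∈)))
            identify (there (here e)) = inj₂ (components T₂ e (proj₂ (tie 2∈)))
          us⊆β : ∀ {u} → u ∈ us → ∃ λ l → u ≡ β l
          us⊆β u∈ = Consecutive.hi pair , Consecutive.x≡ pair
            where pair = sound (proj₁ (proj₂ (us-sound u∈)))
          j∉us : ∀ (T : Tie s) → ¬ β (j T) ∈ us
          j∉us T j∈us = tie-not-above T (proj₁ (proj₂ (us-sound j∈us))) (proj₂ (proj₂ (us-sound j∈us)))
          k∉ls : ∀ (T : Tie s) → ¬ β (k T) ∈ ls
          k∉ls T k∈ls = tie-not-below T (proj₁ (proj₂ (ls-sound k∈ls))) (proj₂ (proj₂ (ls-sound k∈ls)))
          configuration : Configuration s r′
          configuration = record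
            { tie₁ = T₁ ; tie₂ = T₂ ; us = us ; ls = ls
            ; distinct = T₁≢T₂ ; us-unique = us-unique ; ls-unique = ls-unique
            ; |us| = |us| ; |ls| = |ls| ; us-sound = us-sound ; ls-sound = ls-sound ; us⊆β = us⊆β
            ; j∉us = j∉us ; k∉ls = k∉ls ; cover⁺ = cover⁺ ; cover⁻ = cover⁻ ; cover⁼ = cover⁼
            }

      structure : Structure s r′
      structure with twoTies Es refl
      ... | q₁ , q₂ , Es≡ = assemble q₁ q₂ Es≡

    conclusion : 1 ≤ r → Conclusion
    conclusion 1≤r = fromSpec (kthLargest-spec r′ Δs (subst (r′ <_) (sym length-Δs)
        (≤-trans (≤-reflexive (sym r≡1+r′)) (m≤m*n r 2))))
      where
      r′ = pred r
      r≡1+r′ : r ≡ suc r′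
      r≡1+r′ = sym (suc-pred r {{>-nonZero 1≤r}})
      fromSpec : (∃ λ s → kthLargest (suc r′) Δs ≡ just s × #> s Δs ≤ r′ × #< s Δs + suc r′ ≤ length Δs) →
                 Conclusion
      fromSpec (s , kth , gt , lt) = conclude s r′ (structure s r′ r≡1+r′ gt lt)
        (subst (λ k → kthLargest k Δs ≡ just s) (sym r≡1+r′) kth)

open import Defs
open import Algebra.Apartness.Bundles using (HeytingField)
open import Data.Fin.Base using (Fin)
open import Data.Fin.Subset using (Subset; _∩_; _─_)
open import Data.Maybe.Base using (just)
open import Data.Nat.Base using (ℕ; _+_; _*_; _≤_; NonZero)
open import Data.Nat.Divisibility.Core using (_∣_)
open import Data.Product.Base using (_×_; ∃; ∃₂)
open import Data.Sum.Base using (_⊎_)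
open import Data.Vec.Functional using (Vector)
open import Function.Bundles using (_⇔_)
open import Relation.Binary.PropositionalEquality.Core using (_≡_; _≢_)

corollary8p34 : ∀ {c ℓ₁ ℓ₂} (K : HeytingField c ℓ₁ ℓ₂) → Schur.CharacteristicZero K →
    (t r : ℕ) .{{_ : NonZero t}} → 2 ≤ t → 1 ≤ r →
    (ζ : HeytingField.Carrier K) → Schur.IsPrimitiveRoot K t ζ →
    (lam : Vector ℕ (t + r * 2)) → IsPartition lam →
    let open Beads t r lam in
    Schur.VanishesIdentically K t r ζ lam →
    (∀ (i : Fin t) → 1 ≤ n i) →
    2 ∣ t ×
    (∃₂ λ (g₁ g₂ : Subset N) →
    (g₁ ≢ g₂ × (∀ g → G g ⇔ (g ≡ g₁ ⊎ g ≡ g₂))) ×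
    (∃ λ s → τ ≡ just s ×
    (∃₂ λ m M → IsMin m (values 𝒮) × IsMax M (values 𝒮) × m + M ≡ s) ×
    IsStable s (values (𝒮 ─ (g₁ ∩ g₂)))))
corollary8p34 K char0 t r 2≤t 1≤r ζ prim lam isPartition vanishes n≥1 =
  BeadConfiguration.conclusion t r lam isPartition n≥1
    (VanishingSchur.constantTermsSingular K char0 t r ζ prim lam vanishes) 1≤r
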